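{- For any prime power $k$, and also for $k=1$, $$ z(k^2+k+1-h) = \begin{cases} k^3+2k^2+2k+1 & \text{for } h=0,\\ k^3+2k^2 & \text{for } h=1,\\ k^3+2k^2-2k & \text{for } h=2,\\ k^3+2k^2-4k+1 & \text{for } h=3. \end{cases} $$
   Context: For a nonnegative integer $n$, $z(n)$ denotes the Zarankiewicz number $z(n,n;2,2)$: the maximum number of edges in a subgraph of the complete bipartite graph $K_{n,n}$ that does not contain $K_{2,2}=C_4$ (the 4-cycle) as a subgraph (not necessarily induced). Equivalently, $z(n)$ is the maximum number of 1's in an $n\times n$ 0-1 matrix with no $2\times 2$ submatrix (rows and columns not necessarily consecutive) consisting entirely of 1's. For $n=0$ (which occurs for $k=1$, $h=3$) the graph $K_{0,0}$ is empty and $z(0)=0$. A prime power is a number $p^a$ with $p$ prime and $a\ge 1$. -}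

module Defs where

open import Data.Bool.Base using (Bool; true; false)
open import Data.Fin.Base using (Fin)
open import Data.Fin.Properties using (_≟_; any?)
open import Data.Fin.Subset using (Subset; _∈_; ∣_∣) renaming (⊥ to ∅)
open import Data.Fin.Subset.Properties using (_∈?_; ∉⊥)
open import Data.List.Base as List using (List; filter; cartesianProductWith)
open import Data.List.Extrema.Nat using (argmax; argmax-all; f[xs]≤f[argmax])
import Data.List.Membership.Propositional as ListMem
open import Data.List.Membership.Propositional.Properties
  using (∈-cartesianProductWith⁺; ∈-filter⁺)
import Data.List.Relation.Unary.All as All
open import Data.List.Relation.Unary.All.Properties using (all-filter)
open import Data.List.Relation.Unary.Any using (here; there)
open import Data.Nat.Base using (ℕ; zero; suc; _^_; _≤_)
open import Data.Nat.Primality using (Prime)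
open import Data.Product using (_×_; _,_; ∃; ∃₂; proj₁)
open import Data.Vec.Base as Vec using (Vec; []; _∷_; lookup; replicate)
open import Data.Vec.Properties using (lookup-replicate)
open import Relation.Binary.PropositionalEquality using (_≡_; _≢_; refl; subst)
open import Relation.Nullary using (¬_; Dec; ¬?; _×-dec_)

PrimePower : ℕ → Set
PrimePower k = ∃₂ λ p a → Prime p × 1 ≤ a × k ≡ p ^ a

-- A subgraph of K_{n,n}, given by its biadjacency matrix: the u-th row is the
-- set of neighbours of the left vertex u.  Isolated vertices are immaterial.
Subgraph : ℕ → Set
Subgraph n = Vec (Subset n) n

Adjacent : ∀ {n} → Subgraph n → Fin n → Fin n → Set
Adjacent G u v = v ∈ lookup G u

edges : ∀ {n} → Subgraph n → ℕ
edges G = Vec.sum (Vec.map ∣_∣ G)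

ContainsK₂₂ : ∀ {n} → Subgraph n → Set
ContainsK₂₂ G = ∃₂ λ u u′ → ∃₂ λ v v′ →
  u ≢ u′ × v ≢ v′ ×
  Adjacent G u v × Adjacent G u v′ × Adjacent G u′ v × Adjacent G u′ v′

K₂₂-free : ∀ {n} → Subgraph n → Set
K₂₂-free G = ¬ ContainsK₂₂ G

IsZarankiewicz : ℕ → ℕ → Set
IsZarankiewicz n m =
  (∃ λ (G : Subgraph n) → K₂₂-free G × edges G ≡ m) ×
  (∀ (G : Subgraph n) → K₂₂-free G → edges G ≤ m)

containsK₂₂? : ∀ {n} (G : Subgraph n) → Dec (ContainsK₂₂ G)
containsK₂₂? G = any? λ u → any? λ u′ → any? λ v → any? λ v′ →
  ¬? (u ≟ u′) ×-dec ¬? (v ≟ v′) ×-dec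
  (v ∈? lookup G u) ×-dec (v′ ∈? lookup G u) ×-dec
  (v ∈? lookup G u′) ×-dec (v′ ∈? lookup G u′)

K₂₂-free? : ∀ {n} (G : Subgraph n) → Dec (K₂₂-free G)
K₂₂-free? G = ¬? (containsK₂₂? G)

emptyGraph : ∀ n → Subgraph n
emptyGraph n = replicate n ∅

emptyGraph-K₂₂-free : ∀ n → K₂₂-free (emptyGraph n)
emptyGraph-K₂₂-free n (u , _ , v , _ , _ , _ , uv , _) =
  ∉⊥ (subst (v ∈_) (lookup-replicate u ∅) uv)

allVecs : ∀ {A : Set} → List A → ∀ n → List (Vec A n)
allVecs xs zero    = [] List.∷ List.[]
allVecs xs (suc n) = cartesianProductWith _∷_ xs (allVecs xs n)

∈-allVecs : ∀ {A : Set} {xs : List A} → (∀ x → x ListMem.∈ xs) →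
            ∀ {n} (v : Vec A n) → v ListMem.∈ allVecs xs n
∈-allVecs complete []      = here refl
∈-allVecs complete (x ∷ v) =
  ∈-cartesianProductWith⁺ _∷_ (complete x) (∈-allVecs complete v)

bools : List Bool
bools = false List.∷ true List.∷ List.[]

∈-bools : ∀ b → b ListMem.∈ bools
∈-bools false = here refl
∈-bools true  = there (here refl)

allSubgraphs : ∀ n → List (Subgraph n)
allSubgraphs n = allVecs (allVecs bools n) n

∈-allSubgraphs : ∀ {n} (G : Subgraph n) → G ListMem.∈ allSubgraphs n
∈-allSubgraphs = ∈-allVecs (∈-allVecs ∈-bools)

zarankiewicz : ∀ n → ∃ (IsZarankiewicz n)
zarankiewicz n = edges best , (best , best-free , refl) , best-max
  where
  candidates : List (Subgraph n)
  candidates = filter K₂₂-free? (allSubgraphs n)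

  best : Subgraph n
  best = argmax edges (emptyGraph n) candidates

  best-free : K₂₂-free best
  best-free = argmax-all edges (emptyGraph-K₂₂-free n)
                         (all-filter K₂₂-free? (allSubgraphs n))

  best-max : ∀ G → K₂₂-free G → edges G ≤ edges best
  best-max G free = All.lookup (f[xs]≤f[argmax] (emptyGraph n) candidates)
                               (∈-filter⁺ K₂₂-free? (∈-allSubgraphs G) free)

z : ℕ → ℕ
z n = proj₁ (zarankiewicz n)

{-# OPTIONS --safe #-}
module Submission where

-- Upper bounds. Let a line with s points have defect k + 1 − s and a point on d lines defect
-- k + 1 − d; both kinds of defect have the same sum. Counting the points joined to p shows that
-- the lines through p have total defect at least h − k · defect(p). If no defect is negative,
-- averaging over p settles h ≤ 2, and for h = 3 it produces a point of defect 1 on lines of size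
-- k + 1 only: the k − 3 points not joined to it lie on too few lines to meet each line of size
-- k + 1 that misses it. Lines with more than k + 1 points (and dually such points) are excluded by
-- the Kővári–Sós–Turán–Roman count on what is left after deleting such a line with its points,
-- where for h = 3 and large k a second line or a point of low degree has to be deleted as well.
--
-- Lower bounds. Delete up to three vertices and sides of a triangle from a projective plane of
-- order k. For k = pᵃ the plane is coordinatised by a finite domain of characteristic p, obtained
-- from 𝔽ₚ[X] / (X^(k−1) − 1), in which all y satisfy y^k = y, by dividing by zero divisors as long
-- as the product of the X^(p^d) − X with 0 < d < a survives. Then X has a distinct conjugates, so
-- the polynomials of degree < a in X have distinct values, and these are all roots of y^k = y.
-- Existence of the plane is only shown up to double negation, which suffices since the claims are
-- equations between integers.

-- With one edge more than claimed, the total defect is at most D = -1, k - 1, 2k - 2, 3k - 4 for h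
-- = 0, 1, 2, 3. For h = 1, 2 and nonnegative defects, a point of defect y has lines of total defect
-- X ≥ h - h y; the sum of X is at most k D, so (k + h) D ≥ h n, which is false. For h = 3 these
-- weights are no longer enough, since (k + 3) D - 3n = 2k - 6. The weights 3 - 2y would give the
-- contradiction (k + 2) D - 3n = -k - 2, but X ≥ 3 - 2y fails precisely where y = 1 and X = 0. This
-- is the origin of the exceptional point.
--
-- For the field, no irreducible polynomial has to be found. Dividing by zero divisors ends because
-- each division merges two of finitely many residue classes. The surviving product keeps the
-- quotient large enough for k distinct elements, and y^k = y allows no more. Membership in the
-- ideals that occur is not decided, hence the double negation.

-- Polynomials modulo p as operators on a periodic sequence

module ShiftOperators where

  open import Algebra.Bundles using (CommutativeRing)
  open import Data.Nat using (ℕ; suc; _+_; _*_; NonZero)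
  open import Data.Nat.Properties
  open import Data.Nat.DivMod using (_%_; %-distribˡ-+; %-distribˡ-*; m*n%n≡0)
  open import Data.Product using (_,_)
  open import Level using (0ℓ)
  open import Relation.Binary.PropositionalEquality using (_≡_; refl; sym; trans; cong; cong₂)

  -- Polynomials with coefficients in ℕ, acting on sequences with X as the shift.
  data Poly : Set where
    con : ℕ → Poly
    X : Poly
    _⊕_ _⊗_ : Poly → Poly → Poly

  act : Poly → (ℕ → ℕ) → ℕ → ℕ
  act (con c) s i = c * s i
  act X s i = s (suc i)
  act (P ⊕ Q) s i = act P s i + act Q s i
  act (P ⊗ Q) s i = act P (act Q s) i

  act-cong : ∀ P {s t} → (∀ j → s j ≡ t j) → ∀ i → act P s i ≡ act P t i
  act-cong (con c) e i = cong (c *_) (e i)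
  act-cong X e i = e (suc i)
  act-cong (P ⊕ Q) e i = cong₂ _+_ (act-cong P e i) (act-cong Q e i)
  act-cong (P ⊗ Q) e i = act-cong P (act-cong Q e) i

  act-+ : ∀ P s t i → act P (λ j → s j + t j) i ≡ act P s i + act P t i
  act-+ (con c) s t i = *-distribˡ-+ c (s i) (t i)
  act-+ X s t i = refl
  act-+ (P ⊕ Q) s t i =
    trans (cong₂ _+_ (act-+ P s t i) (act-+ Q s t i)) (+-interchange (act P s i) (act P t i) (act Q s i) (act Q t i))
    where
    open import Algebra.Properties.CommutativeSemigroup +-commutativeSemigroup using () renaming (interchange to +-interchange)
  act-+ (P ⊗ Q) s t i = trans (act-cong P (act-+ Q s t) i) (act-+ P (act Q s) (act Q t) i)

  act-* : ∀ P c s i → act P (λ j → c * s j) i ≡ c * act P s i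
  act-* (con d) c s i = x∙yz≈y∙xz d c (s i)
    where open import Algebra.Properties.CommutativeSemigroup *-commutativeSemigroup using (x∙yz≈y∙xz)
  act-* X c s i = refl
  act-* (P ⊕ Q) c s i =
    trans (cong₂ _+_ (act-* P c s i) (act-* Q c s i)) (sym (*-distribˡ-+ c (act P s i) (act Q s i)))
  act-* (P ⊗ Q) c s i = trans (act-cong P (act-* Q c s) i) (act-* P c (act Q s) i)

  act-shift : ∀ P n s i → act P (λ j → s (n + j)) i ≡ act P s (n + i)
  act-shift (con c) n s i = refl
  act-shift X n s i = cong s (+-suc n i)
  act-shift (P ⊕ Q) n s i = cong₂ _+_ (act-shift P n s i) (act-shift Q n s i)
  act-shift (P ⊗ Q) n s i = trans (act-cong P (act-shift Q n s) i) (act-shift P n (act Q s) i)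

  -- Operators are additive and commute with scalars and shifts, and they are built from scalars and
  -- shifts. This is the commutativity of the ring below.
  act-comm : ∀ P Q s i → act P (act Q s) i ≡ act Q (act P s) i
  act-comm (con c) Q s i = sym (act-* Q c s i)
  act-comm X Q s i = sym (act-shift Q 1 s i)
  act-comm (P ⊕ P′) Q s i =
    trans (cong₂ _+_ (act-comm P Q s i) (act-comm P′ Q s i)) (sym (act-+ Q (act P s) (act P′ s) i))
  act-comm (P ⊗ P′) Q s i =
    trans (act-cong P (act-comm P′ Q s) i) (act-comm P Q (act P′ s) i)

  module _ {d : ℕ} .{{_ : NonZero d}} where

    +-cong-% : ∀ {a b c e} → a % d ≡ b % d → c % d ≡ e % d → (a + c) % d ≡ (b + e) % d
    +-cong-% {a} {b} {c} {e} p q =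
      trans (%-distribˡ-+ a c d) (trans (cong₂ (λ u v → (u + v) % d) p q) (sym (%-distribˡ-+ b e d)))

    *-cong-% : ∀ {a b c e} → a % d ≡ b % d → c % d ≡ e % d → (a * c) % d ≡ (b * e) % d
    *-cong-% {a} {b} {c} {e} p q =
      trans (%-distribˡ-* a c d) (trans (cong₂ (λ u v → (u * v) % d) p q) (sym (%-distribˡ-* b e d)))

    act-cong-% : ∀ P {s t} → (∀ j → s j % d ≡ t j % d) → ∀ i → act P s i % d ≡ act P t i % d
    act-cong-% (con c) e i = *-cong-% {c} refl (e i)
    act-cong-% X e i = e (suc i)
    act-cong-% (P ⊕ Q) {s} {t} e i =
      +-cong-% {act P s i} {act P t i} (act-cong-% P e i) (act-cong-% Q e i)
    act-cong-% (P ⊗ Q) e i = act-cong-% P (act-cong-% Q e) i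

  -- For δ the indicator of the multiples of N this is 𝔽ₚ[X] / (Xᴺ − 1).
  module OperatorRing (p′ : ℕ) (δ : ℕ → ℕ) where

    private
      p : ℕ
      p = suc p′

    -- Comparing values on `δ` alone is enough: operators commute, so agreement on `δ` extends to
    -- every sequence `act R δ`, which makes the relation compatible with products. As a record it
    -- lets `P` and `Q` be inferred.
    record _≈_ (P Q : Poly) : Set where
      constructor ≈-intro
      field at : ∀ i → act P δ i % p ≡ act Q δ i % p
    open _≈_ public

    ≡⇒≈ : ∀ P Q → (∀ i → act P δ i ≡ act Q δ i) → P ≈ Q
    ≡⇒≈ P Q e = ≈-intro λ i → cong (_% p) (e i)

    -- The scalar `p′ = p − 1` is -1 modulo `p`.
    neg : Poly → Poly
    neg P = con p′ ⊗ P

    private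
      ≈-sym : ∀ {P Q} → P ≈ Q → Q ≈ P
      ≈-sym e = ≈-intro λ i → sym (at e i)

      ≈-trans : ∀ {P Q R} → P ≈ Q → Q ≈ R → P ≈ R
      ≈-trans e f = ≈-intro λ i → trans (at e i) (at f i)

      ⊕-cong : ∀ {P P′ Q Q′} → P ≈ P′ → Q ≈ Q′ → (P ⊕ Q) ≈ (P′ ⊕ Q′)
      ⊕-cong {P} {P′} e f = ≈-intro λ i → +-cong-% {p} {act P δ i} {act P′ δ i} (at e i) (at f i)

      ⊗-congʳ : ∀ P {Q Q′} → Q ≈ Q′ → (P ⊗ Q) ≈ (P ⊗ Q′)
      ⊗-congʳ P f = ≈-intro λ i → act-cong-% P (at f) i

      ⊗-comm : ∀ P Q → (P ⊗ Q) ≈ (Q ⊗ P)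
      ⊗-comm P Q = ≡⇒≈ (P ⊗ Q) (Q ⊗ P) (act-comm P Q δ)

      ⊗-cong : ∀ {P P′ Q Q′} → P ≈ P′ → Q ≈ Q′ → (P ⊗ Q) ≈ (P′ ⊗ Q′)
      ⊗-cong {P} {P′} {Q} {Q′} e f =
        ≈-trans (⊗-congʳ P f) (≈-trans (⊗-comm P Q′) (≈-trans (⊗-congʳ Q′ e) (⊗-comm Q′ P′)))

      ⊕-comm : ∀ P Q → (P ⊕ Q) ≈ (Q ⊕ P)
      ⊕-comm P Q = ≡⇒≈ (P ⊕ Q) (Q ⊕ P) λ i → +-comm (act P δ i) (act Q δ i)

      ⊕-identityˡ : ∀ P → (con 0 ⊕ P) ≈ P
      ⊕-identityˡ P = ≡⇒≈ (con 0 ⊕ P) P λ i → refl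

      neg-inverseˡ : ∀ P → (neg P ⊕ P) ≈ con 0
      neg-inverseˡ P = ≈-intro λ i → trans
        (cong (_% p) (trans (+-comm (p′ * act P δ i) (act P δ i)) (*-comm p (act P δ i))))
        (m*n%n≡0 (act P δ i) p)

      ⊗-identityˡ : ∀ P → (con 1 ⊗ P) ≈ P
      ⊗-identityˡ P = ≡⇒≈ (con 1 ⊗ P) P λ i → *-identityˡ (act P δ i)

      ⊗-distribˡ : ∀ P Q R → (P ⊗ (Q ⊕ R)) ≈ ((P ⊗ Q) ⊕ (P ⊗ R))
      ⊗-distribˡ P Q R = ≡⇒≈ (P ⊗ (Q ⊕ R)) ((P ⊗ Q) ⊕ (P ⊗ R)) (act-+ P (act Q δ) (act R δ))

    ring : CommutativeRing 0ℓ 0ℓ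
    ring = record
      { Carrier = Poly
      ; _≈_ = _≈_
      ; _+_ = _⊕_
      ; _*_ = _⊗_
      ; -_ = neg
      ; 0# = con 0
      ; 1# = con 1
      ; isCommutativeRing = record
        { isRing = record
          { +-isAbelianGroup = record
            { isGroup = record
              { isMonoid = record
                { isSemigroup = record
                  { isMagma = record
                    { isEquivalence = record
                      { refl = ≈-intro λ i → refl ; sym = ≈-sym ; trans = ≈-trans }
                    ; ∙-cong = ⊕-cong
                    }
                  ; assoc = λ P Q R → ≡⇒≈ ((P ⊕ Q) ⊕ R) (P ⊕ (Q ⊕ R))
                      λ i → +-assoc (act P δ i) (act Q δ i) (act R δ i)
                  }
                ; identity = ⊕-identityˡ , λ P → ≈-trans (⊕-comm P (con 0)) (⊕-identityˡ P)
                }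
              ; inverse = neg-inverseˡ , λ P → ≈-trans (⊕-comm P (neg P)) (neg-inverseˡ P)
              ; ⁻¹-cong = ⊗-congʳ (con p′)
              }
            ; comm = ⊕-comm
            }
          ; *-cong = ⊗-cong
          ; *-assoc = λ P Q R → ≈-intro λ i → refl
          ; *-identity = ⊗-identityˡ , λ P → ≈-trans (⊗-comm P (con 1)) (⊗-identityˡ P)
          ; distrib = ⊗-distribˡ , λ P Q R → ≈-intro λ i → refl
          }
        ; *-comm = ⊗-comm
        }
      }

-- The Frobenius map in characteristic p

module FrobeniusPower where

  open import Algebra.Bundles using (CommutativeRing)
  open import Data.Fin.Base as Fin using (Fin; zero; suc; toℕ; inject₁; fromℕ)
  open import Data.Fin.Properties using (toℕ<n; toℕ-inject₁; toℕ-fromℕ)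
  open import Data.Nat as ℕ using (ℕ; zero; suc; _<_; s≤s; z≤n; _!)
  open import Data.Nat.Properties as ℕₚ using (_!*_!≢0; <⇒≤)
  open import Data.Nat.Combinatorics using (_C_; nCk≡n!/k![n-k]!; k![n∸k]!∣n!; nCn≡1)
  open import Data.Nat.Divisibility using (_∣_; divides; m∣m*n; ∣⇒≤; ∣1⇒≡1)
  open import Data.Nat.DivMod using (m/n*n≡m)
  open import Data.Nat.Primality using (Prime; euclidsLemma; ¬prime[1])
  open import Data.Sum using (inj₁; inj₂)
  open import Data.Empty using (⊥-elim)
  open import Level using (0ℓ)
  open import Relation.Nullary using (¬_)
  import Relation.Binary.PropositionalEquality as ≡
  open ≡ using (_≡_)

  prime∤! : ∀ {p} → Prime p → ∀ m → m < p → ¬ p ∣ m !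
  prime∤! pr zero _ p∣1 with ≡.refl ← ∣1⇒≡1 p∣1 = ¬prime[1] pr
  prime∤! pr (suc m) m<p p∣ with euclidsLemma (suc m) (m !) pr p∣
  ... | inj₁ p∣m = ℕₚ.<⇒≱ m<p (∣⇒≤ p∣m)
  ... | inj₂ p∣m! = prime∤! pr m (<⇒≤ m<p) p∣m!

  -- The prime divides `p !`, which is the binomial coefficient times `k !` and `(p − k) !`, and it
  -- divides neither of these factorials.
  prime∣C : ∀ {p} → Prime p → ∀ k → 0 < k → k < p → p ∣ p C k
  prime∣C {p@(suc p′)} pr k 0<k k<p
    with euclidsLemma (p C k) (k ! ℕ.* (p ℕ.∸ k) !) pr
           (≡.subst (p ∣_) (≡.sym C*d≡p!) (m∣m*n (p′ !)))
    where
    instance _ = k !* (p ℕ.∸ k) !≢0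
    C*d≡p! : (p C k) ℕ.* (k ! ℕ.* (p ℕ.∸ k) !) ≡ p !
    C*d≡p! = ≡.trans (≡.cong (ℕ._* (k ! ℕ.* (p ℕ.∸ k) !)) (nCk≡n!/k![n-k]! (<⇒≤ k<p)))
                     (m/n*n≡m (k![n∸k]!∣n! (<⇒≤ k<p)))
  ... | inj₁ p∣C = p∣C
  ... | inj₂ p∣d with euclidsLemma (k !) ((p ℕ.∸ k) !) pr p∣d
  ...   | inj₁ p∣k! = ⊥-elim (prime∤! pr k k<p p∣k!)
  ...   | inj₂ p∣! = ⊥-elim (prime∤! pr (p ℕ.∸ k) (ℕₚ.∸-monoʳ-< 0<k (<⇒≤ k<p)) p∣!)

  module Frobenius (R : CommutativeRing 0ℓ 0ℓ) where

    open CommutativeRing R hiding (zero)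
    open import Algebra.Properties.Semiring.Exp semiring public
    open import Algebra.Properties.Semiring.Mult semiring public
    open import Algebra.Properties.CommutativeMonoid.Sum +-commutativeMonoid
      using (sum; sum-cong-≋; sum-init-last; sum-replicate-zero)
    open import Algebra.Properties.CommutativeSemiring.Binomial commutativeSemiring
      using (binomialTerm; theorem)
    open import Algebra.Properties.CommutativeMonoid.Mult *-commutativeMonoid
      public using () renaming (×-distrib-+ to ^-distrib-*)
    open import Relation.Binary.Reasoning.Setoid setoid

    n∣m⇒m×≈0 : ∀ {m n} → n × 1# ≈ 0# → n ∣ m → ∀ x → m × x ≈ 0#
    n∣m⇒m×≈0 {m} {n} n×1≈0 (divides q ≡.refl) x = begin
      (q ℕ.* n) × x               ≈⟨ ×-congʳ (q ℕ.* n) (*-identityˡ x) ⟨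
      (q ℕ.* n) × (1# * x)        ≈⟨ ×-assoc-* (q ℕ.* n) 1# x ⟨
      (q ℕ.* n) × 1# * x          ≈⟨ *-congʳ (×1-homo-* q n) ⟩
      (q × 1#) * (n × 1#) * x     ≈⟨ *-congʳ (*-congˡ n×1≈0) ⟩
      (q × 1#) * 0# * x           ≈⟨ *-congʳ (zeroʳ _) ⟩
      0# * x                      ≈⟨ zeroˡ x ⟩
      0#                          ∎

    1^n≈1 : ∀ n → 1# ^ n ≈ 1#
    1^n≈1 zero = refl
    1^n≈1 (suc n) = trans (*-identityˡ _) (1^n≈1 n)

    0^n≈0 : ∀ n → 0 < n → 0# ^ n ≈ 0#
    0^n≈0 (suc n) _ = zeroˡ _

    module _ {p : ℕ} (pr : Prime p) (p×1≈0 : p × 1# ≈ 0#) where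

      frobenius : ∀ x y → (x + y) ^ p ≈ x ^ p + y ^ p
      frobenius x y = go p pr p×1≈0
        where
        go : ∀ p → Prime p → p × 1# ≈ 0# → (x + y) ^ p ≈ x ^ p + y ^ p
        go p@(suc p′) pr p×1≈0 = begin
          (x + y) ^ p                                        ≈⟨ theorem p x y ⟩
          t zero + sum (λ j → t (suc j))                     ≈⟨ +-cong first (sum-init-last (λ j → t (suc j))) ⟩
          y ^ p + (sum (λ j → t (suc (inject₁ j))) + t (suc (fromℕ p′)))
            ≈⟨ +-congˡ (+-cong (trans (sum-cong-≋ middle) (sum-replicate-zero p′)) last) ⟩
          y ^ p + (0# + x ^ p)                               ≈⟨ +-congˡ (+-identityˡ _) ⟩
          y ^ p + x ^ p                                      ≈⟨ +-comm _ _ ⟩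
          x ^ p + y ^ p                                      ∎
          where
          t : Fin (suc p) → Carrier
          t = binomialTerm x y p
          first : t zero ≈ y ^ p
          first = trans (+-identityʳ _) (*-identityˡ _)
          middle : ∀ j → t (suc (inject₁ j)) ≈ 0#
          middle j = n∣m⇒m×≈0 p×1≈0
            (prime∣C pr (suc (toℕ (inject₁ j))) (s≤s z≤n)
              (s≤s (≡.subst (_< p′) (≡.sym (toℕ-inject₁ j)) (toℕ<n j)))) _
          last : t (suc (fromℕ p′)) ≈ x ^ p
          last rewrite toℕ-fromℕ p′ | nCn≡1 p | ℕₚ.n∸n≡0 p′ = trans (+-identityʳ _) (*-identityʳ _)

      frobenius^ : ∀ a x y → (x + y) ^ (p ℕ.^ a) ≈ x ^ (p ℕ.^ a) + y ^ (p ℕ.^ a)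
      frobenius^ zero x y = trans (*-identityʳ _) (sym (+-cong (*-identityʳ _) (*-identityʳ _)))
      frobenius^ (suc a) x y = begin
        (x + y) ^ (p ℕ.* p ℕ.^ a)              ≈⟨ ^-assocʳ _ p (p ℕ.^ a) ⟨
        ((x + y) ^ p) ^ (p ℕ.^ a)              ≈⟨ ^-congˡ (p ℕ.^ a) (frobenius x y) ⟩
        (x ^ p + y ^ p) ^ (p ℕ.^ a)            ≈⟨ frobenius^ a (x ^ p) (y ^ p) ⟩
        (x ^ p) ^ (p ℕ.^ a) + (y ^ p) ^ (p ℕ.^ a)
          ≈⟨ +-cong (^-assocʳ x p (p ℕ.^ a)) (^-assocʳ y p (p ℕ.^ a)) ⟩
        x ^ (p ℕ.* p ℕ.^ a) + y ^ (p ℕ.* p ℕ.^ a) ∎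

      -- Fermat's little theorem, by induction on `n` from the additivity of the `p`-th power.
      ×1-frobenius : ∀ n → (n × 1#) ^ p ≈ n × 1#
      ×1-frobenius zero = 0^n≈0 p (prime>0 pr)
        where
        prime>0 : ∀ {p} → Prime p → 0 < p
        prime>0 {suc _} _ = s≤s z≤n
      ×1-frobenius (suc n) = trans (frobenius 1# (n × 1#)) (+-cong (1^n≈1 p) (×1-frobenius n))

-- Quotients by ideals and the existence of a prime quotient

module Congruences where

  open import Algebra.Bundles using (CommutativeRing)
  open import Data.Fin.Base using (Fin; zero; suc; punchOut)
  open import Data.Fin.Properties using (_≟_; punchOut-injective)
  open import Data.Nat using (ℕ; zero; suc)
  open import Data.Product using (Σ; ∃; _×_; _,_)
  open import Level using (0ℓ)
  open import Relation.Nullary using (¬_; yes; no)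
  import Relation.Binary.PropositionalEquality as ≡
  open ≡ using (_≡_)

  -- A quotient ring is kept as a coarser equality on the same carrier. Stability under double
  -- negation replaces decidability: it allows arguments by contradiction about membership in an
  -- ideal.
  record Congruence (R : CommutativeRing 0ℓ 0ℓ) : Set₁ where

    open CommutativeRing R

    infix 4 _~_
    field
      _~_ : Carrier → Carrier → Set
      ≈⇒~ : ∀ {x y} → x ≈ y → x ~ y
      ~-sym : ∀ {x y} → x ~ y → y ~ x
      ~-trans : ∀ {x y z} → x ~ y → y ~ z → x ~ z
      ~-+-cong : ∀ {x y u v} → x ~ y → u ~ v → x + u ~ y + v
      ~-*-cong : ∀ {x y u v} → x ~ y → u ~ v → x * u ~ y * v
      ~-stable : ∀ {x y} → ¬ ¬ x ~ y → x ~ y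

    open import Algebra.Properties.Ring ring using (-1*x≈-x)

    quotient : CommutativeRing 0ℓ 0ℓ
    quotient = record
      { Carrier = Carrier ; _≈_ = _~_ ; _+_ = _+_ ; _*_ = _*_ ; -_ = -_ ; 0# = 0# ; 1# = 1#
      ; isCommutativeRing = record
        { isRing = record
          { +-isAbelianGroup = record
            { isGroup = record
              { isMonoid = record
                { isSemigroup = record
                  { isMagma = record
                    { isEquivalence = record { refl = ≈⇒~ refl ; sym = ~-sym ; trans = ~-trans }
                    ; ∙-cong = ~-+-cong
                    }
                  ; assoc = λ x y z → ≈⇒~ (+-assoc x y z)
                  }
                ; identity = (λ x → ≈⇒~ (+-identityˡ x)) , (λ x → ≈⇒~ (+-identityʳ x))
                }
              ; inverse = (λ x → ≈⇒~ (-‿inverseˡ x)) , (λ x → ≈⇒~ (-‿inverseʳ x))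
              ; ⁻¹-cong = λ {x} {y} x~y → ~-trans (≈⇒~ (sym (-1*x≈-x x)))
                  (~-trans (~-*-cong (≈⇒~ refl) x~y) (≈⇒~ (-1*x≈-x y)))
              }
            ; comm = λ x y → ≈⇒~ (+-comm x y)
            }
          ; *-cong = ~-*-cong
          ; *-assoc = λ x y z → ≈⇒~ (*-assoc x y z)
          ; *-identity = (λ x → ≈⇒~ (*-identityˡ x)) , (λ x → ≈⇒~ (*-identityʳ x))
          ; distrib = (λ x y z → ≈⇒~ (distribˡ x y z)) , (λ x y z → ≈⇒~ (distribʳ x y z))
          }
        ; *-comm = λ x y → ≈⇒~ (*-comm x y)
        }
      }

  module PrimeQuotient (R : CommutativeRing 0ℓ 0ℓ) where

    open CommutativeRing R using (Carrier; _+_; _*_; -_; 0#; 1#)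
    open Congruence using (quotient)

    module _ (C : Congruence R) where

      open Congruence C using (_~_; ~-stable)
      open CommutativeRing (quotient C) using (refl; sym; trans; +-cong; +-congˡ; +-congʳ; *-cong; *-congˡ; *-congʳ;
        zeroˡ; zeroʳ; +-identityˡ; +-identityʳ; *-identityˡ; +-assoc; distribʳ; -‿inverseʳ)
      open import Algebra.Solver.Ring.NaturalCoefficients.Default (CommutativeRing.commutativeSemiring (quotient C))
        using (solve; _:=_; _:+_; _:*_)

      -- Equality modulo the further generator `a`; the double negation around the cofactor `c`
      -- makes the relation stable.
      adjoin : Carrier → Congruence R
      adjoin a = record
        { _~_ = λ x y → ¬ ¬ ∃ λ c → x ~ y + c * a
        ; ≈⇒~ = λ {x} {y} e k → k (0# , trans (Congruence.≈⇒~ C e) (sym (trans (+-congˡ (zeroˡ a)) (+-identityʳ y))))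
        ; ~-sym = λ {x} {y} x~y k → x~y λ (c , e) → k (- c , trans
            (cancel y c) (+-congʳ (sym e)))
        ; ~-trans = λ {x} {y} {z} x~y y~z k → x~y λ (c , e) → y~z λ (d , f) → k (d + c , trans
            (trans e (+-congʳ f)) (solve 4 (λ z d c a → (z :+ d :* a) :+ c :* a := z :+ (d :+ c) :* a) refl z d c a))
        ; ~-+-cong = λ {x} {y} {u} {v} x~y u~v k → x~y λ (c , e) → u~v λ (d , f) → k (c + d , trans (+-cong e f)
            (solve 5 (λ y v c d a → (y :+ c :* a) :+ (v :+ d :* a) := (y :+ v) :+ (c :+ d) :* a) refl y v c d a))
        ; ~-*-cong = λ {x} {y} {u} {v} x~y u~v k → x~y λ (c , e) → u~v λ (d , f) →
            k (y * d + c * v + c * a * d , trans (*-cong e f) (solve 5 (λ y v c d a →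
              (y :+ c :* a) :* (v :+ d :* a) := y :* v :+ (y :* d :+ c :* v :+ c :* a :* d) :* a) refl y v c d a))
        ; ~-stable = λ k l → k λ m → m l
        }
        where
        cancel : ∀ y c → y ~ (y + c * a) + (- c) * a
        cancel y c = sym (trans (+-assoc y (c * a) ((- c) * a)) (trans (+-congˡ (trans (sym (distribʳ a c (- c)))
          (trans (*-congʳ (-‿inverseʳ c)) (zeroˡ a)))) (+-identityʳ y)))

      module _ (a : Carrier) {m : ℕ} (sig : Carrier → Fin (suc m))
               (sig-inj : ∀ x y → sig x ≡ sig y → x ~ y) (a≁0 : ¬ a ~ 0#) where

        open Congruence (adjoin a) using () renaming (_~_ to _≋_; ~-sym to ≋-sym; ~-trans to ≋-trans)

        ~⇒≋ : ∀ {x y} → x ~ y → x ≋ y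
        ~⇒≋ {x} {y} e k = k (0# , trans e (sym (trans (+-congˡ (zeroˡ a)) (+-identityʳ y))))

        a≋0 : a ≋ 0#
        a≋0 k = k (1# , sym (trans (+-identityˡ _) (*-identityˡ a)))

        sig-a≢sig-0 : ¬ sig a ≡ sig 0#
        sig-a≢sig-0 e = a≁0 (sig-inj a 0# e)

        merge : Carrier → Fin m
        merge x with sig a ≟ sig x
        ... | yes _ = punchOut sig-a≢sig-0
        ... | no a≢x = punchOut a≢x

        merge-inj : ∀ x y → merge x ≡ merge y → x ≋ y
        merge-inj x y e with sig a ≟ sig x | sig a ≟ sig y
        ... | yes p | yes q = ~⇒≋ (sig-inj x y (≡.trans (≡.sym p) q))
        ... | yes p | no q = ≋-trans (~⇒≋ (sig-inj x a (≡.sym p)))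
                               (≋-trans a≋0 (~⇒≋ (sig-inj 0# y (punchOut-injective _ q e))))
        ... | no p | yes q = ≋-trans (~⇒≋ (sig-inj x 0# (punchOut-injective p _ e)))
                               (≋-trans (≋-sym a≋0) (~⇒≋ (sig-inj a y q)))
        ... | no p | no q = ~⇒≋ (sig-inj x y (punchOut-injective p q e))

      -- If `g` is a multiple of `a` and of `b`, then `g * g` is a multiple of `a * b` and hence
      -- zero.
      ab~0⇒reduced : ∀ {a b g} → a * b ~ 0# → (g * g ~ 0# → g ~ 0#) →
                     Congruence._~_ (adjoin a) g 0# → Congruence._~_ (adjoin b) g 0# → g ~ 0#
      ab~0⇒reduced {a} {b} {g} ab~0 red g∈a g∈b = ~-stable λ g≁0 → g∈a λ (c , e) → g∈b λ (d , f) →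
        g≁0 (red (trans (*-cong e f) (trans
          (solve 5 (λ z a b c d → (z :+ c :* a) :* (z :+ d :* b) := z :* (z :+ d :* b :+ c :* a) :+ (c :* d) :* (a :* b)) refl 0# a b c d)
          (trans (+-cong (zeroˡ _) (trans (*-congˡ ab~0) (zeroʳ _))) (+-identityˡ 0#)))))

    IsDomain : Congruence R → Set
    IsDomain C = ∀ {a b} → a * b ~ 0# → ¬ a ~ 0# → b ~ 0#
      where open Congruence C

    -- While ab ~ 0 with a, b ≁ 0, dividing by a or by b keeps g nonzero and loses a class of sig.
    primeQuotient : ∀ g → (∀ (C : Congruence R) → let open Congruence C in g * g ~ 0# → g ~ 0#) →
      ∀ m (C : Congruence R) (sig : Carrier → Fin m) →
      (∀ x y → sig x ≡ sig y → Congruence._~_ C x y) → ¬ Congruence._~_ C g 0# →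
      ¬ ¬ Σ (Congruence R) λ D → ¬ Congruence._~_ D g 0# × IsDomain D
    primeQuotient g red zero C sig inj g≁0 k with () ← sig 0#
    -- Since `k` refutes every prime quotient, the recursion shows that each nonzero `a` has `g` in
    -- its ideal. Two nonzero elements with product zero would then make `g` zero, so `C` itself is
    -- a domain.
    primeQuotient g red (suc m) C sig inj g≁0 k = k (C , g≁0 , λ {a} {b} ab~0 a≁0 → ~-stable λ b≁0 →
      g≁0 (ab~0⇒reduced C ab~0 (red C) (in-ideal a a≁0) (in-ideal b b≁0)))
      where
      open Congruence C
      in-ideal : ∀ a → ¬ a ~ 0# → Congruence._~_ (adjoin C a) g 0#
      in-ideal a a≁0 = Congruence.~-stable (adjoin C a) {g} {0#} λ g∉ →
        primeQuotient g red m (adjoin C a) (merge C a sig inj a≁0) (merge-inj C a sig inj a≁0) g∉ k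

-- Coordinates from a domain in which y^q = y

module FiniteDomains where

  open import Algebra.Bundles using (CommutativeRing)
  open import Data.Empty using (⊥-elim)
  open import Data.Fin.Base using (Fin; zero; suc; toℕ; finToFun; funToFin; combine; fromℕ)
  open import Data.Fin.Properties using (toℕ<n; toℕ-injective; funToFin-finToFin; suc-injective)
  open import Data.Nat as ℕ using (ℕ; zero; suc; _≤_; _<_; s≤s; z≤n; s≤s⁻¹)
  open import Data.Nat.Properties as ℕₚ using (<-cmp)
  open import Data.Nat.Coprimality using (coprime-Bézout; prime⇒coprime)
  open import Data.Nat.Divisibility using (divides)
  open import Data.Nat.GCD using (module Bézout)
  open import Data.Nat.Primality using (Prime; prime⇒nonTrivial)
  open import Data.Product using (∃; _,_)
  open import Function using (_∘_)
  open import Level using (0ℓ)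
  open import Relation.Binary.Definitions using (tri<; tri≈; tri>)
  open import Relation.Nullary using (¬_)
  import Relation.Binary.PropositionalEquality as ≡
  open ≡ using (_≡_; _≢_)

  open FrobeniusPower

  -- line m x b plays the role of m x + b.
  record Coordinates (k : ℕ) : Set where
    field
      line : Fin k → Fin k → Fin k → Fin k
      line-injective : ∀ m x {b b′} → line m x b ≡ line m x b′ → b ≡ b′
      slope-unique : ∀ {m m′ x x′ b b′} → x ≢ x′ →
        line m x b ≡ line m′ x b′ → line m x′ b ≡ line m′ x′ b′ → m ≡ m′

  ¬¬-∀ : ∀ n {P : Fin n → Set} → (∀ i → ¬ ¬ P i) → ¬ ¬ (∀ i → P i)
  ¬¬-∀ zero h k = k λ ()
  ¬¬-∀ (suc n) h k = h zero λ p₀ → ¬¬-∀ n (h ∘ suc) λ p → k λ { zero → p₀ ; (suc i) → p i }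

  prime^>0 : ∀ {p} → Prime p → ∀ j → 0 < p ℕ.^ j
  prime^>0 {suc p} _ j = ℕₚ.m^n>0 (suc p) j

  module Domain (K : CommutativeRing 0ℓ 0ℓ) where

    open CommutativeRing K hiding (zero)
    open Frobenius K
    open import Algebra.Properties.Group +-group using (x∙y⁻¹≈ε⇒x≈y; x≈y⇒x∙y⁻¹≈ε)
    open import Algebra.Properties.Ring ring using (-‿distribʳ-*)
    open import Algebra.Solver.Ring.NaturalCoefficients.Default commutativeSemiring
      using (solve; _:=_; _:+_; _:*_)
    open import Relation.Binary.Reasoning.Setoid setoid

    eval : ∀ {n} → (Fin n → Carrier) → Carrier → Carrier
    eval {zero} c y = 0#
    eval {suc n} c y = c zero + y * eval (c ∘ suc) y

    eval-congʳ : ∀ {n} (c : Fin n → Carrier) {x y} → x ≈ y → eval c x ≈ eval c y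
    eval-congʳ {zero} c e = refl
    eval-congʳ {suc n} c e = +-congˡ (*-cong e (eval-congʳ (c ∘ suc) e))

    eval-0 : ∀ {n} {c : Fin n → Carrier} y → (∀ i → c i ≈ 0#) → eval c y ≈ 0#
    eval-0 {zero} y e = refl
    eval-0 {suc n} y e = trans (+-cong (e zero) (trans (*-congˡ (eval-0 y (e ∘ suc))) (zeroʳ y))) (+-identityʳ 0#)

    eval-+ : ∀ {n} (c d : Fin n → Carrier) y → eval (λ i → c i + d i) y ≈ eval c y + eval d y
    eval-+ {zero} c d y = sym (+-identityʳ 0#)
    eval-+ {suc n} c d y = trans (+-congˡ (*-congˡ (eval-+ (c ∘ suc) (d ∘ suc) y)))
      (solve 5 (λ c d y u v → (c :+ d) :+ y :* (u :+ v) := (c :+ y :* u) :+ (d :+ y :* v)) refl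
        (c zero) (d zero) y (eval (c ∘ suc) y) (eval (d ∘ suc) y))

    eval-neg : ∀ {n} (c : Fin n → Carrier) y → eval (λ i → - c i) y ≈ - eval c y
    eval-neg c y = trans (sym (+-identityʳ _)) (trans (+-congˡ (sym (-‿inverseʳ (eval c y))))
      (trans (sym (+-assoc _ _ _)) (trans (+-congʳ (trans (sym (eval-+ (λ i → - c i) c y))
        (eval-0 y (λ i → -‿inverseˡ (c i))))) (+-identityˡ _))))

    -- Synthetic division by y − r.
    quot : ∀ {n} → (Fin (suc n) → Carrier) → Carrier → Fin n → Carrier
    quot {suc n} c r zero = eval (c ∘ suc) r
    quot {suc n} c r (suc j) = quot (c ∘ suc) r j

    -- This is c(y) = c(r) + (y - r) q(y) at `y = r + d`, stated without subtraction so that the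
    -- semiring solver applies.
    factor : ∀ {n} (c : Fin (suc n) → Carrier) r d →
             eval c (r + d) ≈ eval c r + d * eval (quot c r) (r + d)
    factor {zero} c r d =
      trans (+-congˡ (zeroʳ _)) (sym (trans (+-cong (+-congˡ (zeroʳ r)) (zeroʳ d)) (+-identityʳ _)))
    factor {suc n} c r d = trans (+-congˡ (*-congˡ (factor (c ∘ suc) r d)))
      (solve 5 (λ c r d h q → c :+ (r :+ d) :* (h :+ d :* q) := (c :+ r :* h) :+ d :* (h :+ (r :+ d) :* q)) refl
        (c zero) r d (eval (c ∘ suc) r) (eval (quot (c ∘ suc) r) (r + d)))

    -- The quotient has the leading coefficient of `c`, and each lower coefficient of `c` above the
    -- constant one is determined by the quotient and the coefficients above it.
    quot≈0⇒tail≈0 : ∀ {n} (c : Fin (suc n) → Carrier) r →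
                    (∀ j → quot c r j ≈ 0#) → ∀ j → c (suc j) ≈ 0#
    quot≈0⇒tail≈0 {suc n} c r e = λ { zero → head≈0 ; (suc j) → tail≈0 j }
      where
      tail≈0 : ∀ j → c (suc (suc j)) ≈ 0#
      tail≈0 = quot≈0⇒tail≈0 (c ∘ suc) r (e ∘ suc)
      head≈0 : c (suc zero) ≈ 0#
      head≈0 = trans (sym (trans (+-congˡ (trans (*-congˡ (eval-0 r tail≈0)) (zeroʳ r))) (+-identityʳ _))) (e zero)

    module _ (domain : ∀ {a b} → a * b ≈ 0# → ¬ a ≈ 0# → b ≈ 0#) where

      -- After the first root is split off, the domain property makes the quotient vanish at all
      -- remaining roots, so induction kills the quotient and with it everything but the constant
      -- term.
      roots⇒coefficients≈0 : ∀ n (c r : Fin n → Carrier) → (∀ {i j} → r i ≈ r j → i ≡ j) →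
                             (∀ i → eval c (r i) ≈ 0#) → ∀ j → c j ≈ 0#
      roots⇒coefficients≈0 (suc n) c r r-inj e = λ { zero → head≈0 ; (suc j) → tail≈0 j }
        where
        r₀ = r zero
        root : ∀ i → eval (quot c r₀) (r (suc i)) ≈ 0#
        root i = domain (begin
          d * eval (quot c r₀) (r (suc i))              ≈⟨ +-identityˡ _ ⟨
          0# + d * eval (quot c r₀) (r (suc i))         ≈⟨ +-cong (e zero) (*-congˡ (eval-congʳ (quot c r₀) r₀+d)) ⟨
          eval c r₀ + d * eval (quot c r₀) (r₀ + d)     ≈⟨ factor c r₀ d ⟨
          eval c (r₀ + d)                               ≈⟨ eval-congʳ c r₀+d ⟩
          eval c (r (suc i))                            ≈⟨ e (suc i) ⟩
          0#                                            ∎)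
          (λ d≈0 → ⊥-elim (absurd (r-inj (x∙y⁻¹≈ε⇒x≈y (r (suc i)) r₀ d≈0))))
          where
          d = r (suc i) + - r₀
          r₀+d : r₀ + d ≈ r (suc i)
          r₀+d = trans (+-comm r₀ d) (trans (+-assoc _ _ _) (trans (+-congˡ (-‿inverseˡ r₀)) (+-identityʳ _)))
          absurd : ¬ suc i ≡ zero
          absurd ()
        tail≈0 : ∀ j → c (suc j) ≈ 0#
        tail≈0 = quot≈0⇒tail≈0 c r₀ (roots⇒coefficients≈0 n (quot c r₀) (r ∘ suc) (suc-injective ∘ r-inj) root)
        head≈0 : c zero ≈ 0#
        head≈0 = trans (sym (trans (+-congˡ (trans (*-congˡ (eval-0 r₀ tail≈0)) (zeroʳ r₀))) (+-identityʳ _))) (e zero)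

      module _ (stable : ∀ {x y} → ¬ ¬ x ≈ y → x ≈ y) (1≉0 : ¬ 1# ≈ 0#)
               {p : ℕ} (pr : Prime p) (p×1≈0 : p × 1# ≈ 0#)
               (a′ : ℕ) (fixed : ∀ y → y ^ (p ℕ.^ suc a′) ≈ y)
               (θ : Carrier) (θ-moved : ∀ d → d < a′ → ¬ θ ^ (p ℕ.^ suc d) ≈ θ) where

        private
          a q : ℕ
          a = suc a′
          q = p ℕ.^ a

        -- A positive `n` below `p` is coprime to `p`; by Bézout `1#` would be a combination of two
        -- zero multiples.
        ×1≈0⇒≡0 : ∀ {n} → n < p → n × 1# ≈ 0# → n ≡ 0
        ×1≈0⇒≡0 {zero} _ _ = ≡.refl
        ×1≈0⇒≡0 {n@(suc _)} n<p n×1≈0 with coprime-Bézout (prime⇒coprime pr n<p)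
        ... | Bézout.+- x y eq = ⊥-elim (1≉0 (begin
          1#                       ≈⟨ +-identityʳ 1# ⟨
          1# + 0#                  ≈⟨ +-congˡ (n∣m⇒m×≈0 n×1≈0 (divides y ≡.refl) 1#) ⟨
          suc (y ℕ.* n) × 1#       ≡⟨ ≡.cong (_× 1#) eq ⟩
          (x ℕ.* p) × 1#           ≈⟨ n∣m⇒m×≈0 p×1≈0 (divides x ≡.refl) 1# ⟩
          0#                       ∎))
        ... | Bézout.-+ x y eq = ⊥-elim (1≉0 (begin
          1#                       ≈⟨ +-identityʳ 1# ⟨
          1# + 0#                  ≈⟨ +-congˡ (n∣m⇒m×≈0 p×1≈0 (divides x ≡.refl) 1#) ⟨
          suc (x ℕ.* p) × 1#       ≡⟨ ≡.cong (_× 1#) eq ⟩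
          (y ℕ.* n) × 1#           ≈⟨ n∣m⇒m×≈0 n×1≈0 (divides y ≡.refl) 1# ⟩
          0#                       ∎))

        ×1-injective-< : ∀ {m n} → n < p → m < n → ¬ m × 1# ≈ n × 1#
        ×1-injective-< {m} {n} n<p m<n e = ℕₚ.<⇒≢ (ℕₚ.m<n⇒0<n∸m m<n)
          (≡.sym (×1≈0⇒≡0 (ℕₚ.≤-<-trans (ℕₚ.m∸n≤m n m) n<p) (begin
            (n ℕ.∸ m) × 1#                                 ≈⟨ +-identityʳ _ ⟨
            (n ℕ.∸ m) × 1# + 0#                            ≈⟨ +-congˡ (-‿inverseʳ (m × 1#)) ⟨
            (n ℕ.∸ m) × 1# + (m × 1# + - (m × 1#))         ≈⟨ +-assoc _ _ _ ⟨
            ((n ℕ.∸ m) × 1# + m × 1#) + - (m × 1#)         ≈⟨ +-congʳ (×-homo-+ 1# (n ℕ.∸ m) m) ⟨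
            (n ℕ.∸ m ℕ.+ m) × 1# + - (m × 1#)
              ≡⟨ ≡.cong (λ t → t × 1# + - (m × 1#)) (ℕₚ.m∸n+n≡m (ℕₚ.<⇒≤ m<n)) ⟩
            n × 1# + - (m × 1#)                            ≈⟨ x≈y⇒x∙y⁻¹≈ε (sym e) ⟩
            0#                                             ∎)))

        ×1-injective : ∀ {m n} → m < p → n < p → m × 1# ≈ n × 1# → m ≡ n
        ×1-injective {m} {n} m<p n<p e with <-cmp m n
        ... | tri< m<n _ _ = ⊥-elim (×1-injective-< n<p m<n e)
        ... | tri≈ _ m≡n _ = m≡n
        ... | tri> _ _ n<m = ⊥-elim (×1-injective-< m<p n<m (sym e))

        -- Additivity of the `p`-th power gives this without separating `p = 2` from odd `p`.
        frobenius-neg : ∀ y → (- y) ^ p ≈ - (y ^ p)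
        frobenius-neg y = begin
          (- y) ^ p                                ≈⟨ +-identityʳ _ ⟨
          (- y) ^ p + 0#                           ≈⟨ +-congˡ (-‿inverseʳ (y ^ p)) ⟨
          (- y) ^ p + (y ^ p + - (y ^ p))          ≈⟨ +-assoc _ _ _ ⟨
          (- y) ^ p + y ^ p + - (y ^ p)            ≈⟨ +-congʳ (frobenius pr p×1≈0 (- y) y) ⟨
          (- y + y) ^ p + - (y ^ p)                ≈⟨ +-congʳ (^-congˡ p (-‿inverseˡ y)) ⟩
          0# ^ p + - (y ^ p)                       ≈⟨ +-congʳ (×1-frobenius pr p×1≈0 0) ⟩
          0# + - (y ^ p)                           ≈⟨ +-identityˡ _ ⟩
          - (y ^ p)                                ∎

        eval-frobenius : ∀ {n} (c : Fin n → Carrier) → (∀ i → c i ^ p ≈ c i) →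
                         ∀ y → eval c y ^ p ≈ eval c (y ^ p)
        eval-frobenius {zero} c fix y = ×1-frobenius pr p×1≈0 0
        eval-frobenius {suc n} c fix y = begin
          (c zero + y * eval (c ∘ suc) y) ^ p          ≈⟨ frobenius pr p×1≈0 (c zero) (y * eval (c ∘ suc) y) ⟩
          c zero ^ p + (y * eval (c ∘ suc) y) ^ p      ≈⟨ +-cong (fix zero) (^-distrib-* y (eval (c ∘ suc) y) p) ⟩
          c zero + y ^ p * eval (c ∘ suc) y ^ p        ≈⟨ +-congˡ (*-congˡ (eval-frobenius (c ∘ suc) (fix ∘ suc) y)) ⟩
          c zero + y ^ p * eval (c ∘ suc) (y ^ p)      ∎

        -- Frobenius fixes the coefficients, so it carries the value at a point to the value at the
        -- `p`-th power of that point.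
        eval-conjugate : ∀ {n} (c : Fin n → Carrier) → (∀ i → c i ^ p ≈ c i) → eval c θ ≈ 0# →
                         ∀ j → eval c (θ ^ (p ℕ.^ j)) ≈ 0#
        eval-conjugate c fix e j = trans (sym (power j)) (trans (^-congˡ (p ℕ.^ j) e) (0^n≈0 (p ℕ.^ j) (prime^>0 pr j)))
          where
          power : ∀ j → eval c θ ^ (p ℕ.^ j) ≈ eval c (θ ^ (p ℕ.^ j))
          power zero = trans (*-identityʳ _) (sym (eval-congʳ c (*-identityʳ θ)))
          power (suc j) = begin
            eval c θ ^ (p ℕ.* p ℕ.^ j)          ≡⟨ ≡.cong (eval c θ ^_) (ℕₚ.*-comm p (p ℕ.^ j)) ⟩
            eval c θ ^ (p ℕ.^ j ℕ.* p)          ≈⟨ ^-assocʳ (eval c θ) (p ℕ.^ j) p ⟨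
            (eval c θ ^ (p ℕ.^ j)) ^ p          ≈⟨ ^-congˡ p (power j) ⟩
            eval c (θ ^ (p ℕ.^ j)) ^ p          ≈⟨ eval-frobenius c fix _ ⟩
            eval c ((θ ^ (p ℕ.^ j)) ^ p)        ≈⟨ eval-congʳ c (^-assocʳ θ (p ℕ.^ j) p) ⟩
            eval c (θ ^ (p ℕ.^ j ℕ.* p))        ≡⟨ ≡.cong (λ t → eval c (θ ^ t)) (ℕₚ.*-comm (p ℕ.^ j) p) ⟩
            eval c (θ ^ (p ℕ.* p ℕ.^ j))        ∎

        -- Raising θ^(p^i) ≈ θ^(p^j) to the power p^(a-i) gives θ ≈ θ^(p^(j-i)).
        conjugates-distinct-< : ∀ {i j} → i < j → j < a → ¬ θ ^ (p ℕ.^ i) ≈ θ ^ (p ℕ.^ j)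
        conjugates-distinct-< {i} {j} i<j j<a e with ℕₚ.m≤n⇒∃[o]m+o≡n i<j
        ... | d , ≡.refl = θ-moved d
          (ℕₚ.≤-trans (ℕₚ.+-monoˡ-≤ d (s≤s (z≤n {i}))) (s≤s⁻¹ j<a))
          (sym (begin
            θ                                        ≈⟨ fixed θ ⟨
            θ ^ (p ℕ.^ a)                            ≡⟨ ≡.cong (θ ^_) (split i (ℕₚ.<⇒≤ (ℕₚ.<-trans i<j j<a))) ⟩
            θ ^ (p ℕ.^ i ℕ.* r)                      ≈⟨ ^-assocʳ θ (p ℕ.^ i) r ⟨
            (θ ^ (p ℕ.^ i)) ^ r                      ≈⟨ ^-congˡ r e ⟩
            (θ ^ (p ℕ.^ suc (i ℕ.+ d))) ^ r          ≈⟨ ^-assocʳ θ (p ℕ.^ suc (i ℕ.+ d)) r ⟩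
            θ ^ (p ℕ.^ suc (i ℕ.+ d) ℕ.* r)          ≡⟨ ≡.cong (θ ^_) exponent ⟩
            θ ^ (p ℕ.^ a ℕ.* p ℕ.^ suc d)            ≈⟨ ^-assocʳ θ (p ℕ.^ a) (p ℕ.^ suc d) ⟨
            (θ ^ (p ℕ.^ a)) ^ (p ℕ.^ suc d)          ≈⟨ ^-congˡ (p ℕ.^ suc d) (fixed θ) ⟩
            θ ^ (p ℕ.^ suc d)                        ∎))
          where
          r = p ℕ.^ (a ℕ.∸ i)
          split : ∀ i → i ≤ a → p ℕ.^ a ≡ p ℕ.^ i ℕ.* p ℕ.^ (a ℕ.∸ i)
          split i i≤a = ≡.trans (≡.cong (p ℕ.^_) (≡.sym (ℕₚ.m+[n∸m]≡n i≤a))) (ℕₚ.^-distribˡ-+-* p i (a ℕ.∸ i))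
          exponent : p ℕ.^ suc (i ℕ.+ d) ℕ.* r ≡ p ℕ.^ a ℕ.* p ℕ.^ suc d
          exponent = ≡.trans (≡.cong (λ t → p ℕ.^ t ℕ.* r) (≡.trans (≡.sym (ℕₚ.+-suc i d)) (ℕₚ.+-comm i (suc d))))
            (≡.trans (≡.cong (ℕ._* r) (ℕₚ.^-distribˡ-+-* p (suc d) i))
            (≡.trans (ℕₚ.*-assoc (p ℕ.^ suc d) (p ℕ.^ i) r)
            (≡.trans (ℕₚ.*-comm (p ℕ.^ suc d) (p ℕ.^ i ℕ.* r))
            (≡.cong (ℕ._* p ℕ.^ suc d) (≡.sym (split i (ℕₚ.<⇒≤ (ℕₚ.<-trans i<j j<a))))))))

        conjugates-distinct : ∀ {i j : Fin a} → θ ^ (p ℕ.^ toℕ i) ≈ θ ^ (p ℕ.^ toℕ j) → i ≡ j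
        conjugates-distinct {i} {j} e with <-cmp (toℕ i) (toℕ j)
        ... | tri< i<j _ _ = ⊥-elim (conjugates-distinct-< i<j (toℕ<n j) e)
        ... | tri≈ _ i≡j _ = toℕ-injective i≡j
        ... | tri> _ _ j<i = ⊥-elim (conjugates-distinct-< j<i (toℕ<n i) (sym e))

        digits : Fin q → Fin a → Carrier
        digits i j = toℕ (finToFun {p} {a} i j) × 1#

        element : Fin q → Carrier
        element i = eval (digits i) θ

        -- The difference of two such polynomials has `a` coefficients in the prime field. A root
        -- `θ` brings its `a` distinct conjugates as roots, so the difference is zero, and digits
        -- below `p` can be read off from their images.
        element-injective : ∀ {i j} → element i ≈ element j → i ≡ j
        element-injective {i} {j} e = ≡.trans (≡.sym (funToFin-finToFin {a} {p} i))
          (≡.trans (funToFin-cong digits≡) (funToFin-finToFin {a} {p} j))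
          where
          funToFin-cong : ∀ {m n} {f g : Fin m → Fin n} → (∀ l → f l ≡ g l) → funToFin f ≡ funToFin g
          funToFin-cong {zero} h = ≡.refl
          funToFin-cong {suc m} h = ≡.cong₂ combine (h zero) (funToFin-cong (h ∘ suc))
          difference : Fin a → Carrier
          difference l = digits i l + - digits j l
          difference-fix : ∀ l → difference l ^ p ≈ difference l
          difference-fix l = trans (frobenius pr p×1≈0 (digits i l) (- digits j l))
            (+-cong (×1-frobenius pr p×1≈0 (toℕ (finToFun {p} {a} i l)))
              (trans (frobenius-neg (digits j l)) (-‿cong (×1-frobenius pr p×1≈0 (toℕ (finToFun {p} {a} j l))))))
          difference-root : eval difference θ ≈ 0#
          difference-root = trans (eval-+ (digits i) (λ l → - digits j l) θ)
            (trans (+-congˡ (eval-neg (digits j) θ)) (x≈y⇒x∙y⁻¹≈ε e))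
          digits≡ : ∀ l → finToFun {p} {a} i l ≡ finToFun j l
          digits≡ l = toℕ-injective (×1-injective (toℕ<n (finToFun {p} {a} i l)) (toℕ<n (finToFun {p} {a} j l))
            (x∙y⁻¹≈ε⇒x≈y (digits i l) (digits j l)
              (roots⇒coefficients≈0 a difference (λ l → θ ^ (p ℕ.^ toℕ l)) conjugates-distinct
                (λ l → eval-conjugate difference difference-fix difference-root (toℕ l)) l)))

        monomial : ∀ n → Fin (suc n) → Carrier
        monomial zero _ = 1#
        monomial (suc n) zero = 0#
        monomial (suc n) (suc j) = monomial n j

        eval-monomial : ∀ n y → eval (monomial n) y ≈ y ^ n
        eval-monomial zero y = trans (+-congˡ (zeroʳ y)) (+-identityʳ 1#)
        eval-monomial (suc n) y = trans (+-identityˡ _) (*-congˡ (eval-monomial n y))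

        monomial-top : ∀ n → monomial n (fromℕ n) ≈ 1#
        monomial-top zero = refl
        monomial-top (suc n) = monomial-top n

        -- The polynomial Y^q - Y has the `q` values of `element` as roots. A further root would
        -- make all its `q + 1` coefficients vanish, including the leading one.
        element-surjective : ∀ y → ¬ ¬ ∃ λ i → element i ≈ y
        element-surjective y none = 1≉0 (trans (sym (top q q>1)) (coefficients≈0 (fromℕ q)))
          where
          q>1 : 1 < q
          q>1 = ℕₚ.<-≤-trans (ℕ.nonTrivial⇒n>1 p {{prime⇒nonTrivial pr}}) (ℕₚ.≤-trans
            (ℕₚ.≤-reflexive (≡.sym (ℕₚ.*-identityʳ p))) (ℕₚ.*-monoʳ-≤ p (prime^>0 pr a′)))
          minus-linear : ∀ {n} → Fin n → Carrier
          minus-linear zero = 0#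
          minus-linear (suc zero) = - 1#
          minus-linear (suc (suc _)) = 0#
          eval-minus-linear : ∀ n → 1 < n → ∀ y → eval {suc n} minus-linear y ≈ - y
          eval-minus-linear (suc zero) (s≤s ()) y
          eval-minus-linear (suc (suc n)) _ y = trans (+-identityˡ _)
            (trans (*-congˡ (trans (+-congˡ (trans (*-congˡ (eval-0 {suc n} y (λ _ → refl))) (zeroʳ y))) (+-identityʳ _)))
              (trans (sym (-‿distribʳ-* y 1#)) (-‿cong (*-identityʳ y))))
          coefficient : Fin (suc q) → Carrier
          coefficient j = monomial q j + minus-linear j
          -- Here `1 < n` matters: for exponent 1 the two terms of Y^n - Y would cancel at the top.
          top : ∀ n → 1 < n → monomial n (fromℕ n) + minus-linear (fromℕ n) ≈ 1#
          top (suc zero) (s≤s ())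
          top (suc (suc n)) _ = trans (+-identityʳ _) (monomial-top n)
          root : Fin (suc q) → Carrier
          root zero = y
          root (suc i) = element i
          root-injective : ∀ {i j} → root i ≈ root j → i ≡ j
          root-injective {zero} {zero} _ = ≡.refl
          root-injective {zero} {suc j} e = ⊥-elim (none (j , sym e))
          root-injective {suc i} {zero} e = ⊥-elim (none (i , e))
          root-injective {suc i} {suc j} e = ≡.cong suc (element-injective e)
          coefficients≈0 : ∀ j → coefficient j ≈ 0#
          coefficients≈0 = roots⇒coefficients≈0 (suc q) coefficient root root-injective λ i → begin
            eval coefficient (root i)                            ≈⟨ eval-+ (monomial q) minus-linear (root i) ⟩
            eval (monomial q) (root i) + eval {suc q} minus-linear (root i)
              ≈⟨ +-cong (eval-monomial q (root i)) (eval-minus-linear q q>1 (root i)) ⟩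
            root i ^ q + - root i                                ≈⟨ x≈y⇒x∙y⁻¹≈ε (fixed (root i)) ⟩
            0#                                                   ∎

        coordinates : ¬ ¬ Coordinates q
        -- Only finitely many values m x + b occur, so the double negation is drawn out of all of
        -- them at once before `line` is chosen.
        coordinates none = ¬¬-∀ q (λ m → ¬¬-∀ q λ x → ¬¬-∀ q λ b →
          element-surjective (element m * element x + element b)) λ value → none (from value)
          where
          from : (∀ m x b → ∃ λ y → element y ≈ element m * element x + element b) → Coordinates q
          from value = record
            { line = line
            ; line-injective = λ m x {b} {b′} e → element-injective
                (+-cancelˡ (element m * element x) (element b) (element b′) (line-≈ m x b m x b′ e))
            ; slope-unique = λ {m} {m′} {x} {x′} {b} {b′} x≢x′ e e′ → element-injective
                (x∙y⁻¹≈ε⇒x≈y (element m) (element m′) (domain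
                  (slopes (line-≈ m x b m′ x b′ e) (line-≈ m x′ b m′ x′ b′ e′))
                  (λ x≈x′ → x≢x′ (element-injective (x∙y⁻¹≈ε⇒x≈y _ _ x≈x′)))))
            }
            where
            open import Algebra.Properties.Group +-group using () renaming (∙-cancelˡ to +-cancelˡ)
            line : Fin q → Fin q → Fin q → Fin q
            line m x b = let (y , _) = value m x b in y
            line-≈ : ∀ m x b m′ x′ b′ → line m x b ≡ line m′ x′ b′ →
                     element m * element x + element b ≈ element m′ * element x′ + element b′
            line-≈ m x b m′ x′ b′ e with value m x b | value m′ x′ b′
            ... | y , h | y′ , h′ = trans (sym h) (trans (reflexive (≡.cong element e)) h′)
            -- With x = d + x′ and m = s + m′ both hypotheses give d * s ≈ 0.
            slopes : ∀ {m m′ x x′ b b′} → m * x + b ≈ m′ * x + b′ → m * x′ + b ≈ m′ * x′ + b′ →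
                     (x + - x′) * (m + - m′) ≈ 0#
            slopes {m} {m′} {x} {x′} {b} {b′} e e′ =
              +-cancelʳ (m * x′ + b + (m′ * x + b′)) _ _ (begin
                d * s + (m * x′ + b + (m′ * x + b′))
                  ≈⟨ +-congˡ (+-cong (+-congʳ (*-congʳ m≈)) (+-congʳ (*-congˡ x≈))) ⟨
                d * s + ((s + m′) * x′ + b + (m′ * (d + x′) + b′))
                  ≈⟨ solve 6 (λ d s m′ x′ b b′ →
                       d :* s :+ ((s :+ m′) :* x′ :+ b :+ (m′ :* (d :+ x′) :+ b′))
                         := ((s :+ m′) :* (d :+ x′) :+ b) :+ (m′ :* x′ :+ b′)) refl d s m′ x′ b b′ ⟩
                ((s + m′) * (d + x′) + b) + (m′ * x′ + b′)
                  ≈⟨ +-congʳ (+-congʳ (*-cong m≈ x≈)) ⟩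
                (m * x + b) + (m′ * x′ + b′)                       ≈⟨ +-cong e (sym e′) ⟩
                (m′ * x + b′) + (m * x′ + b)                       ≈⟨ +-comm _ _ ⟩
                (m * x′ + b) + (m′ * x + b′)                       ≈⟨ +-identityˡ _ ⟨
                0# + (m * x′ + b + (m′ * x + b′))                  ∎)
              where
              open import Algebra.Properties.Group +-group using () renaming (∙-cancelʳ to +-cancelʳ)
              d = x + - x′
              s = m + - m′
              restore : ∀ u v → (u + - v) + v ≈ u
              restore u v = trans (+-assoc _ _ _) (trans (+-congˡ (-‿inverseˡ v)) (+-identityʳ u))
              x≈ : d + x′ ≈ x
              x≈ = restore x x′
              m≈ : s + m′ ≈ m
              m≈ = restore m m′

-- Coordinates for prime powers, from the ring of operators

module PrimePowerFields where

  open import Algebra.Bundles using (CommutativeRing)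
  open import Data.Fin.Base using (Fin; toℕ; fromℕ<; finToFun; funToFin)
  open import Data.Fin.Properties using (toℕ-fromℕ<; finToFun-funToFin)
  open import Data.Nat as ℕ using (ℕ; zero; suc; _+_; _*_; _∸_; _≤_; _<_; s≤s; s≤s⁻¹; NonZero)
  open import Data.Nat.DivMod using (_%_; _/_; m%n<n; m≡m%n+[m/n]*n; n%n≡0; m<n⇒m%n≡m; m*n%n≡0; [m+n]%n≡m%n)
  open import Data.Nat.Primality using (Prime; prime⇒nonTrivial)
  open import Data.Nat.Properties
  open import Data.Product using (_,_)
  open import Relation.Binary.PropositionalEquality using (_≡_; refl; sym; trans; cong; cong₂; subst; module ≡-Reasoning)
  open import Relation.Nullary using (¬_; yes; no)
  open import Relation.Nullary.Decidable using (decidable-stable)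

  open ShiftOperators
  open FrobeniusPower
  open Congruences
  open FiniteDomains

  -- The leading coefficient of P is read off a sequence vanishing at the d preceding places.
  Monic : Poly → ℕ → Set
  Monic P d = ∀ s i → (∀ j → j < d → s (j + i) ≡ 0) → act P s i ≡ s (d + i)

  -- Of a window of `e + d` zeros, `Q` uses up `e` at each of the first `d` places, which leaves `P`
  -- a window of `d` zeros.
  monic-⊗ : ∀ {P Q d e} → Monic P d → Monic Q e → Monic (P ⊗ Q) (e + d)
  monic-⊗ {P} {Q} {d} {e} monicP monicQ s i vanish =
    trans (monicP (act Q s) i λ j j<d → trans (inner j (<⇒≤ j<d))
            (trans (cong s (sym (+-assoc e j i))) (vanish (e + j) (+-monoʳ-< e j<d))))
      (trans (inner d ≤-refl) (cong s (sym (+-assoc e d i))))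
    where
    inner : ∀ j → j ≤ d → act Q s (j + i) ≡ s (e + (j + i))
    inner j j≤d = monicQ s (j + i) λ l l<e →
      trans (cong s (sym (+-assoc l j i))) (vanish (l + j) (+-mono-<-≤ l<e j≤d))

  module Periodic (N : ℕ) .{{_ : NonZero N}} where

    is0 : ℕ → ℕ
    is0 zero = 1
    is0 (suc _) = 0

    δ : ℕ → ℕ
    δ i = is0 (i % N)

    δ-periodic : ∀ i → δ (N + i) ≡ δ i
    δ-periodic i = cong is0 (trans (cong (_% N) (+-comm N i)) ([m+n]%n≡m%n i N))

    act-periodic : ∀ P i → act P δ (N + i) ≡ act P δ i
    act-periodic P i = trans (sym (act-shift P N δ i)) (act-cong P δ-periodic i)

    -- An operator is thus determined by `N` values on `δ`, which modulo `p` bounds the number of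
    -- classes by `p ^ N`.
    act-% : ∀ P i → act P δ i ≡ act P δ (i % N)
    act-% P i = trans (cong (act P δ) (trans (m≡m%n+[m/n]*n i N) (+-comm (i % N) (i / N * N)))) (drop (i / N) (i % N))
      where
      drop : ∀ k j → act P δ (k * N + j) ≡ act P δ j
      drop zero j = refl
      drop (suc k) j = trans (cong (act P δ) (+-assoc N (k * N) j)) (trans (act-periodic P (k * N + j)) (drop k j))

    -- At place `N − d` the sequence `δ` shows `d` zeros followed by the 1 at `N`, so the leading
    -- coefficient is read off. A monic operator of degree below the period is therefore nonzero
    -- modulo `p`.
    monic-act≡1 : ∀ {P d} → Monic P d → d < N → act P δ (N ∸ d) ≡ 1
    monic-act≡1 {P} {d} monic d<N = trans (monic δ (N ∸ d) vanish)
      (trans (cong δ (m+[n∸m]≡n (<⇒≤ d<N))) (cong is0 (n%n≡0 N)))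
      where
      is0-positive : ∀ {n} → 0 < n → is0 n ≡ 0
      is0-positive {suc n} _ = refl
      vanish : ∀ j → j < d → δ (j + (N ∸ d)) ≡ 0
      vanish j j<d = trans
        (cong is0 (m<n⇒m%n≡m (<-≤-trans (+-monoˡ-< (N ∸ d) j<d) (≤-reflexive (m+[n∸m]≡n (<⇒≤ d<N))))))
        (is0-positive (<-≤-trans (m<n⇒0<n∸m d<N) (m≤n+m (N ∸ d) j)))

  module PrimePowerField (p′ : ℕ) (pr : Prime (suc p′)) (a′ N′ : ℕ) (q≡ : suc p′ ℕ.^ suc a′ ≡ suc (suc N′)) where

    private
      p N : ℕ
      p = suc p′
      N = suc N′

    open Periodic N
    open OperatorRing p′ δ renaming (ring to R)
    open CommutativeRing R using (1#; 0#)
      renaming (refl to ≈-refl; sym to ≈-sym; trans to ≈-trans; +-cong to ⊕-cong; *-cong to ⊗-cong; +-congˡ to ⊕-congˡ)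
    open Frobenius R
    open PrimeQuotient R using (IsDomain; primeQuotient)

    1<p : 1 < p
    1<p = ℕ.nonTrivial⇒n>1 p {{prime⇒nonTrivial pr}}

    con≈× : ∀ c → con c ≈ (c × 1#)
    con≈× zero = ≈-refl
    con≈× (suc c) = ≈-trans (≡⇒≈ (con (suc c)) (1# ⊕ con c) λ i → cong (_+ c * δ i) (sym (*-identityˡ (δ i))))
                            (⊕-congˡ {1#} (con≈× c))

    p×1≈0 : (p × 1#) ≈ 0#
    p×1≈0 = ≈-trans (≈-sym (con≈× p)) (≈-intro λ i → trans (cong (_% p) (*-comm p (δ i))) (m*n%n≡0 (δ i) p))

    act-X^ : ∀ n s i → act (X ^ n) s i ≡ s (n + i)
    act-X^ zero s i = *-identityˡ (s i)
    act-X^ (suc n) s i = trans (act-X^ n s (suc i)) (cong s (+-suc n i))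

    -- The fixed points of the `q`-th power form a subring by Frobenius. It contains the constants
    -- by Fermat, and `X` because the shift by the period `N = q − 1` leaves `δ` unchanged.
    fixed : ∀ P → (P ^ (p ℕ.^ suc a′)) ≈ P
    fixed (con c) = ≈-trans (^-congˡ (p ℕ.^ suc a′) (con≈× c)) (≈-trans (iterate (suc a′)) (≈-sym (con≈× c)))
      where
      iterate : ∀ n → ((c × 1#) ^ (p ℕ.^ n)) ≈ (c × 1#)
      iterate zero = CommutativeRing.*-identityʳ R (c × 1#)
      iterate (suc n) = ≈-trans (≈-sym (^-assocʳ (c × 1#) p (p ℕ.^ n)))
        (≈-trans (^-congˡ (p ℕ.^ n) (×1-frobenius pr p×1≈0 c)) (iterate n))
    fixed X = ≡⇒≈ (X ^ (p ℕ.^ suc a′)) X λ i → trans (act-X^ (p ℕ.^ suc a′) δ i)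
      (trans (cong (λ t → δ (t + i)) q≡) (trans (cong δ (sym (+-suc N i))) (δ-periodic (suc i))))
    fixed (P ⊕ Q) = ≈-trans (frobenius^ pr p×1≈0 (suc a′) P Q) (⊕-cong (fixed P) (fixed Q))
    fixed (P ⊗ Q) = ≈-trans (^-distrib-* P Q (p ℕ.^ suc a′)) (⊗-cong (fixed P) (fixed Q))

    moving : ℕ → Poly
    moving d = (X ^ (p ℕ.^ suc d)) ⊕ neg X

    monic-moving : ∀ d → Monic (moving d) (p ℕ.^ suc d)
    monic-moving d s i vanish = trans (cong₂ _+_ (act-X^ (p ℕ.^ suc d) s i)
      (trans (cong (p′ *_) (vanish 1 1<p^)) (*-zeroʳ p′))) (+-identityʳ _)
      where
      1<p^ : 1 < p ℕ.^ suc d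
      1<p^ = <-≤-trans 1<p (≤-trans (≤-reflexive (sym (*-identityʳ p))) (*-monoʳ-≤ p (prime^>0 pr d)))

    -- The product of X^(p^d) − X over 1 ≤ d ≤ n: where it is nonzero, the conjugates of X are distinct.
    separator : ℕ → Poly
    separator zero = con 1
    separator (suc n) = moving n ⊗ separator n

    degree : ℕ → ℕ
    degree zero = 0
    degree (suc n) = degree n + p ℕ.^ suc n

    monic-separator : ∀ n → Monic (separator n) (degree n)
    monic-separator zero s i _ = *-identityˡ (s i)
    monic-separator (suc n) = monic-⊗ {moving n} {separator n} (monic-moving n) (monic-separator n)

    -- The sum p + ... + p^n stays below p^(n+1) by at least 2, which puts the degree of `g` below
    -- `N = q − 1`.
    degree-bound : ∀ n → degree n + 2 ≤ p ℕ.^ suc n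
    degree-bound zero = subst (2 ≤_) (sym (*-identityʳ p)) 1<p
    degree-bound (suc n) = begin
      degree n + p ℕ.^ suc n + 2      ≡⟨ trans (+-assoc (degree n) _ 2) (trans (cong (degree n +_) (+-comm _ 2)) (sym (+-assoc (degree n) 2 _))) ⟩
      degree n + 2 + p ℕ.^ suc n      ≤⟨ +-monoˡ-≤ _ (degree-bound n) ⟩
      p ℕ.^ suc n + p ℕ.^ suc n       ≡⟨ cong (p ℕ.^ suc n +_) (+-identityʳ _) ⟨
      2 * p ℕ.^ suc n                 ≤⟨ *-monoˡ-≤ (p ℕ.^ suc n) 1<p ⟩
      p * p ℕ.^ suc n                 ∎
      where open ≤-Reasoning

    g : Poly
    g = separator a′

    g≉0 : ¬ g ≈ 0#
    g≉0 e = 1≢0 (trans (sym (m<n⇒m%n≡m 1<p)) (trans (cong (_% p) (sym (monic-act≡1 {g} (monic-separator a′) degree<N)))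
      (at e (N ∸ degree a′))))
      where
      1≢0 : ¬ 1 ≡ 0
      1≢0 ()
      degree<N : degree a′ < N
      degree<N = s≤s⁻¹ (≤-trans (≤-reflexive (sym (+-comm (degree a′) 2)))
        (≤-trans (degree-bound a′) (≤-reflexive q≡)))

    identity : Congruence R
    identity = record
      { _~_ = _≈_
      ; ≈⇒~ = λ e → e
      ; ~-sym = ≈-sym
      ; ~-trans = ≈-trans
      ; ~-+-cong = ⊕-cong
      ; ~-*-cong = ⊗-cong
      ; ~-stable = λ k → ≈-intro λ i → decidable-stable (_ ℕ.≟ _) λ ne → k λ e → ne (at e i)
      }

    values : Poly → Fin N → Fin p
    values P i = fromℕ< (m%n<n (act P δ (toℕ i)) p)

    signature : Poly → Fin (p ℕ.^ N)
    signature P = funToFin (values P)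

    signature-injective : ∀ P Q → signature P ≡ signature Q → P ≈ Q
    signature-injective P Q e = ≈-intro λ i → let r = fromℕ< (m%n<n i N) in begin
      act P δ i % p            ≡⟨ cong (_% p) (act-% P i) ⟩
      act P δ (i % N) % p      ≡⟨ cong (λ j → act P δ j % p) (toℕ-fromℕ< (m%n<n i N)) ⟨
      act P δ (toℕ r) % p      ≡⟨ toℕ-fromℕ< (m%n<n (act P δ (toℕ r)) p) ⟨
      toℕ (values P r)         ≡⟨ cong toℕ (finToFun-funToFin (values P) r) ⟨
      toℕ (finToFun (signature P) r) ≡⟨ cong (λ f → toℕ (finToFun {p} {N} f r)) e ⟩
      toℕ (finToFun (signature Q) r) ≡⟨ cong toℕ (finToFun-funToFin (values Q) r) ⟩
      toℕ (values Q r)         ≡⟨ toℕ-fromℕ< (m%n<n (act Q δ (toℕ r)) p) ⟩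
      act Q δ (toℕ r) % p      ≡⟨ cong (λ j → act Q δ j % p) (toℕ-fromℕ< (m%n<n i N)) ⟩
      act Q δ (i % N) % p      ≡⟨ cong (_% p) (act-% Q i) ⟨
      act Q δ i % p            ∎
      where open ≡-Reasoning

    module _ (C : Congruence R) where

      open Congruence C
      private
        module K = CommutativeRing quotient
        module F = Frobenius quotient

      -- Stuck applications of _^_ and _×_ in the two rings differ: the raw bundles carry the equality.
      ^-quotient : ∀ P n → P F.^ n ≡ P ^ n
      ^-quotient P zero = refl
      ^-quotient P (suc n) = cong (P ⊗_) (^-quotient P n)

      ×-quotient : ∀ n P → n F.× P ≡ n × P
      ×-quotient zero P = refl
      ×-quotient (suc n) P = cong (P ⊕_) (×-quotient n P)

      -- By `fixed`, `g` equals its `q`-th power, and `q` is at least 2, so `g` is a multiple of its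
      -- own square. This remains true in every quotient.
      reduced : (g ⊗ g) ~ 0# → g ~ 0#
      reduced gg~0 = K.trans (≈⇒~ (≈-sym (≈-trans (^-congʳ g (sym q≡)) (fixed g))))
        (K.trans (K.sym (K.*-assoc g g (g ^ N′))) (K.trans (K.*-congʳ gg~0) (K.zeroˡ (g ^ N′))))

      -- One factor of the product vanishes. Read backwards: as long as `g` survives, no smaller
      -- Frobenius power fixes `X`.
      separator~0 : ∀ d → (X ^ (p ℕ.^ suc d)) ~ X → ∀ n → d < n → separator n ~ 0#
      separator~0 d e (suc n) d<n with d ℕ.≟ n
      ... | yes refl = K.trans (K.*-congʳ (K.trans (K.+-congʳ e) (K.-‿inverseʳ X))) (K.zeroˡ (separator n))
      ... | no d≢n = K.trans (K.*-congˡ {moving n} (separator~0 d e n (≤∧≢⇒< (s≤s⁻¹ d<n) d≢n))) (K.zeroʳ (moving n))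

      quotientCoordinates : ¬ g ~ 0# → IsDomain C → ¬ ¬ Coordinates (p ℕ.^ suc a′)
      quotientCoordinates g≁0 domain = Domain.coordinates quotient domain ~-stable
        (λ 1~0 → g≁0 (K.trans (K.sym (K.*-identityʳ g)) (K.trans (K.*-congˡ {g} 1~0) (K.zeroʳ g))))
        pr (K.trans (K.reflexive (×-quotient p 1#)) (≈⇒~ p×1≈0)) a′
        (λ P → K.trans (K.reflexive (^-quotient P (p ℕ.^ suc a′))) (≈⇒~ (fixed P))) X
        (λ d d<a′ e → g≁0 (separator~0 d (K.trans (K.reflexive (sym (^-quotient X (p ℕ.^ suc d)))) e) a′ d<a′))

    coordinates : ¬ ¬ Coordinates (p ℕ.^ suc a′)
    coordinates none = primeQuotient g reduced (p ℕ.^ N) identity signature signature-injective g≉0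
      λ (D , g≁0 , domain) → quotientCoordinates D g≁0 domain none

  primePowerCoordinates : ∀ {p} → Prime p → ∀ {a} → 1 ≤ a → ¬ ¬ Coordinates (p ℕ.^ a)
  primePowerCoordinates {suc p′} pr {suc a′} _ with suc p′ ℕ.^ suc a′ in q≡ | 1<q
    where
    1<q : 1 < suc p′ ℕ.^ suc a′
    1<q = <-≤-trans (ℕ.nonTrivial⇒n>1 (suc p′) {{prime⇒nonTrivial pr}}) (≤-trans
      (≤-reflexive (sym (*-identityʳ (suc p′)))) (*-monoʳ-≤ (suc p′) (prime^>0 pr a′)))
  ... | suc (suc N′) | _ = subst (λ q → ¬ ¬ Coordinates q) q≡ (PrimePowerField.coordinates p′ pr a′ N′ q≡)
  ... | suc zero | s≤s ()

-- Incidence counting for the upper bounds; planes and deletions for the lower bounds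

module Counting where

  open import Data.Empty using (⊥; ⊥-elim)
  open import Data.Bool.Base using (true; false; if_then_else_)
  open import Data.Fin.Base using (Fin; zero; suc; punchIn; punchOut; splitAt; join; quotRem; remQuot; combine)
  open import Data.Fin.Properties using (_≟_; any?; all?; ¬∀⟶∃¬; punchIn-injective; punchIn-punchOut; splitAt-join; join-splitAt; remQuot-combine; combine-remQuot)
  open import Data.Fin.Subset using (Subset; _∈_; ∣_∣)
  open import Data.Fin.Subset.Properties using (_∈?_)
  open import Data.Integer using (ℤ; +_; -[1+_]; 0ℤ; 1ℤ; -1ℤ; _+_; _*_; _-_; -_; _≤_; +≤+; _≤?_)
  open import Data.Integer.Properties hiding (_≟_)
  open import Data.Integer.Tactic.RingSolver using (solve-∀)
  open import Data.Nat as ℕ using (ℕ; zero; suc; z≤n)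
  open import Data.Product as Prod using (∃; _×_; _,_; proj₁; proj₂; uncurry)
  open import Data.Sum as Sum using (_⊎_; inj₁; inj₂; [_,_]′)
  open import Data.Unit using (⊤; tt)
  open import Data.Vec.Base as Vec using (Vec; []; _∷_; lookup; tabulate)
  open import Data.Vec.Properties using (lookup∘tabulate; []=⇒lookup; lookup⇒[]=)
  open import Function using (_∘_)
  open import Relation.Binary.PropositionalEquality using (_≡_; _≢_; refl; sym; trans; cong; cong₂; subst; subst₂; module ≡-Reasoning)
  open import Relation.Nullary using (¬_; Dec; yes; no; does; ¬?; _×-dec_)
  open import Relation.Nullary.Decidable using (decidable-stable; map′)
  open import Relation.Nullary.Negation using (contradiction)
  open import Algebra.Properties.Semiring.Sum +-*-semiring
    using (sum; sum-remove; ∑-comm; ∑-distrib-+; *-distribˡ-sum)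
    renaming (sum-cong-≗ to sum-cong)
  open import Defs using (Subgraph; Adjacent; K₂₂-free; edges; IsZarankiewicz)
  open FiniteDomains using (Coordinates)

  -- Integer inequalities and sums

  infixl 6 _⊹_
  infixl 7 _⊛_

  _⊹_ : ∀ {a b} → 0ℤ ≤ a → 0ℤ ≤ b → 0ℤ ≤ a + b
  _⊹_ = +-mono-≤

  _⊛_ : ∀ {a b} → 0ℤ ≤ a → 0ℤ ≤ b → 0ℤ ≤ a * b
  _⊛_ {+ m} {+ n} _ _ = subst (0ℤ ≤_) (pos-* m n) (+≤+ z≤n)

  0≤+ : ∀ {n} → 0ℤ ≤ + n
  0≤+ = +≤+ z≤n

  gap : ∀ {a b} → a ≤ b → 0ℤ ≤ b - a
  gap = i≤j⇒0≤j-i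

  certify : ∀ {a b t} → 0ℤ ≤ t → b - a ≡ t → a ≤ b
  certify 0≤t e = 0≤i-j⇒j≤i (subst (0ℤ ≤_) (sym e) 0≤t)

  -- Contradictions are certified by a nonnegative combination t of the hypotheses that the ring
  -- solver identifies with a negative constant. Matching on the equation instead would make Agda
  -- evaluate the solver's proofs.
  refute : ∀ {t n} → 0ℤ ≤ t → t ≡ -[1+ n ] → ⊥
  refute 0≤t e = contradiction (subst (0ℤ ≤_) e 0≤t) λ ()

  ≰⇒≥+1 : ∀ {a b} → ¬ a ≤ b → b + 1ℤ ≤ a
  ≰⇒≥+1 {a} {b} a≰b = subst (_≤ a) (+-comm 1ℤ b) (i<j⇒suc[i]≤j (≰⇒> a≰b))

  -- Integrality enters the counting through this inequality for two consecutive integers.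
  0≤n*[n-1] : ∀ z → 0ℤ ≤ z * (z - 1ℤ)
  0≤n*[n-1] (+ zero) = 0≤+
  0≤n*[n-1] (+ suc n) = 0≤+ {suc n} ⊛ 0≤+ {n}
  0≤n*[n-1] -[1+ n ] = 0≤+

  ZeroOne : ℤ → Set
  ZeroOne z = z ≡ 0ℤ ⊎ z ≡ 1ℤ

  module _ {z : ℤ} where

    01⇒0≤ : ZeroOne z → 0ℤ ≤ z
    01⇒0≤ (inj₁ refl) = 0≤+
    01⇒0≤ (inj₂ refl) = 0≤+

    01⇒≤1 : ZeroOne z → z ≤ 1ℤ
    01⇒≤1 (inj₁ refl) = 0≤+
    01⇒≤1 (inj₂ refl) = ≤-refl

    01⇒idem : ZeroOne z → z * z ≡ z
    01⇒idem (inj₁ refl) = refl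
    01⇒idem (inj₂ refl) = refl

  01-complement : ∀ {z} → ZeroOne z → ZeroOne (1ℤ - z)
  01-complement (inj₁ refl) = inj₂ refl
  01-complement (inj₂ refl) = inj₁ refl

  01-* : ∀ {y z} → ZeroOne y → ZeroOne z → ZeroOne (y * z)
  01-* (inj₁ refl) _ = inj₁ refl
  01-* (inj₂ refl) (inj₁ refl) = inj₁ refl
  01-* (inj₂ refl) (inj₂ refl) = inj₂ refl

  𝟙 : {P : Set} → Dec P → ℤ
  𝟙 P? = if does P? then 1ℤ else 0ℤ

  𝟙-01 : {P : Set} (P? : Dec P) → ZeroOne (𝟙 P?)
  𝟙-01 (yes _) = inj₂ refl
  𝟙-01 (no _) = inj₁ refl

  sum-mono : ∀ {n} {f g : Fin n → ℤ} → (∀ i → f i ≤ g i) → sum f ≤ sum g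
  sum-mono {zero} h = ≤-refl
  sum-mono {suc n} h = +-mono-≤ (h zero) (sum-mono (h ∘ suc))

  sum-0 : ∀ n → sum {n} (λ _ → 0ℤ) ≡ 0ℤ
  sum-0 zero = refl
  sum-0 (suc n) = trans (+-identityˡ _) (sum-0 n)

  sum-nonneg : ∀ {n} {f : Fin n → ℤ} → (∀ i → 0ℤ ≤ f i) → 0ℤ ≤ sum f
  sum-nonneg {n} {f} h = subst (_≤ sum f) (sum-0 n) (sum-mono h)

  sum-1 : ∀ n → sum {n} (λ _ → 1ℤ) ≡ + n
  sum-1 zero = refl
  sum-1 (suc n) = cong (λ t → 1ℤ + t) (sum-1 n)

  sum-linear : ∀ {n} a b (f g : Fin n → ℤ) → sum (λ i → a * f i + b * g i) ≡ a * sum f + b * sum g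
  sum-linear a b f g = trans (∑-distrib-+ (λ i → a * f i) (λ i → b * g i))
    (sym (cong₂ _+_ (*-distribˡ-sum a f) (*-distribˡ-sum b g)))

  sum-- : ∀ {n} (f g : Fin n → ℤ) → sum (λ i → f i - g i) ≡ sum f - sum g
  sum-- f g = trans (sum-cong λ i → e (f i) (g i)) (trans (sum-linear 1ℤ (- 1ℤ) f g) (sym (e (sum f) (sum g))))
    where
    e : ∀ a b → a - b ≡ 1ℤ * a + - 1ℤ * b
    e = solve-∀

  sum-affine : ∀ {n} a b (f : Fin n → ℤ) → sum (λ i → a + b * f i) ≡ a * + n + b * sum f
  sum-affine {n} a b f = trans (sum-cong λ i → cong (_+ b * f i) (sym (*-identityʳ a)))
    (trans (sum-linear a b (λ _ → 1ℤ) f) (cong (λ t → a * t + b * sum f) (sum-1 n)))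

  sum-≤+ : ∀ {n} {f : Fin n → ℤ} → (∀ i → f i ≤ 1ℤ) → sum f ≤ + n
  sum-≤+ {n} {f} h = subst (sum f ≤_) (sum-1 n) (sum-mono h)

  𝟙≟-suc : ∀ {n} (i j : Fin n) → 𝟙 (suc i ≟ suc j) ≡ 𝟙 (i ≟ j)
  𝟙≟-suc i j with i ≟ j
  ... | yes refl = refl
  ... | no _ = refl

  sum-select : ∀ {n} (i : Fin n) (f : Fin n → ℤ) → sum (λ j → 𝟙 (i ≟ j) * f j) ≡ f i
  sum-select {suc n} zero f = trans (cong₂ _+_ (*-identityˡ (f zero)) (trans (sum-cong λ j → *-zeroˡ (f (suc j))) (sum-0 n)))
    (+-identityʳ (f zero))
  sum-select {suc n} (suc i) f = trans (+-identityˡ _)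
    (trans (sum-cong λ j → cong (_* f (suc j)) (𝟙≟-suc i j)) (sum-select i (f ∘ suc)))

  sum-except : ∀ {n} (i : Fin n) (f : Fin n → ℤ) → sum (λ j → (1ℤ - 𝟙 (i ≟ j)) * f j) ≡ sum f - f i
  sum-except i f = trans (sum-cong λ j → e (𝟙 (i ≟ j)) (f j))
    (trans (sum-- f (λ j → 𝟙 (i ≟ j) * f j)) (cong (λ t → sum f - t) (sum-select i f)))
    where
    e : ∀ a b → (1ℤ - a) * b ≡ b - a * b
    e = solve-∀

  sum-𝟙≟ : ∀ {n} (i : Fin n) → sum (λ j → 𝟙 (i ≟ j)) ≡ 1ℤ
  sum-𝟙≟ i = trans (sum-cong λ j → sym (*-identityʳ (𝟙 (i ≟ j)))) (sum-select i (λ _ → 1ℤ))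

  -- Incidence matrices

  -- Rows are points and columns are lines. The condition is recorded for rows and for columns, so
  -- that `dual` merely exchanges fields; integer entries keep all counts open to ring identities.
  record Incidence (n : ℕ) : Set where
    field
      M : Fin n → Fin n → ℤ
      M-01 : ∀ p l → ZeroOne (M p l)
      joint-≤1 : ∀ p q → p ≢ q → sum (λ l → M p l * M q l) ≤ 1ℤ
      meet-≤1 : ∀ l m → l ≢ m → sum (λ p → M p l * M p m) ≤ 1ℤ

    degree size : Fin n → ℤ
    degree p = sum (λ l → M p l)
    size l = sum (λ p → M p l)

    incidences : ℤ
    incidences = sum degree

    sum-size : sum size ≡ incidences
    sum-size = ∑-comm (λ l p → M p l)

    size≤n : ∀ l → size l ≤ + n
    size≤n l = sum-≤+ λ p → 01⇒≤1 (M-01 p l)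

    0≤size : ∀ l → 0ℤ ≤ size l
    0≤size l = sum-nonneg λ p → 01⇒0≤ (M-01 p l)

    dual : Incidence n
    dual = record
      { M = λ l p → M p l ; M-01 = λ l p → M-01 p l ; joint-≤1 = meet-≤1 ; meet-≤1 = joint-≤1 }

    joint : Fin n → Fin n → ℤ
    joint p q = sum (λ l → M p l * M q l)

    -- Off the diagonal, 1 if no line joins p and q and 0 otherwise; 0 on the diagonal.
    apart : Fin n → Fin n → ℤ
    apart p q = 1ℤ + 𝟙 (p ≟ q) * (degree p - 1ℤ) - joint p q

    joint-self : ∀ p → joint p p ≡ degree p
    joint-self p = sum-cong λ l → 01⇒idem (M-01 p l)

    apart-nonneg : ∀ p q → 0ℤ ≤ apart p q
    apart-nonneg p q with p ≟ q
    ... | yes refl = ≤-reflexive (sym (trans (cong (λ t → 1ℤ + 1ℤ * (degree p - 1ℤ) - t) (joint-self p)) (e (degree p))))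
      where
      e : ∀ d → 1ℤ + 1ℤ * (d - 1ℤ) - d ≡ 0ℤ
      e = solve-∀
    ... | no p≢q = subst (0ℤ ≤_) (e (degree p) (joint p q)) (gap (joint-≤1 p q p≢q))
      where
      e : ∀ d j → 1ℤ - j ≡ 1ℤ + 0ℤ * (d - 1ℤ) - j
      e = solve-∀

    sum-size-through : ∀ p → sum (joint p) ≡ sum (λ l → M p l * size l)
    sum-size-through p = trans (∑-comm (λ q l → M p l * M q l))
      (sum-cong λ l → sym (*-distribˡ-sum (M p l) (λ q → M q l)))

    sum-weighted-apart : ∀ (c : Fin n → ℤ) p → sum (λ q → c q * apart p q) ≡
                         sum c + c p * (degree p - 1ℤ) - sum (λ q → c q * joint p q)
    sum-weighted-apart c p = begin
      sum (λ q → c q * apart p q)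
        ≡⟨ sum-cong (λ q → e (c q) (𝟙 (p ≟ q)) (degree p) (joint p q)) ⟩
      sum (λ q → (c q + 𝟙 (p ≟ q) * (c q * (degree p - 1ℤ))) - c q * joint p q)
        ≡⟨ sum-- (λ q → c q + 𝟙 (p ≟ q) * (c q * (degree p - 1ℤ))) (λ q → c q * joint p q) ⟩
      sum (λ q → c q + 𝟙 (p ≟ q) * (c q * (degree p - 1ℤ))) - sum (λ q → c q * joint p q)
        ≡⟨ cong (_- sum (λ q → c q * joint p q)) (trans (∑-distrib-+ c (λ q → 𝟙 (p ≟ q) * (c q * (degree p - 1ℤ))))
             (cong (λ t → sum c + t) (sum-select p (λ q → c q * (degree p - 1ℤ))))) ⟩
      sum c + c p * (degree p - 1ℤ) - sum (λ q → c q * joint p q) ∎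
      where
      open ≡-Reasoning
      e : ∀ c i d j → c * (1ℤ + i * (d - 1ℤ) - j) ≡ (c + i * (c * (d - 1ℤ))) - c * j
      e = solve-∀

    sum-apart : ∀ p → sum (apart p) ≡ + n + (degree p - 1ℤ) - sum (λ l → M p l * size l)
    sum-apart p = begin
      sum (apart p)                   ≡⟨ sum-cong (λ q → *-identityˡ (apart p q)) ⟨
      sum (λ q → 1ℤ * apart p q)      ≡⟨ sum-weighted-apart (λ _ → 1ℤ) p ⟩
      sum {n} (λ _ → 1ℤ) + 1ℤ * (degree p - 1ℤ) - sum (λ q → 1ℤ * joint p q)
        ≡⟨ cong₂ _-_ (cong₂ _+_ (sum-1 n) (*-identityˡ (degree p - 1ℤ)))
             (trans (sum-cong λ q → *-identityˡ (joint p q)) (sum-size-through p)) ⟩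
      + n + (degree p - 1ℤ) - sum (λ l → M p l * size l) ∎
      where open ≡-Reasoning

    -- A point p off the line m is joined to at most degree p of the points of m.
    apart-on-line : ∀ p m → M p m ≡ 0ℤ → size m - degree p ≤ sum (λ q → M q m * apart p q)
    apart-on-line p m p∉m = subst (size m - degree p ≤_) (sym (trans (sum-weighted-apart (λ q → M q m) p)
        (cong (λ t → size m + t * (degree p - 1ℤ) - sum (λ q → M q m * joint p q)) p∉m)))
      (certify (gap joined-on-m) (e (size m) (degree p) (sum (λ q → M q m * joint p q))))
      where
      e : ∀ s d j → (s + 0ℤ * (d - 1ℤ) - j) - (s - d) ≡ d - j
      e = solve-∀
      swap : sum (λ q → M q m * joint p q) ≡ sum (λ l → M p l * sum (λ q → M q l * M q m))
      swap = trans (sum-cong λ q → *-distribˡ-sum (M q m) (λ l → M p l * M q l))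
        (trans (∑-comm (λ q l → M q m * (M p l * M q l)))
          (sum-cong λ l → trans (sum-cong λ q → e′ (M q m) (M p l) (M q l)) (sym (*-distribˡ-sum (M p l) (λ q → M q l * M q m)))))
        where
        e′ : ∀ a b c → a * (b * c) ≡ b * (c * a)
        e′ = solve-∀
      pointwise : ∀ l → M p l * sum (λ q → M q l * M q m) ≤ M p l
      pointwise l with l ≟ m
      ... | yes refl = ≤-reflexive (trans (cong (_* sum (λ q → M q l * M q m)) p∉m) (trans (*-zeroˡ (sum (λ q → M q l * M q m))) (sym p∉m)))
      ... | no l≢m = certify (01⇒0≤ (M-01 p l) ⊛ gap (meet-≤1 l m l≢m)) (e′ (M p l) (sum (λ q → M q l * M q m)))
        where
        e′ : ∀ a b → a - a * b ≡ a * (1ℤ - b)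
        e′ = solve-∀
      joined-on-m : sum (λ q → M q m * joint p q) ≤ degree p
      joined-on-m = subst (_≤ degree p) (sym swap) (sum-mono pointwise)

    -- For a 0-1 weight this counts the points of χ on a line; other weights, such as `apart p`,
    -- occur as well.
    trace : (Fin n → ℤ) → Fin n → ℤ
    trace χ l = sum (λ p → χ p * M p l)

    sum-trace : ∀ χ (f : Fin n → ℤ) → sum (λ l → f l * trace χ l) ≡ sum (λ p → χ p * sum (λ l → M p l * f l))
    sum-trace χ f = trans (sum-cong λ l → *-distribˡ-sum (f l) (λ p → χ p * M p l))
      (trans (∑-comm (λ l p → f l * (χ p * M p l)))
        (sum-cong λ p → trans (sum-cong λ l → e (f l) (χ p) (M p l)) (sym (*-distribˡ-sum (χ p) (λ l → M p l * f l)))))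
      where
      e : ∀ a b c → a * (b * c) ≡ b * (c * a)
      e = solve-∀

    sum-trace-1 : ∀ χ → sum (trace χ) ≡ sum (λ p → χ p * degree p)
    sum-trace-1 χ = trans (sum-cong λ l → sym (*-identityˡ (trace χ l))) (trans (sum-trace χ (λ _ → 1ℤ))
      (sum-cong λ p → cong (λ t → χ p * t) (sum-cong λ l → *-identityʳ (M p l))))

    module _ (χ : Fin n → ℤ) (χ-01 : ∀ p → ZeroOne (χ p)) where

      -- Double count of the pairs of points of χ.
      sum-trace² : sum (λ l → trace χ l * trace χ l) ≤ sum χ * sum χ + sum (λ p → χ p * (degree p - 1ℤ))
      sum-trace² = subst₂ _≤_ (sym lhs) rhs (sum-mono λ p →
          certify (01⇒0≤ (χ-01 p) ⊛ sum-nonneg (λ q → 01⇒0≤ (χ-01 q) ⊛ apart-nonneg p q)) (pointwise p))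
        where
        open ≡-Reasoning
        lhs : sum (λ l → trace χ l * trace χ l) ≡ sum (λ p → χ p * sum (λ q → χ q * joint p q))
        lhs = trans (sum-trace χ (trace χ)) (sum-cong λ p → cong (λ t → χ p * t)
          (trans (sum-trace χ (λ l → M p l)) (sum-cong λ q → cong (λ t → χ q * t) (sum-cong λ l → *-comm (M q l) (M p l)))))
        pointwise : ∀ p → (χ p * sum χ + χ p * (degree p - 1ℤ)) - χ p * sum (λ q → χ q * joint p q) ≡
                          χ p * sum (λ q → χ q * apart p q)
        pointwise p = sym (trans (cong (λ t → χ p * t) (sum-weighted-apart χ p))
          (trans (e (χ p) (sum χ) (degree p - 1ℤ) (sum (λ q → χ q * joint p q)))
            (cong (λ t → (χ p * sum χ + t * (degree p - 1ℤ)) - χ p * sum (λ q → χ q * joint p q)) (01⇒idem (χ-01 p)))))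
          where
          e : ∀ c s d j → c * (s + c * d - j) ≡ (c * s + c * c * d) - c * j
          e = solve-∀
        rhs : sum (λ p → χ p * sum χ + χ p * (degree p - 1ℤ)) ≡ sum χ * sum χ + sum (λ p → χ p * (degree p - 1ℤ))
        rhs = trans (∑-distrib-+ (λ p → χ p * sum χ) (λ p → χ p * (degree p - 1ℤ)))
          (cong (λ t → t + sum (λ p → χ p * (degree p - 1ℤ)))
            (trans (sum-cong λ p → *-comm (χ p) (sum χ)) (sym (*-distribˡ-sum (sum χ) χ))))

      -- Each ordered pair of distinct points of χ lies on at most one line.
      sum-trace[trace-1] : sum (λ l → trace χ l * (trace χ l - 1ℤ)) ≤ sum χ * (sum χ - 1ℤ)
      sum-trace[trace-1] = certify (gap sum-trace²) (begin
        s * (s - 1ℤ) - sum (λ l → a l * (a l - 1ℤ))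
          ≡⟨ cong (λ t → s * (s - 1ℤ) - t) (trans (sum-cong λ l → e₁ (a l)) (sum-- (λ l → a l * a l) a)) ⟩
        s * (s - 1ℤ) - (sum (λ l → a l * a l) - sum a)
          ≡⟨ cong (λ t → s * (s - 1ℤ) - (sum (λ l → a l * a l) - t)) (sum-trace-1 χ) ⟩
        s * (s - 1ℤ) - (sum (λ l → a l * a l) - sum (λ p → χ p * degree p))
          ≡⟨ e₂ s (sum (λ l → a l * a l)) (sum (λ p → χ p * degree p)) ⟩
        s * s + (sum (λ p → χ p * degree p) - s) - sum (λ l → a l * a l)
          ≡⟨ cong (λ t → s * s + t - sum (λ l → a l * a l))
               (trans (sum-cong λ p → e₃ (χ p) (degree p)) (sum-- (λ p → χ p * degree p) χ)) ⟨
        s * s + sum (λ p → χ p * (degree p - 1ℤ)) - sum (λ l → a l * a l) ∎)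
        where
        open ≡-Reasoning
        s = sum χ
        a = trace χ
        e₁ : ∀ a → a * (a - 1ℤ) ≡ a * a - a
        e₁ = solve-∀
        e₂ : ∀ s u v → s * (s - 1ℤ) - (u - v) ≡ s * s + (v - s) - u
        e₂ = solve-∀
        e₃ : ∀ c d → c * (d - 1ℤ) ≡ c * d - c
        e₃ = solve-∀

      -- Roman's bound for the points χ and the lines τ, in terms of lower bounds w for the traces.
      roman : ∀ (τ : Fin n → ℤ) → (∀ l → ZeroOne (τ l)) → ∀ t → 0ℤ ≤ t →
              ∀ (w : Fin n → ℤ) → (∀ l → τ l * w l ≤ τ l * trace χ l) →
              + 2 * t * sum (λ l → τ l * w l) ≤ sum χ * (sum χ - 1ℤ) + t * (t + 1ℤ) * sum τ
      roman τ τ-01 t 0≤t w w≤ = certify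
        (gap sum-trace[trace-1] ⊹ gap total) (e (sum χ * (sum χ - 1ℤ)) (t * (t + 1ℤ) * sum τ)
          (sum (λ l → trace χ l * (trace χ l - 1ℤ))) (+ 2 * t * sum (λ l → τ l * w l)))
        where
        e : ∀ s u v w → s + u - w ≡ (s - v) + (v - (w + - u))
        e = solve-∀
        pointwise : ∀ l → + 2 * t * (τ l * w l) + - (t * (t + 1ℤ)) * τ l ≤ trace χ l * (trace χ l - 1ℤ)
        pointwise l with τ-01 l
        ... | inj₁ τ≡0 = subst (_≤ trace χ l * (trace χ l - 1ℤ)) (sym (trans
            (cong (λ x → + 2 * t * (x * w l) + - (t * (t + 1ℤ)) * x) τ≡0) (e′ t (w l))))
            (0≤n*[n-1] (trace χ l))
          where
          e′ : ∀ t w → + 2 * t * (0ℤ * w) + - (t * (t + 1ℤ)) * 0ℤ ≡ 0ℤ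
          e′ = solve-∀
        -- The quadratic a(a - 1) is replaced by the linear 2ta - t(t + 1): their difference is (a -
        -- t)(a - t - 1), nonnegative for an integer trace a and zero exactly at t and t + 1.
        ... | inj₂ τ≡1 = certify (0≤n*[n-1] (trace χ l - t) ⊹ 0≤+ {2} ⊛ 0≤t ⊛ gap (w≤ l)) (trans
            (cong (λ x → trace χ l * (trace χ l - 1ℤ) - (+ 2 * t * (x * w l) + - (t * (t + 1ℤ)) * x)) τ≡1)
            (trans (e′ t (w l) (trace χ l)) (cong (λ x → (trace χ l - t) * (trace χ l - t - 1ℤ) + + 2 * t * (x * trace χ l - x * w l)) (sym τ≡1))))
          where
          e′ : ∀ t w a → a * (a - 1ℤ) - (+ 2 * t * (1ℤ * w) + - (t * (t + 1ℤ)) * 1ℤ) ≡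
                         (a - t) * (a - t - 1ℤ) + + 2 * t * (1ℤ * a - 1ℤ * w)
          e′ = solve-∀
        total : + 2 * t * sum (λ l → τ l * w l) + - (t * (t + 1ℤ) * sum τ) ≤ sum (λ l → trace χ l * (trace χ l - 1ℤ))
        total = subst (_≤ sum (λ l → trace χ l * (trace χ l - 1ℤ)))
          (trans (sum-linear (+ 2 * t) (- (t * (t + 1ℤ))) (λ l → τ l * w l) τ)
            (cong (λ x → + 2 * t * sum (λ l → τ l * w l) + x) (sym (neg-distribˡ-* (t * (t + 1ℤ)) (sum τ)))))
          (sum-mono pointwise)

  -- Deleting lines and points

  module Removal {n : ℕ} (I : Incidence n) (K : ℤ) where

    open Incidence I

    private
      N : ℤ
      N = + n

    -- The estimate is sharp for lines of `K` or `K + 1` points, whence `t = K`.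
    keepAll : 0ℤ ≤ K → + 2 * K * incidences ≤ N * (N - 1ℤ) + K * (K + 1ℤ) * N
    keepAll 0≤K = subst₂ _≤_ (cong (λ t → + 2 * K * t) total)
      (cong (λ t → t * (t - 1ℤ) + K * (K + 1ℤ) * t) (sum-1 n))
      (roman (λ _ → 1ℤ) (λ _ → inj₂ refl) (λ _ → 1ℤ) (λ _ → inj₂ refl) K 0≤K (trace (λ _ → 1ℤ)) (λ _ → ≤-refl))
      where
      total : sum (λ l → 1ℤ * trace (λ _ → 1ℤ) l) ≡ incidences
      total = trans (sum-trace (λ _ → 1ℤ) (λ _ → 1ℤ)) (sum-cong λ p → trans (*-identityˡ _)
        (sum-cong λ l → *-identityʳ (M p l)))

    meet : Fin n → Fin n → ℤ
    meet l m = sum (λ p → M p l * M p m)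

    off : Fin n → Fin n → ℤ
    off l p = 1ℤ - M p l

    off-01 : ∀ l p → ZeroOne (off l p)
    off-01 l p = 01-complement (M-01 p l)

    sum-off : ∀ l → sum (off l) ≡ N - size l
    sum-off l = trans (sum-- (λ _ → 1ℤ) (λ p → M p l)) (cong (_- size l) (sum-1 n))

    other : Fin n → Fin n → ℤ
    other l m = 1ℤ - 𝟙 (l ≟ m)

    other-01 : ∀ l m → ZeroOne (other l m)
    other-01 l m = 01-complement (𝟙-01 (l ≟ m))

    sum-other : ∀ l → sum (other l) ≡ N - 1ℤ
    sum-other l = trans (sum-- (λ _ → 1ℤ) (λ m → 𝟙 (l ≟ m))) (cong₂ _-_ (sum-1 n) (sum-𝟙≟ l))

    sum-shift : ∀ c (f : Fin n → ℤ) → sum (λ m → f m - c) ≡ sum f - c * N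
    sum-shift c f = trans (sum-cong λ m → e (f m) c) (trans (sum-affine (- c) 1ℤ f) (e′ c (sum f) N))
      where
      e : ∀ f c → f - c ≡ - c + 1ℤ * f
      e = solve-∀
      e′ : ∀ c s n → - c * n + 1ℤ * s ≡ s - c * n
      e′ = solve-∀

    module _ (1≤K : 0ℤ ≤ K - 1ℤ) where

      private
        t : ℤ
        t = K - 1ℤ

      -- Every other line loses at most one point, so full lines drop to about `K` points and
      -- `t = K − 1` is the suitable tangent.
      removeLine : ∀ l → + 2 * t * (incidences - N - (size l - 1ℤ)) ≤
                         (N - size l) * (N - size l - 1ℤ) + t * (t + 1ℤ) * (N - 1ℤ)
      removeLine l = subst₂ _≤_ (cong (λ x → + 2 * t * x) total)
        (cong₂ (λ x y → x * (x - 1ℤ) + t * (t + 1ℤ) * y) (sum-off l) (sum-other l))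
        (roman (off l) (off-01 l) (other l) (other-01 l) t 1≤K (λ m → size m - 1ℤ) pointwise)
        where
        trace-off : ∀ m → trace (off l) m ≡ size m - meet l m
        trace-off m = trans (sum-cong λ p → e (M p l) (M p m)) (sum-- (λ p → M p m) (λ p → M p l * M p m))
          where
          e : ∀ a b → (1ℤ - a) * b ≡ b - a * b
          e = solve-∀
        pointwise : ∀ m → other l m * (size m - 1ℤ) ≤ other l m * trace (off l) m
        pointwise m with l ≟ m
        ... | yes _ = ≤-refl
        ... | no l≢m = certify (gap (meet-≤1 l m l≢m))
          (trans (cong (λ x → 1ℤ * x - 1ℤ * (size m - 1ℤ)) (trace-off m)) (e (size m) (meet l m)))
          where
          e : ∀ s j → 1ℤ * (s - j) - 1ℤ * (s - 1ℤ) ≡ 1ℤ - j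
          e = solve-∀
        total : sum (λ m → other l m * (size m - 1ℤ)) ≡ incidences - N - (size l - 1ℤ)
        total = trans (sum-except l (λ m → size m - 1ℤ)) (cong (_- (size l - 1ℤ))
          (trans (sum-shift 1ℤ size) (cong₂ _-_ sum-size (*-identityˡ N))))

      -- The lines through `q` lose `q` in addition to their point on `l`.
      removeLineAndPoint : ∀ l q → M q l ≡ 0ℤ →
        + 2 * t * (incidences - N - degree q - (size l - 1ℤ)) ≤
        (N - size l - 1ℤ) * (N - size l - 1ℤ - 1ℤ) + t * (t + 1ℤ) * (N - 1ℤ)
      removeLineAndPoint l q q∉l = subst₂ _≤_ (cong (λ x → + 2 * t * x) total)
        (cong₂ (λ x y → x * (x - 1ℤ) + t * (t + 1ℤ) * y) sum-χ (sum-other l))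
        (roman χ χ-01 (other l) (other-01 l) t 1≤K (λ m → size m - 1ℤ - M q m) pointwise)
        where
        χ : Fin n → ℤ
        χ p = off l p * other q p
        χ-01 : ∀ p → ZeroOne (χ p)
        χ-01 p = 01-* (off-01 l p) (other-01 q p)
        sum-χ : sum χ ≡ N - size l - 1ℤ
        sum-χ = trans (sum-cong λ p → *-comm (off l p) (other q p)) (trans (sum-except q (off l))
          (cong₂ _-_ (sum-off l) (cong (λ x → 1ℤ - x) q∉l)))
        trace-χ : ∀ m → trace χ m ≡ size m - meet l m - M q m
        trace-χ m = trans (sum-cong λ p → e (M p l) (𝟙 (q ≟ p)) (M p m))
          (trans (sum-except q (λ p → M p m - M p l * M p m))
            (cong₂ _-_ (sum-- (λ p → M p m) (λ p → M p l * M p m))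
              (trans (cong (λ x → M q m - x * M q m) q∉l) (e′ (M q m)))))
          where
          e : ∀ a b c → (1ℤ - a) * (1ℤ - b) * c ≡ (1ℤ - b) * (c - a * c)
          e = solve-∀
          e′ : ∀ x → x - 0ℤ * x ≡ x
          e′ = solve-∀
        pointwise : ∀ m → other l m * (size m - 1ℤ - M q m) ≤ other l m * trace χ m
        pointwise m with l ≟ m
        ... | yes _ = ≤-refl
        ... | no l≢m = certify (gap (meet-≤1 l m l≢m))
          (trans (cong (λ x → 1ℤ * x - 1ℤ * (size m - 1ℤ - M q m)) (trace-χ m)) (e (size m) (meet l m) (M q m)))
          where
          e : ∀ s j i → 1ℤ * (s - j - i) - 1ℤ * (s - 1ℤ - i) ≡ 1ℤ - j
          e = solve-∀
        total : sum (λ m → other l m * (size m - 1ℤ - M q m)) ≡ incidences - N - degree q - (size l - 1ℤ)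
        total = trans (sum-except l (λ m → size m - 1ℤ - M q m)) (cong₂ _-_
          (trans (sum-- (λ m → size m - 1ℤ) (λ m → M q m)) (cong (_- degree q)
            (trans (sum-shift 1ℤ size) (cong₂ _-_ sum-size (*-identityˡ N)))))
          (trans (cong (λ x → size l - 1ℤ - x) q∉l) (+-identityʳ (size l - 1ℤ))))

      -- A line loses at most one point to each of `l` and `l′`. At a common point the two losses
      -- coincide, so every common point returns its degree to the count.
      removeTwoLines : ∀ l l′ → l ≢ l′ →
        let c = meet l l′ ; s = N - size l - (size l′ - c) in
        + 2 * t * (incidences - + 2 * N + sum (λ p → M p l * M p l′ * degree p) -
                   (size l - + 2 + c) - (size l′ - + 2 + c)) ≤
        s * (s - 1ℤ) + t * (t + 1ℤ) * (N - 1ℤ - 1ℤ)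
      removeTwoLines l l′ l≢l′ = subst₂ _≤_ (cong (λ x → + 2 * t * x) total)
        (cong₂ (λ x y → x * (x - 1ℤ) + t * (t + 1ℤ) * y) sum-χ sum-τ)
        (roman χ χ-01 τ τ-01 t 1≤K w pointwise)
        where
        χ ρ τ w : Fin n → ℤ
        χ p = off l p * off l′ p
        ρ p = M p l * M p l′
        τ m = other l m * other l′ m
        w m = size m - + 2 + trace ρ m
        χ-01 : ∀ p → ZeroOne (χ p)
        χ-01 p = 01-* (off-01 l p) (off-01 l′ p)
        τ-01 : ∀ m → ZeroOne (τ m)
        τ-01 m = 01-* (other-01 l m) (other-01 l′ m)
        other≡1 : ∀ {a b} → a ≢ b → other a b ≡ 1ℤ
        other≡1 {a} {b} a≢b with a ≟ b
        ... | yes a≡b = ⊥-elim (a≢b a≡b)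
        ... | no _ = refl
        sum-χ : sum χ ≡ N - size l - (size l′ - meet l l′)
        sum-χ = trans (sum-cong λ p → e (M p l) (M p l′)) (trans (sum-- (off l) (λ p → M p l′ - ρ p))
          (cong₂ _-_ (sum-off l) (sum-- (λ p → M p l′) ρ)))
          where
          e : ∀ a b → (1ℤ - a) * (1ℤ - b) ≡ (1ℤ - a) - (b - a * b)
          e = solve-∀
        sum-τ-weighted : ∀ f → sum (λ m → τ m * f m) ≡ sum f - f l - f l′
        sum-τ-weighted f = trans (sum-cong λ m → e (other l m) (other l′ m) (f m))
          (trans (sum-except l′ (λ m → other l m * f m)) (cong₂ _-_ (sum-except l f)
            (trans (cong (_* f l′) (other≡1 l≢l′)) (*-identityˡ (f l′)))))
          where
          e : ∀ a b c → a * b * c ≡ b * (a * c)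
          e = solve-∀
        sum-τ : sum τ ≡ N - 1ℤ - 1ℤ
        sum-τ = trans (sum-cong λ m → sym (*-identityʳ (τ m)))
          (trans (sum-τ-weighted (λ _ → 1ℤ)) (cong (λ x → x - 1ℤ - 1ℤ) (sum-1 n)))
        trace-χ : ∀ m → trace χ m ≡ (size m - meet l m) - (meet l′ m - trace ρ m)
        trace-χ m = trans (sum-cong λ p → e (M p l) (M p l′) (M p m))
          (trans (sum-- (λ p → M p m - M p l * M p m) (λ p → M p l′ * M p m - ρ p * M p m))
            (cong₂ _-_ (sum-- (λ p → M p m) (λ p → M p l * M p m))
              (sum-- (λ p → M p l′ * M p m) (λ p → ρ p * M p m))))
          where
          e : ∀ a b c → (1ℤ - a) * (1ℤ - b) * c ≡ (c - a * c) - (b * c - a * b * c)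
          e = solve-∀
        pointwise : ∀ m → τ m * w m ≤ τ m * trace χ m
        pointwise m with l ≟ m | l′ ≟ m
        ... | yes _ | _ = ≤-refl
        ... | no _ | yes _ = ≤-refl
        ... | no l≢m | no l′≢m = certify (gap (meet-≤1 l m l≢m) ⊹ gap (meet-≤1 l′ m l′≢m))
          (trans (cong (λ x → 1ℤ * x - 1ℤ * w m) (trace-χ m)) (e (size m) (meet l m) (meet l′ m) (trace ρ m)))
          where
          e : ∀ s i j r → 1ℤ * ((s - i) - (j - r)) - 1ℤ * (s - + 2 + r) ≡ (1ℤ - i) + (1ℤ - j)
          e = solve-∀
        trace-ρ-l : trace ρ l ≡ meet l l′
        trace-ρ-l = sum-cong λ p → trans (e (M p l) (M p l′)) (cong (_* M p l′) (01⇒idem (M-01 p l)))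
          where
          e : ∀ a b → a * b * a ≡ a * a * b
          e = solve-∀
        trace-ρ-l′ : trace ρ l′ ≡ meet l l′
        trace-ρ-l′ = sum-cong λ p → trans (*-assoc (M p l) (M p l′) (M p l′)) (cong (λ x → M p l * x) (01⇒idem (M-01 p l′)))
        sum-w : sum w ≡ incidences - + 2 * N + sum (λ p → ρ p * degree p)
        sum-w = trans (∑-distrib-+ (λ m → size m - + 2) (trace ρ)) (cong₂ _+_
          (trans (sum-shift (+ 2) size) (cong (_- + 2 * N) sum-size)) (sum-trace-1 ρ))
        total : sum (λ m → τ m * w m) ≡ incidences - + 2 * N + sum (λ p → ρ p * degree p) -
                                         (size l - + 2 + meet l l′) - (size l′ - + 2 + meet l l′)
        total = trans (sum-τ-weighted w) (trans (cong₂ (λ x y → sum w - (size l - + 2 + x) - (size l′ - + 2 + y)) trace-ρ-l trace-ρ-l′)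
          (cong (λ x → x - (size l - + 2 + meet l l′) - (size l′ - + 2 + meet l l′)) sum-w))

  -- Defects

  dichotomy : ∀ a b → a ≤ b ⊎ 0ℤ ≤ a - (b + 1ℤ)
  dichotomy a b with a ≤? b
  ... | yes a≤b = inj₁ a≤b
  ... | no a≰b = inj₂ (gap (≰⇒≥+1 a≰b))

  zero-or-positive : ∀ z → 0ℤ ≤ z → z ≡ 0ℤ ⊎ 0ℤ ≤ z - 1ℤ
  zero-or-positive (+ zero) _ = inj₁ refl
  zero-or-positive (+ suc m) _ = inj₂ 0≤+

  -- `H` stands for h. The hypothesis `many` describes a counterexample: `D` is one less than the
  -- total defect at the claimed value.
  module Defects {n : ℕ} (I : Incidence n) (K H D : ℤ) (n≡ : + n ≡ K * K + K + 1ℤ - H)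
                 (many : + n * (K + 1ℤ) - D ≤ Incidence.incidences I) where

    open Incidence I
    open Removal I K

    Δ : ℤ
    Δ = + n * (K + 1ℤ) - incidences

    -- The defects of the lines and points, and the total defect of the lines through p.
    x y X : Fin n → ℤ
    x m = K + 1ℤ - size m
    y p = K + 1ℤ - degree p
    X p = sum (λ m → M p m * x m)

    gap-many : let P = K * K + K + 1ℤ - H in 0ℤ ≤ incidences - (P * (K + 1ℤ) - D)
    gap-many = subst (λ N → 0ℤ ≤ incidences - (N * (K + 1ℤ) - D)) n≡ (gap many)

    Δ≤D : 0ℤ ≤ D - Δ
    Δ≤D = subst (0ℤ ≤_) (e incidences (+ n * (K + 1ℤ)) D) (gap many)
      where
      e : ∀ i a d → i - (a - d) ≡ d - (a - i)
      e = solve-∀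

    sum-defect : (f : Fin n → ℤ) → sum f ≡ incidences → sum (λ i → K + 1ℤ - f i) ≡ Δ
    sum-defect f e = trans (sum-cong λ i → e₁ (K + 1ℤ) (f i)) (trans (sum-affine (K + 1ℤ) (- 1ℤ) f)
      (trans (e₂ (K + 1ℤ) (+ n) (sum f)) (cong (λ t → + n * (K + 1ℤ) - t) e)))
      where
      e₁ : ∀ a b → a - b ≡ a + - 1ℤ * b
      e₁ = solve-∀
      e₂ : ∀ a n s → a * n + - 1ℤ * s ≡ n * a - s
      e₂ = solve-∀

    sum-x : sum x ≡ Δ
    sum-x = sum-defect size sum-size

    sum-y : sum y ≡ Δ
    sum-y = sum-defect degree refl

    X-eq : ∀ p → X p ≡ (K + 1ℤ) * degree p - sum (λ m → M p m * size m)
    X-eq p = trans (sum-cong λ m → e (M p m) (K + 1ℤ) (size m))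
      (trans (sum-- (λ m → (K + 1ℤ) * M p m) (λ m → M p m * size m))
        (cong (_- sum (λ m → M p m * size m)) (sym (*-distribˡ-sum (K + 1ℤ) (λ m → M p m)))))
      where
      e : ∀ a k s → a * (k - s) ≡ k * a - a * s
      e = solve-∀

    sum-apart-X : ∀ p → sum (apart p) ≡ X p - (H - K * y p)
    sum-apart-X p = trans (sum-apart p) (trans
      (cong (λ N → N + (degree p - 1ℤ) - sum (λ m → M p m * size m)) n≡)
      (trans (e K H (degree p) (sum (λ m → M p m * size m)))
        (cong (_- (H - K * y p)) (sym (X-eq p)))))
      where
      e : ∀ K H d s → (K * K + K + 1ℤ - H) + (d - 1ℤ) - s ≡ ((K + 1ℤ) * d - s) - (H - K * (K + 1ℤ - d))
      e = solve-∀

    X-bound : ∀ p → 0ℤ ≤ X p - (H - K * y p)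
    X-bound p = subst (0ℤ ≤_) (sum-apart-X p) (sum-nonneg (apart-nonneg p))

    sum-X : ∀ φ → sum (λ p → φ p * X p) ≡ sum (λ m → x m * trace φ m)
    sum-X φ = sym (sum-trace φ x)

    fullBound : let P = K * K + K + 1ℤ - H in 0ℤ ≤ K → 0ℤ ≤ + 2 * K * D - P * H
    fullBound 0≤K = subst (0ℤ ≤_) (e K H D incidences)
      (subst (λ N → 0ℤ ≤ (N * (N - 1ℤ) + K * (K + 1ℤ) * N) - + 2 * K * incidences) n≡ (gap (keepAll 0≤K))
        ⊹ 0≤+ {2} ⊛ 0≤K ⊛ gap-many)
      where
      e : ∀ K H D i → ((K * K + K + 1ℤ - H) * ((K * K + K + 1ℤ - H) - 1ℤ) + K * (K + 1ℤ) * (K * K + K + 1ℤ - H)) - + 2 * K * i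
            + + 2 * K * (i - ((K * K + K + 1ℤ - H) * (K + 1ℤ) - D))
          ≡ + 2 * K * D - (K * K + K + 1ℤ - H) * H
      e = solve-∀

    gap-size : let P = K * K + K + 1ℤ - H in ∀ l → 0ℤ ≤ P - size l
    gap-size l = subst (λ N → 0ℤ ≤ N - size l) n≡ (gap (size≤n l))

    lineBound : let P = K * K + K + 1ℤ - H in 0ℤ ≤ K - 1ℤ → ∀ l →
      0ℤ ≤ (P - size l) * (P - size l - 1ℤ) + (K - 1ℤ) * K * (P - 1ℤ)
           - + 2 * (K - 1ℤ) * (P * K - D - (size l - 1ℤ))
    lineBound 1≤K l = subst (0ℤ ≤_) (e K H D incidences (size l))
      (subst (λ N → 0ℤ ≤ ((N - size l) * (N - size l - 1ℤ) + (K - 1ℤ) * (K - 1ℤ + 1ℤ) * (N - 1ℤ))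
          - + 2 * (K - 1ℤ) * (incidences - N - (size l - 1ℤ))) n≡ (gap (removeLine 1≤K l))
        ⊹ 0≤+ {2} ⊛ 1≤K ⊛ gap-many)
      where
      e : ∀ K H D i s → let P = K * K + K + 1ℤ - H in
        ((P - s) * (P - s - 1ℤ) + (K - 1ℤ) * (K - 1ℤ + 1ℤ) * (P - 1ℤ)) - + 2 * (K - 1ℤ) * (i - P - (s - 1ℤ))
          + + 2 * (K - 1ℤ) * (i - (P * (K + 1ℤ) - D))
        ≡ (P - s) * (P - s - 1ℤ) + (K - 1ℤ) * K * (P - 1ℤ) - + 2 * (K - 1ℤ) * (P * K - D - (s - 1ℤ))
      e = solve-∀

    module NoLongLines (0≤x : ∀ m → 0ℤ ≤ x m) where

      0≤X : ∀ p → 0ℤ ≤ X p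
      0≤X p = sum-nonneg λ m → 01⇒0≤ (M-01 p m) ⊛ 0≤x m

      -- A line of defect x lies on K + 1 - x points and so contributes x(K + 1 - x), which is at
      -- most K x because x(x - 1) is nonnegative.
      sum-X≤KΔ : sum X ≤ K * Δ
      sum-X≤KΔ = subst₂ _≤_ (trans (sym (sum-X (λ _ → 1ℤ))) (sum-cong λ p → *-identityˡ (X p)))
        (trans (sym (*-distribˡ-sum K x)) (cong (λ t → K * t) sum-x))
        (sum-mono λ m → certify (0≤n*[n-1] (x m)) (trans
          (cong (λ t → K * x m - x m * t) (sum-cong λ p → *-identityˡ (M p m))) (e K (size m))))
        where
        e : ∀ K s → K * (K + 1ℤ - s) - (K + 1ℤ - s) * s ≡ (K + 1ℤ - s) * (K + 1ℤ - s - 1ℤ)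
        e = solve-∀

      averaging : let P = K * K + K + 1ℤ - H in ∀ α β → 0ℤ ≤ K + β → (∀ p → α - β * y p ≤ X p) → 0ℤ ≤ (K + β) * D - α * P
      averaging α β 0≤K+β h = subst (0ℤ ≤_) (trans
          (cong (λ t → K * Δ - t + (K + β) * (D - Δ)) (trans (sum-affine′ α β y) (cong₂ (λ N t → α * N - β * t) n≡ sum-y)))
          (e K α β D Δ (K * K + K + 1ℤ - H)))
        (gap (≤-trans (sum-mono h) sum-X≤KΔ) ⊹ 0≤K+β ⊛ Δ≤D)
        where
        e : ∀ K α β D Δ P → K * Δ - (α * P - β * Δ) + (K + β) * (D - Δ) ≡ (K + β) * D - α * P
        e = solve-∀
        sum-affine′ : ∀ α β (f : Fin n → ℤ) → sum (λ i → α - β * f i) ≡ α * + n - β * sum f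
        sum-affine′ α β f = trans (sum-cong λ i → e₁ α β (f i)) (trans (sum-affine α (- β) f) (e₂ (α * + n) β (sum f)))
          where
          e₁ : ∀ a b c → a - b * c ≡ a + - b * c
          e₁ = solve-∀
          e₂ : ∀ a b c → a + - b * c ≡ a - b * c
          e₂ = solve-∀

      module _ (0≤y : ∀ p → 0ℤ ≤ y p) where

        y≡0⇒X≥H : ∀ p → y p ≡ 0ℤ → 0ℤ ≤ X p - H
        y≡0⇒X≥H p y≡0 = subst (0ℤ ≤_) (trans (cong (λ t → X p - (H - K * t)) y≡0) (e (X p) H K)) (X-bound p)
          where
          e : ∀ X H K → X - (H - K * 0ℤ) ≡ X - H
          e = solve-∀

        -- A point without defect has `X ≥ H`; at any other point the weight `H − H * y` is at most
        -- 0, hence at most `X`.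
        averageBound : let P = K * K + K + 1ℤ - H in 0ℤ ≤ K → 0ℤ ≤ H → 0ℤ ≤ (K + H) * D - H * P
        averageBound 0≤K 0≤H = averaging H H (0≤K ⊹ 0≤H) pointwise
          where
          pointwise : ∀ p → H - H * y p ≤ X p
          pointwise p with zero-or-positive (y p) (0≤y p)
          ... | inj₁ y≡0 = certify (y≡0⇒X≥H p y≡0) (trans (cong (λ t → X p - (H - H * t)) y≡0) (e (X p) H))
            where
            e : ∀ X H → X - (H - H * 0ℤ) ≡ X - H
            e = solve-∀
          ... | inj₂ 1≤y = certify (0≤X p ⊹ 0≤H ⊛ 1≤y) (e (X p) H (y p))
            where
            e : ∀ X H y → X - (H - H * y) ≡ X + H * (y - 1ℤ)
            e = solve-∀

  -- The case h = 3

  incidences-dual : ∀ {n} (I : Incidence n) → Incidence.incidences (Incidence.dual I) ≡ Incidence.incidences I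
  incidences-dual I = Incidence.sum-size I

  module ThreeDefect {n : ℕ} (I : Incidence n) (K : ℤ) (n≡ : + n ≡ K * K + K + 1ℤ - + 3)
                     (many : + n * (K + 1ℤ) - (+ 3 * K - + 4) ≤ Incidence.incidences I) where

    open Incidence I
    open Removal I K using (meet; off; removeLineAndPoint; removeTwoLines)
    open Defects I K (+ 3) (+ 3 * K - + 4) n≡ many

    private
      many-dual : + n * (K + 1ℤ) - (+ 3 * K - + 4) ≤ Incidence.incidences dual
      many-dual = subst (+ n * (K + 1ℤ) - (+ 3 * K - + 4) ≤_) (sym (incidences-dual I)) many

      module Dual = Defects dual K (+ 3) (+ 3 * K - + 4) n≡ many-dual

    module _ (0≤x : ∀ m → 0ℤ ≤ x m) (0≤y : ∀ p → 0ℤ ≤ y p) (3≤K : 0ℤ ≤ K - + 3) where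

      open NoLongLines 0≤x

      private
        0≤K : 0ℤ ≤ K
        0≤K = subst (0ℤ ≤_) (e K) (3≤K ⊹ 0≤+ {3})
          where
          e : ∀ K → K - + 3 + + 3 ≡ K
          e = solve-∀

      full : Fin n → ℤ
      full m = 𝟙 (x m ≤? 0ℤ)

      full-01 : ∀ m → ZeroOne (full m)
      full-01 m = 𝟙-01 (x m ≤? 0ℤ)

      -- A point of degree `K + 1` has lines of total defect at least 3, so one of them is not full.
      -- Any other point lies on at most `K` lines in all.
      fullLinesThrough≤K : ∀ q → 0ℤ ≤ K - sum (λ m → M q m * full m)
      fullLinesThrough≤K q = by-degree (zero-or-positive (y q) (0≤y q))
        where
        Z W : ℤ
        Z = sum (λ m → M q m * full m)
        W = degree q - Z
        W-eq : sum (λ m → M q m * (1ℤ - full m)) ≡ W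
        W-eq = trans (sum-cong λ m → e (M q m) (full m)) (sum-- (λ m → M q m) (λ m → M q m * full m))
          where
          e : ∀ a b → a * (1ℤ - b) ≡ a - a * b
          e = solve-∀
        0≤W : 0ℤ ≤ W
        0≤W = subst (0ℤ ≤_) W-eq (sum-nonneg λ m → 01⇒0≤ (M-01 q m) ⊛ 01⇒0≤ (01-complement (full-01 m)))
        x≤ : ∀ m → 0ℤ ≤ (K + 1ℤ) * (1ℤ - full m) - x m
        x≤ m with x m ≤? 0ℤ
        ... | yes x≤0 = subst (0ℤ ≤_) (e K (x m)) (gap x≤0)
          where
          e : ∀ K x → 0ℤ - x ≡ (K + 1ℤ) * (1ℤ - 1ℤ) - x
          e = solve-∀
        ... | no _ = subst (0ℤ ≤_) (e K (size m)) (0≤size m)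
          where
          e : ∀ K s → s ≡ (K + 1ℤ) * (1ℤ - 0ℤ) - (K + 1ℤ - s)
          e = solve-∀
        X≤ : 0ℤ ≤ (K + 1ℤ) * W - X q
        X≤ = subst (0ℤ ≤_) (trans (sum-- (λ m → (K + 1ℤ) * (M q m * (1ℤ - full m))) (λ m → M q m * x m))
            (cong (_- X q) (trans (sym (*-distribˡ-sum (K + 1ℤ) (λ m → M q m * (1ℤ - full m)))) (cong (λ t → (K + 1ℤ) * t) W-eq))))
          (sum-nonneg λ m → subst (0ℤ ≤_) (e (M q m) (K + 1ℤ) (1ℤ - full m) (x m)) (01⇒0≤ (M-01 q m) ⊛ x≤ m))
          where
          e : ∀ a k f x → a * (k * f - x) ≡ k * (a * f) - a * x
          e = solve-∀
        by-degree : y q ≡ 0ℤ ⊎ 0ℤ ≤ y q - 1ℤ → 0ℤ ≤ K - Z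
        by-degree (inj₂ 1≤y) = subst (0ℤ ≤_) (e K (degree q) Z) (0≤W ⊹ 1≤y)
          where
          e : ∀ K d z → (d - z) + (K + 1ℤ - d - 1ℤ) ≡ K - z
          e = solve-∀
        by-degree (inj₁ y≡0) with zero-or-positive W 0≤W
        ... | inj₁ W≡0 = ⊥-elim (refute {n = 2} (y≡0⇒X≥H 0≤y q y≡0 ⊹ X≤)
          (trans (cong (λ t → X q - + 3 + ((K + 1ℤ) * t - X q)) W≡0) (e (X q) K)))
          where
          e : ∀ X K → X - + 3 + ((K + 1ℤ) * 0ℤ - X) ≡ -[1+ 2 ]
          e = solve-∀
        ... | inj₂ 1≤W = subst (0ℤ ≤_) (trans (cong (λ t → degree q - Z - 1ℤ + t) (sym y≡0)) (e K (degree q) Z)) (1≤W ⊹ 0≤+ {0})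
          where
          e : ∀ K d z → d - z - 1ℤ + (K + 1ℤ - d) ≡ K - z
          e = solve-∀

      -- The K − 3 points not joined to p must cover all full lines missing p.
      no-isolated-defect : ∀ p → y p ≡ 1ℤ → X p ≡ 0ℤ → ⊥
      no-isolated-defect p y≡1 X≡0 = refute {n = 1} (gap cover ⊹ Δ≤D)
          (e K Δ)
        where
        e : ∀ K Δ → K * (K - + 3) - ((K * K + K + 1ℤ - + 3) - Δ - K) + (+ 3 * K - + 4 - Δ) ≡ -[1+ 1 ]
        e = solve-∀
        degree≡K : degree p ≡ K
        degree≡K = trans (e′ K (degree p)) (trans (cong (λ t → K + 1ℤ - t) y≡1) (e″ K))
          where
          e′ : ∀ K d → d ≡ K + 1ℤ - (K + 1ℤ - d)
          e′ = solve-∀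
          e″ : ∀ K → K + 1ℤ - 1ℤ ≡ K
          e″ = solve-∀
        pointwise : ∀ m → full m * (1ℤ - M p m) ≤ full m * trace (apart p) m
        pointwise m with x m ≤? 0ℤ
        ... | no _ = ≤-refl
        ... | yes x≤0 with M-01 p m
        ...   | inj₂ M≡1 = certify (sum-nonneg {f = λ q → apart p q * M q m} (λ q → apart-nonneg p q ⊛ 01⇒0≤ (M-01 q m)))
          (trans (cong (λ t → 1ℤ * trace (apart p) m - 1ℤ * (1ℤ - t)) M≡1) (e′ (trace (apart p) m)))
          where
          e′ : ∀ t → 1ℤ * t - 1ℤ * (1ℤ - 1ℤ) ≡ t
          e′ = solve-∀
        ...   | inj₁ M≡0 = certify (gap (apart-on-line p m M≡0) ⊹ gap x≤0) (trans
          (cong₂ (λ t u → 1ℤ * t - 1ℤ * (1ℤ - u)) (sum-cong λ q → *-comm (apart p q) (M q m)) M≡0)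
          (trans (e′ K A (size m)) (cong (λ t → A - (size m - t) + (0ℤ - x m)) (sym degree≡K))))
          where
          A = sum (λ q → M q m * apart p q)
          e′ : ∀ K A s → 1ℤ * A - 1ℤ * (1ℤ - 0ℤ) ≡ A - (s - K) + (0ℤ - (K + 1ℤ - s))
          e′ = solve-∀
        -- A line that is not full has defect at least 1, so this linear expression bounds the
        -- indicator of the full lines missing `p`. Its sum n - Δ - K is at least K² - 3K + 2, more
        -- than the K(K - 3) that the points not joined to `p` can cover.
        lower : ∀ m → 1ℤ - (x m + M p m) ≤ full m * (1ℤ - M p m)
        lower m with x m ≤? 0ℤ
        ... | yes _ = certify (0≤x m) (e′ (x m) (M p m))
          where
          e′ : ∀ x M → 1ℤ * (1ℤ - M) - (1ℤ - (x + M)) ≡ x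
          e′ = solve-∀
        ... | no x≰0 = certify (gap (≰⇒≥+1 x≰0) ⊹ 01⇒0≤ (M-01 p m)) (e′ (x m) (M p m))
          where
          e′ : ∀ x M → 0ℤ * (1ℤ - M) - (1ℤ - (x + M)) ≡ x - (0ℤ + 1ℤ) + M
          e′ = solve-∀
        total : sum (λ m → 1ℤ - (x m + M p m)) ≡ (K * K + K + 1ℤ - + 3) - Δ - K
        total = trans (sum-- (λ _ → 1ℤ) (λ m → x m + M p m)) (trans
          (cong₂ _-_ (trans (sum-1 n) n≡) (trans (∑-distrib-+ x (λ m → M p m)) (cong₂ _+_ sum-x degree≡K)))
          (e′ (K * K + K + 1ℤ - + 3) Δ K))
          where
          e′ : ∀ a b c → a - (b + c) ≡ a - b - c
          e′ = solve-∀
        upper : sum (λ m → full m * trace (apart p) m) ≤ K * (K - + 3)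
        upper = subst₂ _≤_ (sym (sum-trace (apart p) full))
          (trans (sym (*-distribˡ-sum K (apart p))) (cong (λ t → K * t) (trans (sum-apart-X p)
            (trans (cong₂ (λ a b → a - (+ 3 - K * b)) X≡0 y≡1) (e′ K)))))
          (sum-mono λ q → certify (apart-nonneg p q ⊛ fullLinesThrough≤K q) (e″ K (apart p q) (sum (λ m → M q m * full m))))
          where
          e′ : ∀ K → 0ℤ - (+ 3 - K * 1ℤ) ≡ K - + 3
          e′ = solve-∀
          e″ : ∀ K a z → K * a - a * z ≡ a * (K - z)
          e″ = solve-∀
        cover : (K * K + K + 1ℤ - + 3) - Δ - K ≤ K * (K - + 3)
        cover = subst (_≤ K * (K - + 3)) total (≤-trans (sum-mono lower) (≤-trans (sum-mono pointwise) upper))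

      exception-defect≢0 : ∀ p → ¬ + 3 - + 2 * y p ≤ X p → ¬ y p ≡ 0ℤ
      exception-defect≢0 p X≱ y≡0 =
        X≱ (certify (y≡0⇒X≥H 0≤y p y≡0) (trans (cong (λ t → X p - (+ 3 - + 2 * t)) y≡0) (e (X p))))
        where
        e : ∀ X → X - (+ 3 - + 2 * 0ℤ) ≡ X - + 3
        e = solve-∀

      exception-defect≤1 : ∀ p → ¬ + 3 - + 2 * y p ≤ X p → ¬ 0ℤ ≤ y p - 1ℤ - 1ℤ
      exception-defect≤1 p X≱ 2≤y = refute {n = 1} (gap (≰⇒≥+1 X≱) ⊹ 0≤X p ⊹ 0≤+ {2} ⊛ 2≤y) (e (X p) (y p))
        where
        e : ∀ X y → + 3 - + 2 * y - (X + 1ℤ) + X + + 2 * (y - 1ℤ - 1ℤ) ≡ -[1+ 1 ]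
        e = solve-∀

      exception-X≡0 : ∀ p → ¬ + 3 - + 2 * y p ≤ X p → y p ≡ 1ℤ → X p ≡ 0ℤ
      exception-X≡0 p X≱ y≡1 = ≤-antisym (certify (gap (≰⇒≥+1 X≱))
        (trans (e (X p)) (cong (λ t → + 3 - + 2 * t - (X p + 1ℤ)) (sym y≡1)))) (0≤X p)
        where
        e : ∀ X → 0ℤ - X ≡ + 3 - + 2 * 1ℤ - (X + 1ℤ)
        e = solve-∀

      0-1-or-more : ∀ z → 0ℤ ≤ z → ¬ z ≡ 0ℤ → ¬ 0ℤ ≤ z - 1ℤ - 1ℤ → z ≡ 1ℤ
      0-1-or-more (+ 0) _ z≢0 _ = ⊥-elim (z≢0 refl)
      0-1-or-more (+ 1) _ _ _ = refl
      0-1-or-more (+ suc (suc _)) _ _ z≱2 = ⊥-elim (z≱2 0≤+)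

      averaging-exception⇒⊥ : ∀ p → ¬ + 3 - + 2 * y p ≤ X p → ⊥
      averaging-exception⇒⊥ p X≱ = no-isolated-defect p y≡1 (exception-X≡0 p X≱ y≡1)
        where
        y≡1 : y p ≡ 1ℤ
        y≡1 = 0-1-or-more (y p) (0≤y p) (exception-defect≢0 p X≱) (exception-defect≤1 p X≱)

      nonneg-defects⇒⊥ : ⊥
      nonneg-defects⇒⊥ = search (all? (λ p → + 3 - + 2 * y p ≤? X p))
        where
        search : Dec (∀ p → + 3 - + 2 * y p ≤ X p) → ⊥
        search (yes h) = refute {n = 1} (averaging (+ 3) (+ 2) (0≤K ⊹ 0≤+ {2}) h ⊹ 0≤K) (e K)
          where
          e : ∀ K → (K + + 2) * (+ 3 * K - + 4) - + 3 * (K * K + K + 1ℤ - + 3) + K ≡ -[1+ 1 ]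
          e = solve-∀
        search (no ¬h) = let (p , X≱) = ¬∀⟶∃¬ n (λ p → + 3 - + 2 * y p ≤ X p) (λ p → + 3 - + 2 * y p ≤? X p) ¬h in
          averaging-exception⇒⊥ p X≱

    module _ (6≤K : 0ℤ ≤ K - + 6) (size≤ : ∀ m → size m ≤ K + + 2) where

      private
        1≤K : 0ℤ ≤ K - 1ℤ
        1≤K = subst (0ℤ ≤_) (e K) (6≤K ⊹ 0≤+ {5})
          where
          e : ∀ K → K - + 6 + + 5 ≡ K - 1ℤ
          e = solve-∀
        0≤K : 0ℤ ≤ K
        0≤K = subst (0ℤ ≤_) (e K) (6≤K ⊹ 0≤+ {6})
          where
          e : ∀ K → K - + 6 + + 6 ≡ K
          e = solve-∀

      long : Fin n → ℤ
      long m = 𝟙 (K + + 2 ≤? size m)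

      -- Deleting both lines contradicts the count: a common point returns its degree, and K/2 is
      -- enough for that.
      long-pair⇒⊥ : ∀ {l l′} → l ≢ l′ → size l ≡ K + + 2 → size l′ ≡ K + + 2 →
                     (∀ p → 0ℤ ≤ M p l * M p l′ * (+ 2 * degree p - K)) → ⊥
      long-pair⇒⊥ {l} {l′} l≢l′ sl sl′ high = refute {n = 0}
          (bound ⊹ 0≤+ {2} ⊛ 1≤K ⊛ gap-many ⊹ 1≤K ⊛ weighted
            -- The slack is interpolated between c = 0 and c = 1, the possible numbers of common
            -- points; the term c(1 - c) corrects for its being quadratic in c.
            ⊹ (0≤1-c ⊛ (6≤K ⊛ (6≤K ⊹ 0≤+ {23}) ⊹ 0≤+ {47}) ⊹ 0≤c ⊛ (0≤+ {8} ⊛ 6≤K ⊹ 0≤+ {9}) ⊹ 0≤c ⊛ 0≤1-c))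
          (e K incidences c R)
        where
        c R : ℤ
        c = meet l l′
        R = sum (λ p → M p l * M p l′ * degree p)
        0≤c : 0ℤ ≤ c
        0≤c = sum-nonneg λ p → 01⇒0≤ (M-01 p l) ⊛ 01⇒0≤ (M-01 p l′)
        0≤1-c : 0ℤ ≤ 1ℤ - c
        0≤1-c = gap (meet-≤1 l l′ l≢l′)
        weighted : 0ℤ ≤ + 2 * R - K * c
        weighted = subst (0ℤ ≤_) (trans (sum-cong λ p → e′ (M p l * M p l′) (degree p) K)
          (trans (sum-linear (+ 2) (- K) (λ p → M p l * M p l′ * degree p) (λ p → M p l * M p l′)) (e″ R c K))) (sum-nonneg high)
          where
          e′ : ∀ r d k → r * (+ 2 * d - k) ≡ + 2 * (r * d) + - k * r
          e′ = solve-∀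
          e″ : ∀ R c k → + 2 * R + - k * c ≡ + 2 * R - k * c
          e″ = solve-∀
        bound : let P = K * K + K + 1ℤ - + 3 in 0ℤ ≤ (P - (K + + 2) - (K + + 2 - c)) * (P - (K + + 2) - (K + + 2 - c) - 1ℤ)
            + (K - 1ℤ) * (K - 1ℤ + 1ℤ) * (P - 1ℤ - 1ℤ)
            - + 2 * (K - 1ℤ) * (incidences - + 2 * P + R - (K + + 2 - + 2 + c) - (K + + 2 - + 2 + c))
        bound = subst (λ N → 0ℤ ≤ (N - (K + + 2) - (K + + 2 - c)) * (N - (K + + 2) - (K + + 2 - c) - 1ℤ)
            + (K - 1ℤ) * (K - 1ℤ + 1ℤ) * (N - 1ℤ - 1ℤ)
            - + 2 * (K - 1ℤ) * (incidences - + 2 * N + R - (K + + 2 - + 2 + c) - (K + + 2 - + 2 + c))) n≡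
          (subst₂ (λ s s′ → 0ℤ ≤ (+ n - s - (s′ - c)) * (+ n - s - (s′ - c) - 1ℤ)
            + (K - 1ℤ) * (K - 1ℤ + 1ℤ) * (+ n - 1ℤ - 1ℤ)
            - + 2 * (K - 1ℤ) * (incidences - + 2 * + n + R - (s - + 2 + c) - (s′ - + 2 + c))) sl sl′
            (gap (removeTwoLines 1≤K l l′ l≢l′)))
        e : ∀ K i c R → let P = K * K + K + 1ℤ - + 3 in
          (P - (K + + 2) - (K + + 2 - c)) * (P - (K + + 2) - (K + + 2 - c) - 1ℤ)
            + (K - 1ℤ) * (K - 1ℤ + 1ℤ) * (P - 1ℤ - 1ℤ)
            - + 2 * (K - 1ℤ) * (i - + 2 * P + R - (K + + 2 - + 2 + c) - (K + + 2 - + 2 + c))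
          + + 2 * (K - 1ℤ) * (i - (P * (K + 1ℤ) - (+ 3 * K - + 4))) + (K - 1ℤ) * (+ 2 * R - K * c)
          + ((1ℤ - c) * ((K - + 6) * (K - + 6 + + 23) + + 47) + c * (+ 8 * (K - + 6) + + 9) + c * (1ℤ - c)) ≡ -[1+ 0 ]
        e = solve-∀

      -- Deleting `q` along with `l` costs few incidences but removes many pairs of points. The
      -- threshold K/2 is such that common points of two long lines are covered either here or by
      -- `long-pair⇒⊥`.
      long-off-low⇒⊥ : ∀ {l q} → size l ≡ K + + 2 → M q l ≡ 0ℤ → 0ℤ ≤ K - (+ 2 * degree q + 1ℤ) → ⊥
      long-off-low⇒⊥ {l} {q} sl q∉l low = refute {n = 64}
          (bound ⊹ 0≤+ {2} ⊛ 1≤K ⊛ gap-many ⊹ 1≤K ⊛ low ⊹ 0≤+ {17} ⊛ 6≤K) (e K incidences (degree q))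
        where
        bound : let P = K * K + K + 1ℤ - + 3 in 0ℤ ≤ (P - (K + + 2) - 1ℤ) * (P - (K + + 2) - 1ℤ - 1ℤ) + (K - 1ℤ) * (K - 1ℤ + 1ℤ) * (P - 1ℤ)
          - + 2 * (K - 1ℤ) * (incidences - P - degree q - (K + + 2 - 1ℤ))
        bound = subst₂ (λ N s → 0ℤ ≤ (N - s - 1ℤ) * (N - s - 1ℤ - 1ℤ) + (K - 1ℤ) * (K - 1ℤ + 1ℤ) * (N - 1ℤ)
          - + 2 * (K - 1ℤ) * (incidences - N - degree q - (s - 1ℤ))) n≡ sl (gap (removeLineAndPoint 1≤K l q q∉l))
        e : ∀ K i d → let P = K * K + K + 1ℤ - + 3 in
          (P - (K + + 2) - 1ℤ) * (P - (K + + 2) - 1ℤ - 1ℤ) + (K - 1ℤ) * (K - 1ℤ + 1ℤ) * (P - 1ℤ)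
            - + 2 * (K - 1ℤ) * (i - P - d - (K + + 2 - 1ℤ))
          + + 2 * (K - 1ℤ) * (i - (P * (K + 1ℤ) - (+ 3 * K - + 4))) + (K - 1ℤ) * (K - (+ 2 * d + 1ℤ)) + + 17 * (K - + 6)
          ≡ -[1+ 64 ]
        e = solve-∀

      -- A point off a line l with k + 2 points is not joined to all of l, which improves the bound
      -- 3 − k y for X to 4 − (k − 1) y and forces at least k − 3 lines of size k + 2. Two of them that
      -- meet in no point of degree below k / 2 may be deleted; otherwise all pass through one such point.
      module _ (l : Fin n) (sl : size l ≡ K + + 2) where

        X-off : ∀ p → M p l ≡ 0ℤ → 0ℤ ≤ X p - (+ 4 - (K - 1ℤ) * y p)
        X-off p p∉l = subst (0ℤ ≤_) (trans (cong (λ t → t - A + (A - (size l - degree p))) (sum-apart-X p))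
            (trans (cong (λ t → X p - (+ 3 - K * y p) - A + (A - (t - degree p))) sl) (e (X p) K A (degree p))))
          (gap A≤ ⊹ gap (apart-on-line p l p∉l))
          where
          A = sum (λ q → M q l * apart p q)
          A≤ : A ≤ sum (apart p)
          A≤ = sum-mono λ q → certify (gap (01⇒≤1 (M-01 q l)) ⊛ apart-nonneg p q) (e′ (M q l) (apart p q))
            where
            e′ : ∀ a b → b - a * b ≡ (1ℤ - a) * b
            e′ = solve-∀
          e : ∀ X K A d → X - (+ 3 - K * (K + 1ℤ - d)) - A + (A - (K + + 2 - d)) ≡ X - (+ 4 - (K - 1ℤ) * (K + 1ℤ - d))
          e = solve-∀

        φ : Fin n → ℤ
        φ p = off l p * 𝟙 (y p ≤? 0ℤ)

        φ-01 : ∀ p → ZeroOne (φ p)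
        φ-01 p = 01-* (01-complement (M-01 p l)) (𝟙-01 (y p ≤? 0ℤ))

        -- Negative point defects are still possible here. For y ≤ 0 the bound 4 - (K - 1) y is at
        -- least 4 - 4y, and for y ≥ 1 the left side is at most 0. The slope 4 is chosen so that the
        -- weight vanishes at y = 1.
        φX≥ : ∀ p → off l p * (+ 4 - + 4 * y p) ≤ φ p * X p
        φX≥ p with M-01 p l
        ... | inj₂ M≡1 = ≤-reflexive (trans (cong (λ t → (1ℤ - t) * (+ 4 - + 4 * y p)) M≡1)
          (trans (*-zeroˡ (+ 4 - + 4 * y p)) (sym (trans (cong (λ t → (1ℤ - t) * 𝟙 (y p ≤? 0ℤ) * X p) M≡1)
            (trans (cong (_* X p) (*-zeroˡ (𝟙 (y p ≤? 0ℤ)))) (*-zeroˡ (X p)))))))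
        ... | inj₁ M≡0 with y p ≤? 0ℤ
        ...   | yes y≤0 = certify (X-off p M≡0 ⊹ (6≤K ⊹ 0≤+ {1}) ⊛ gap y≤0)
          (trans (cong (λ t → (1ℤ - t) * 1ℤ * X p - (1ℤ - t) * (+ 4 - + 4 * y p)) M≡0) (e (X p) K (y p)))
          where
          e : ∀ X K y → (1ℤ - 0ℤ) * 1ℤ * X - (1ℤ - 0ℤ) * (+ 4 - + 4 * y) ≡
                X - (+ 4 - (K - 1ℤ) * y) + (K - + 6 + 1ℤ) * (0ℤ - y)
          e = solve-∀
        ...   | no y≰0 = certify (0≤+ {4} ⊛ gap (≰⇒≥+1 y≰0))
          (trans (cong (λ t → (1ℤ - t) * 0ℤ * X p - (1ℤ - t) * (+ 4 - + 4 * y p)) M≡0) (e (X p) (y p)))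
          where
          e : ∀ X y → (1ℤ - 0ℤ) * 0ℤ * X - (1ℤ - 0ℤ) * (+ 4 - + 4 * y) ≡ + 4 * (y - (0ℤ + 1ℤ))
          e = solve-∀

        W : ℤ
        W = sum long

        -- A line of positive defect has at most `K` points, and a line of defect 0 contributes
        -- nothing. A long line has defect -1, and the term `K * long m` makes its right side 0.
        x-trace≤ : ∀ m → x m * trace φ m ≤ K * x m + K * long m
        x-trace≤ m = by-size (K + + 2 ≤? size m)
          where
          c = trace φ m
          0≤c : 0ℤ ≤ c
          0≤c = sum-nonneg λ p → 01⇒0≤ (φ-01 p) ⊛ 01⇒0≤ (M-01 p m)
          c≤size : 0ℤ ≤ size m - c
          c≤size = gap {c} (sum-mono λ p → certify (gap (01⇒≤1 (φ-01 p)) ⊛ 01⇒0≤ (M-01 p m)) (e (φ p) (M p m)))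
            where
            e : ∀ a b → b - a * b ≡ (1ℤ - a) * b
            e = solve-∀
          by-size : (d : Dec (K + + 2 ≤ size m)) → x m * c ≤ K * x m + K * 𝟙 d
          by-size (yes K+2≤) = certify 0≤c (trans
            (cong (λ s → K * (K + 1ℤ - s) + K * 1ℤ - (K + 1ℤ - s) * c) (≤-antisym (size≤ m) K+2≤)) (e K c))
            where
            e : ∀ K c → K * (K + 1ℤ - (K + + 2)) + K * 1ℤ - (K + 1ℤ - (K + + 2)) * c ≡ c
            e = solve-∀
          by-size (no K+2≰) with dichotomy (x m) 0ℤ
          ... | inj₁ x≤0 = ≤-reflexive (trans (cong (_* c) x≡0) (trans (e K c) (cong (λ t → K * t + K * 0ℤ) (sym x≡0))))
            where
            x≡0 : x m ≡ 0ℤ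
            x≡0 = ≤-antisym x≤0 (subst (0ℤ ≤_) (e′ K (size m)) (gap (≰⇒≥+1 K+2≰)))
              where
              e′ : ∀ K s → K + + 2 - (s + 1ℤ) ≡ K + 1ℤ - s
              e′ = solve-∀
            e : ∀ K c → 0ℤ * c ≡ K * 0ℤ + K * 0ℤ
            e = solve-∀
          ... | inj₂ 1≤x = certify ((1≤x ⊹ 0≤+ {1}) ⊛ (c≤size ⊹ 1≤x)) (e K (size m) c)
            where
            e : ∀ K s c → K * (K + 1ℤ - s) + K * 0ℤ - (K + 1ℤ - s) * c ≡
                  (K + 1ℤ - s - (0ℤ + 1ℤ) + 1ℤ) * (s - c + (K + 1ℤ - s - (0ℤ + 1ℤ)))
            e = solve-∀

        many-long : 0ℤ ≤ W - (K - + 3)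
        many-long with dichotomy W (K - + 4)
        ... | inj₂ h = subst (0ℤ ≤_) (e W K) h
          where
          e : ∀ W K → W - (K - + 4 + 1ℤ) ≡ W - (K - + 3)
          e = solve-∀
        ... | inj₁ W≤ = ⊥-elim (refute {n = 11}
            (gap total ⊹ (0≤+ {4} ⊹ 0≤K) ⊛ Δ≤D ⊹ 0≤K ⊛ gap W≤ ⊹ 0≤+ {4} ⊛ Dual.X-bound l)
            (trans (cong₂ (λ N s → K * Δ + K * W - (+ 4 * N - + 4 * Δ - + 4 * s + + 4 * Y)
                + (+ 4 + K) * (+ 3 * K - + 4 - Δ) + K * (K - + 4 - W) + + 4 * (Y - (+ 3 - K * (K + 1ℤ - s)))) n≡ sl)
              (e K Δ W Y)))
          where
          -- The points of `l` are left out of φ. As `l` has defect -1, the dual of `X-bound` makes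
          -- their total defect at least K + 3.
          Y : ℤ
          Y = sum (λ p → M p l * y p)
          lhs : sum (λ p → off l p * (+ 4 - + 4 * y p)) ≡ + 4 * + n - + 4 * Δ - + 4 * size l + + 4 * Y
          lhs = trans (sum-cong λ p → e₁ (M p l) (y p)) (trans
            (∑-distrib-+ (λ p → + 4 + - (+ 4) * y p) (λ p → - (+ 4) * M p l + + 4 * (M p l * y p)))
            (trans (cong₂ _+_ (sum-affine (+ 4) (- (+ 4)) y) (sum-linear (- (+ 4)) (+ 4) (λ p → M p l) (λ p → M p l * y p)))
              (trans (cong (λ t → + 4 * + n + - (+ 4) * t + (- (+ 4) * size l + + 4 * Y)) sum-y) (e₂ (+ n) Δ (size l) Y))))
            where
            e₁ : ∀ M y → (1ℤ - M) * (+ 4 - + 4 * y) ≡ + 4 + - (+ 4) * y + (- (+ 4) * M + + 4 * (M * y))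
            e₁ = solve-∀
            e₂ : ∀ N D s Y → + 4 * N + - (+ 4) * D + (- (+ 4) * s + + 4 * Y) ≡ + 4 * N - + 4 * D - + 4 * s + + 4 * Y
            e₂ = solve-∀
          total : + 4 * + n - + 4 * Δ - + 4 * size l + + 4 * Y ≤ K * Δ + K * W
          total = subst₂ _≤_ lhs (trans (sum-linear K K x long) (cong (λ t → K * t + K * W) sum-x))
            (≤-trans (sum-mono φX≥) (subst (_≤ sum (λ m → K * x m + K * long m)) (sym (sum-X φ)) (sum-mono x-trace≤)))
          e : ∀ K Δ W Y → K * Δ + K * W - (+ 4 * (K * K + K + 1ℤ - + 3) - + 4 * Δ - + 4 * (K + + 2) + + 4 * Y)
                + (+ 4 + K) * (+ 3 * K - + 4 - Δ) + K * (K - + 4 - W) + + 4 * (Y - (+ 3 - K * (K + 1ℤ - (K + + 2)))) ≡ -[1+ 11 ]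
          e = solve-∀

        only-long⇒⊥ : ¬ ∃ (λ m → l ≢ m × K + + 2 ≤ size m) → ⊥
        only-long⇒⊥ none = refute {n = 1} (many-long ⊹ gap W≤1 ⊹ 6≤K) (e W K)
          where
          e : ∀ W K → W - (K - + 3) + (1ℤ - W) + (K - + 6) ≡ -[1+ 1 ]
          e = solve-∀
          pointwise : ∀ m → long m ≤ 𝟙 (l ≟ m)
          pointwise m with l ≟ m | K + + 2 ≤? size m
          ... | yes _ | yes _ = ≤-refl
          ... | yes _ | no _ = 0≤+
          ... | no l≢m | yes h = ⊥-elim (none (m , l≢m , h))
          ... | no _ | no _ = ≤-refl
          W≤1 : W ≤ 1ℤ
          W≤1 = subst (W ≤_) (sum-𝟙≟ l) (sum-mono pointwise)

        -- By `long-off-low⇒⊥` such a point lies on all long lines, of which there are at least K -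
        -- 3; for K ≥ 6 this exceeds its degree.
        low-point⇒⊥ : ∀ q → 0ℤ ≤ K - (+ 2 * degree q + 1ℤ) → ⊥
        low-point⇒⊥ q low = refute {n = 0} (0≤+ {2} ⊛ many-long ⊹ 0≤+ {2} ⊛ gap W≤degree ⊹ low ⊹ 6≤K) (e W K (degree q))
          where
          e : ∀ W K d → + 2 * (W - (K - + 3)) + + 2 * (d - W) + (K - (+ 2 * d + 1ℤ)) + (K - + 6) ≡ -[1+ 0 ]
          e = solve-∀
          pointwise : ∀ m → long m ≤ M q m
          pointwise m with K + + 2 ≤? size m | M-01 q m
          ... | no _ | M01 = 01⇒0≤ M01
          ... | yes _ | inj₂ M≡1 = ≤-reflexive (sym M≡1)
          ... | yes h | inj₁ M≡0 = ⊥-elim (long-off-low⇒⊥ (≤-antisym (size≤ m) h) M≡0 low)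
          W≤degree : W ≤ degree q
          W≤degree = sum-mono pointwise

        long-line⇒⊥ : ⊥
        long-line⇒⊥ with any? (λ m → ¬? (l ≟ m) ×-dec (K + + 2 ≤? size m))
        ... | no none = only-long⇒⊥ none
        ... | yes (l′ , l≢l′ , h)
            with any? (λ q → (1ℤ ≤? M q l * M q l′) ×-dec (+ 2 * degree q + 1ℤ ≤? K))
        ...   | yes (q , _ , low) = low-point⇒⊥ q (gap low)
        ...   | no none = long-pair⇒⊥ l≢l′ sl (≤-antisym (size≤ l′) h) high
          where
          high : ∀ p → 0ℤ ≤ M p l * M p l′ * (+ 2 * degree p - K)
          high p with 01-* (M-01 p l) (M-01 p l′)
          ... | inj₁ ρ≡0 = ≤-reflexive (sym (trans (cong (_* (+ 2 * degree p - K)) ρ≡0) (*-zeroˡ (+ 2 * degree p - K))))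
          ... | inj₂ ρ≡1 = 01⇒0≤ (01-* (M-01 p l) (M-01 p l′)) ⊛ subst (0ℤ ≤_) (e K (degree p))
                (gap (≰⇒≥+1 (λ low → none (p , ≤-reflexive (sym ρ≡1) , low))))
            where
            e : ∀ K d → + 2 * d + 1ℤ - (K + 1ℤ) ≡ + 2 * d - K
            e = solve-∀

  -- Upper bounds

  module _ {n : ℕ} (K : ℤ) (1≤K : 0ℤ ≤ K - 1ℤ) where

    Many : ℤ → Incidence n → Set
    Many D I = + n * (K + 1ℤ) - D ≤ Incidence.incidences I

    many-dual : ∀ {D} (I : Incidence n) → Many D I → Many D (Incidence.dual I)
    many-dual {D} I = subst (+ n * (K + 1ℤ) - D ≤_) (sym (incidences-dual I))

    0≤K : 0ℤ ≤ K
    0≤K = subst (0ℤ ≤_) (e K) (1≤K ⊹ 0≤+ {1})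
      where
      e : ∀ K → K - 1ℤ + 1ℤ ≡ K
      e = solve-∀

    not-many-0 : + n ≡ K * K + K + 1ℤ - + 0 → (I : Incidence n) → ¬ Many -1ℤ I
    not-many-0 n≡ I many = refute {n = 1} (Defects.fullBound I K (+ 0) -1ℤ n≡ many 0≤K ⊹ 0≤+ {2} ⊛ 1≤K) (e K)
      where
      e : ∀ K → + 2 * K * -1ℤ - (K * K + K + 1ℤ - + 0) * + 0 + + 2 * (K - 1ℤ) ≡ -[1+ 1 ]
      e = solve-∀

    module _ (n≡ : + n ≡ K * K + K + 1ℤ - + 1) where

      -- The expression in `lineBound` is a quadratic in the size with leading coefficient 1. It is
      -- negative at K + 2 and at n, hence at all sizes in between; the product in the certificate
      -- expresses this convexity.
      size≤-1 : (I : Incidence n) → Many (K - 1ℤ) I → 0ℤ ≤ K - (+ 2 + 1ℤ) → ∀ m → 0ℤ ≤ K + 1ℤ - Incidence.size I m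
      size≤-1 I many 3≤K m = by-size (dichotomy (size m) (K + 1ℤ))
        where
        open Incidence I
        open Defects I K (+ 1) (K - 1ℤ) n≡ many
        by-size : size m ≤ K + 1ℤ ⊎ 0ℤ ≤ size m - (K + 1ℤ + 1ℤ) → 0ℤ ≤ K + 1ℤ - size m
        by-size (inj₁ h) = gap h
        by-size (inj₂ h) = ⊥-elim (refute {n = 11} (lineBound 1≤K m ⊹ 3≤K ⊛ (0≤K ⊹ 0≤+ {6})
            ⊹ h ⊛ (gap-size m ⊹ 3≤K ⊛ (0≤K ⊹ 0≤+ {1}) ⊹ 0≤+ {2})) (e K (size m)))
          where
          e : ∀ K s → let P = K * K + K + 1ℤ - + 1 in
            (P - s) * (P - s - 1ℤ) + (K - 1ℤ) * K * (P - 1ℤ) - + 2 * (K - 1ℤ) * (P * K - (K - 1ℤ) - (s - 1ℤ))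
            + (K - (+ 2 + 1ℤ)) * (K + + 6)
            + (s - (K + 1ℤ + 1ℤ)) * (P - s + (K - (+ 2 + 1ℤ)) * (K + + 1) + + 2) ≡ -[1+ 11 ]
          e = solve-∀

      not-many-1 : (I : Incidence n) → ¬ Many (K - 1ℤ) I
      not-many-1 I many = by-K (dichotomy K (+ 2))
        where
        open Defects I K (+ 1) (K - 1ℤ) n≡ many
        by-K : K ≤ + 2 ⊎ 0ℤ ≤ K - (+ 2 + 1ℤ) → ⊥
        by-K (inj₁ K≤2) = refute {n = 1} (fullBound 0≤K ⊹ 1≤K ⊛ gap K≤2) (e K)
          where
          e : ∀ K → + 2 * K * (K - 1ℤ) - (K * K + K + 1ℤ - + 1) * + 1 + (K - 1ℤ) * (+ 2 - K) ≡ -[1+ 1 ]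
          e = solve-∀
        by-K (inj₂ 3≤K) = refute {n = 1} (NoLongLines.averageBound (size≤-1 I many 3≤K)
            (size≤-1 (Incidence.dual I) (many-dual I many) 3≤K) 0≤K 0≤+ ⊹ 1≤K) (e K)
          where
          e : ∀ K → (K + + 1) * (K - 1ℤ) - + 1 * (K * K + K + 1ℤ - + 1) + (K - 1ℤ) ≡ -[1+ 1 ]
          e = solve-∀

    module _ (n≡ : + n ≡ K * K + K + 1ℤ - + 2) where

      size≤-2 : (I : Incidence n) → Many (+ 2 * K - + 2) I → 0ℤ ≤ K - (+ 2 + 1ℤ) → ∀ m → 0ℤ ≤ K + 1ℤ - Incidence.size I m
      size≤-2 I many 3≤K m = by-size (dichotomy (size m) (K + 1ℤ))
        where
        open Incidence I
        open Defects I K (+ 2) (+ 2 * K - + 2) n≡ many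
        by-size : size m ≤ K + 1ℤ ⊎ 0ℤ ≤ size m - (K + 1ℤ + 1ℤ) → 0ℤ ≤ K + 1ℤ - size m
        by-size (inj₁ h) = gap h
        by-size (inj₂ h) = ⊥-elim (refute {n = 9} (lineBound 1≤K m ⊹ 0≤+ {8} ⊛ 3≤K
            ⊹ h ⊛ (gap-size m ⊹ 3≤K ⊛ (0≤K ⊹ 0≤+ {1}) ⊹ 0≤+ {1})) (e K (size m)))
          where
          e : ∀ K s → let P = K * K + K + 1ℤ - + 2 in
            (P - s) * (P - s - 1ℤ) + (K - 1ℤ) * K * (P - 1ℤ) - + 2 * (K - 1ℤ) * (P * K - (+ 2 * K - + 2) - (s - 1ℤ))
            + + 8 * (K - (+ 2 + 1ℤ))
            + (s - (K + 1ℤ + 1ℤ)) * (P - s + (K - (+ 2 + 1ℤ)) * (K + + 1) + + 1) ≡ -[1+ 9 ]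
          e = solve-∀

      not-many-2 : (I : Incidence n) → ¬ Many (+ 2 * K - + 2) I
      not-many-2 I many = by-K (dichotomy K (+ 2))
        where
        open Defects I K (+ 2) (+ 2 * K - + 2) n≡ many
        by-K : K ≤ + 2 ⊎ 0ℤ ≤ K - (+ 2 + 1ℤ) → ⊥
        by-K (inj₁ K≤2) = refute {n = 1} (fullBound 0≤K ⊹ 0≤+ {2} ⊛ (1≤K ⊛ gap K≤2)) (e K)
          where
          e : ∀ K → + 2 * K * (+ 2 * K - + 2) - (K * K + K + 1ℤ - + 2) * + 2 + + 2 * ((K - 1ℤ) * (+ 2 - K)) ≡ -[1+ 1 ]
          e = solve-∀
        by-K (inj₂ 3≤K) = refute {n = 1} (NoLongLines.averageBound (size≤-2 I many 3≤K)
            (size≤-2 (Incidence.dual I) (many-dual I many) 3≤K) 0≤K 0≤+) (e K)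
          where
          e : ∀ K → (K + + 2) * (+ 2 * K - + 2) - + 2 * (K * K + K + 1ℤ - + 2) ≡ -[1+ 1 ]
          e = solve-∀

    module _ (n≡ : + n ≡ K * K + K + 1ℤ - + 3) where

      size≤K+2 : (I : Incidence n) → Many (+ 3 * K - + 4) I → 0ℤ ≤ K - (+ 2 + 1ℤ) → ∀ m → Incidence.size I m ≤ K + + 2
      size≤K+2 I many 3≤K m = by-size (dichotomy (size m) (K + + 2))
        where
        open Incidence I
        open Defects I K (+ 3) (+ 3 * K - + 4) n≡ many
        by-size : size m ≤ K + + 2 ⊎ 0ℤ ≤ size m - (K + + 2 + 1ℤ) → size m ≤ K + + 2
        by-size (inj₁ h) = h
        by-size (inj₂ h) = ⊥-elim (refute {n = 9} (lineBound 1≤K m ⊹ gap-size m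
            ⊹ h ⊛ (gap-size m ⊹ 3≤K ⊛ (0≤K ⊹ 0≤+ {1})) ⊹ 0≤+ {13} ⊛ 3≤K) (e K (size m)))
          where
          e : ∀ K s → let P = K * K + K + 1ℤ - + 3 in
            (P - s) * (P - s - 1ℤ) + (K - 1ℤ) * K * (P - 1ℤ) - + 2 * (K - 1ℤ) * (P * K - (+ 3 * K - + 4) - (s - 1ℤ))
            + (P - s) + (s - (K + + 2 + 1ℤ)) * (P - s + (K - (+ 2 + 1ℤ)) * (K + + 1)) + + 13 * (K - (+ 2 + 1ℤ)) ≡ -[1+ 9 ]
          e = solve-∀

      -- At size K + 2 the deletion of one line only yields (K - 2)(K - 13) ≥ 0. For K ≥ 3 this is
      -- absurd up to K = 12, and from 13 on a second deletion is required.
      size≢K+2 : (I : Incidence n) → Many (+ 3 * K - + 4) I → 0ℤ ≤ K - (+ 2 + 1ℤ) → ∀ m → Incidence.size I m ≢ K + + 2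
      size≢K+2 I many 3≤K m sm = by-K (dichotomy K (+ 12))
        where
        open Incidence I
        open Defects I K (+ 3) (+ 3 * K - + 4) n≡ many
        by-K : K ≤ + 12 ⊎ 0ℤ ≤ K - (+ 12 + 1ℤ) → ⊥
        by-K (inj₁ K≤12) = refute {n = 9} (bound ⊹ 3≤K ⊛ gap K≤12) (e K)
          where
          bound : let P = K * K + K + 1ℤ - + 3 in
            0ℤ ≤ (P - (K + + 2)) * (P - (K + + 2) - 1ℤ) + (K - 1ℤ) * K * (P - 1ℤ)
              - + 2 * (K - 1ℤ) * (P * K - (+ 3 * K - + 4) - (K + + 2 - 1ℤ))
          bound = subst (λ s → let P = K * K + K + 1ℤ - + 3 in
            0ℤ ≤ (P - s) * (P - s - 1ℤ) + (K - 1ℤ) * K * (P - 1ℤ)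
              - + 2 * (K - 1ℤ) * (P * K - (+ 3 * K - + 4) - (s - 1ℤ))) sm (lineBound 1≤K m)
          e : ∀ K → let P = K * K + K + 1ℤ - + 3 in
            (P - (K + + 2)) * (P - (K + + 2) - 1ℤ) + (K - 1ℤ) * K * (P - 1ℤ)
              - + 2 * (K - 1ℤ) * (P * K - (+ 3 * K - + 4) - (K + + 2 - 1ℤ)) + (K - (+ 2 + 1ℤ)) * (+ 12 - K) ≡ -[1+ 9 ]
          e = solve-∀
        by-K (inj₂ 13≤K) = ThreeDefect.long-line⇒⊥ I K n≡ many 6≤K (size≤K+2 I many 3≤K) m sm
          where
          6≤K : 0ℤ ≤ K - + 6
          6≤K = subst (0ℤ ≤_) (e K) (13≤K ⊹ 0≤+ {7})
            where
            e : ∀ K → K - (+ 12 + 1ℤ) + + 7 ≡ K - + 6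
            e = solve-∀

      size≤-3 : (I : Incidence n) → Many (+ 3 * K - + 4) I → 0ℤ ≤ K - (+ 2 + 1ℤ) → ∀ m → 0ℤ ≤ K + 1ℤ - Incidence.size I m
      size≤-3 I many 3≤K m = by-size (dichotomy (size m) (K + 1ℤ))
        where
        open Incidence I
        by-size : size m ≤ K + 1ℤ ⊎ 0ℤ ≤ size m - (K + 1ℤ + 1ℤ) → 0ℤ ≤ K + 1ℤ - size m
        by-size (inj₁ h) = gap h
        by-size (inj₂ h) = ⊥-elim (size≢K+2 I many 3≤K m (≤-antisym (size≤K+2 I many 3≤K m) (certify h (e K (size m)))))
          where
          e : ∀ K s → s - (K + + 2) ≡ s - (K + 1ℤ + 1ℤ)
          e = solve-∀

      not-many-3 : (I : Incidence n) → ¬ Many (+ 3 * K - + 4) I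
      not-many-3 I many = by-K (dichotomy K (+ 2))
        where
        by-K : K ≤ + 2 ⊎ 0ℤ ≤ K - (+ 2 + 1ℤ) → ⊥
        by-K (inj₁ K≤2) = refute {n = 1} (Defects.fullBound I K (+ 3) (+ 3 * K - + 4) n≡ many 0≤K
            ⊹ 0≤+ {3} ⊛ (1≤K ⊛ gap K≤2) ⊹ 0≤+ {2} ⊛ 1≤K) (e K)
          where
          e : ∀ K → + 2 * K * (+ 3 * K - + 4) - (K * K + K + 1ℤ - + 3) * + 3 + + 3 * ((K - 1ℤ) * (+ 2 - K)) + + 2 * (K - 1ℤ) ≡ -[1+ 1 ]
          e = solve-∀
        by-K (inj₂ 3≤K) = ThreeDefect.nonneg-defects⇒⊥ I K n≡ many (size≤-3 I many 3≤K)
          (size≤-3 (Incidence.dual I) (many-dual I many) 3≤K) (subst (0ℤ ≤_) (e K) 3≤K)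
          where
          e : ∀ K → K - (+ 2 + 1ℤ) ≡ K - + 3
          e = solve-∀

  -- Configurations and graphs

  𝟙-true : {P : Set} (P? : Dec P) → P → 𝟙 P? ≡ 1ℤ
  𝟙-true (yes _) _ = refl
  𝟙-true (no ¬p) p = ⊥-elim (¬p p)

  𝟙-reflects : {P : Set} (P? : Dec P) → 𝟙 P? ≡ 1ℤ → P
  𝟙-reflects (yes p) _ = p

  sum-unique≤1 : ∀ {n} {f : Fin n → ℤ} → (∀ i → ZeroOne (f i)) →
                 (∀ {i j} → f i ≡ 1ℤ → f j ≡ 1ℤ → i ≡ j) → sum f ≤ 1ℤ
  sum-unique≤1 {zero} _ _ = 0≤+
  sum-unique≤1 {suc n} {f} f-01 unique with f-01 zero
  ... | inj₁ f₀≡0 = subst (_≤ 1ℤ) (sym (trans (cong (_+ sum (f ∘ suc)) f₀≡0) (+-identityˡ _)))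
    (sum-unique≤1 (f-01 ∘ suc) λ e e′ → suc-inj (unique e e′))
    where
    suc-inj : ∀ {n} {i j : Fin n} → suc i ≡ suc j → i ≡ j
    suc-inj refl = refl
  ... | inj₂ f₀≡1 = ≤-reflexive (cong₂ _+_ f₀≡1 (trans (sum-cong tail≡0) (sum-0 n)))
    where
    tail≡0 : ∀ i → f (suc i) ≡ 0ℤ
    tail≡0 i with f-01 (suc i)
    ... | inj₁ e = e
    ... | inj₂ e with () ← unique f₀≡1 e

  record Configuration (n : ℕ) : Set₁ where
    field
      On : Fin n → Fin n → Set
      on? : ∀ p l → Dec (On p l)
      linear : ∀ {p q l m} → p ≢ q → On p l → On q l → On p m → On q m → l ≡ m

    incidence : Incidence n
    incidence = record
      { M = λ p l → 𝟙 (on? p l)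
      ; M-01 = λ p l → 𝟙-01 (on? p l)
      ; joint-≤1 = λ p q p≢q → sum-unique≤1 (λ l → 01-* (𝟙-01 (on? p l)) (𝟙-01 (on? q l)))
          λ {l} {m} e e′ → let (pl , ql) = both (on? p l) (on? q l) e ; (pm , qm) = both (on? p m) (on? q m) e′ in
            linear p≢q pl ql pm qm
      ; meet-≤1 = λ l m l≢m → sum-unique≤1 (λ p → 01-* (𝟙-01 (on? p l)) (𝟙-01 (on? p m)))
          λ {p} {q} e e′ → let (pl , pm) = both (on? p l) (on? p m) e ; (ql , qm) = both (on? q l) (on? q m) e′ in
            decidable-stable (p ≟ q) λ p≢q → l≢m (linear p≢q pl ql pm qm)
      }
      where
      both : {P Q : Set} (P? : Dec P) (Q? : Dec Q) → 𝟙 P? * 𝟙 Q? ≡ 1ℤ → P × Q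
      both (yes p) (yes q) _ = p , q

    open Incidence incidence public

  edges≡ : ∀ {n} (G : Subgraph n) → + edges G ≡ sum (λ u → sum (λ v → 𝟙 (v ∈? lookup G u)))
  edges≡ G = trans (sum-map G) (sum-cong λ u → size≡ (lookup G u))
    where
    sum-map : ∀ {m n} (H : Vec (Subset n) m) → + Vec.sum (Vec.map ∣_∣ H) ≡ sum (λ u → + ∣ lookup H u ∣)
    sum-map [] = refl
    sum-map (p ∷ H) = cong (λ t → + ∣ p ∣ + t) (sum-map H)
    size≡ : ∀ {n} (p : Subset n) → + ∣ p ∣ ≡ sum (λ v → 𝟙 (v ∈? p))
    size≡ [] = refl
    size≡ (true ∷ p) = cong (λ t → 1ℤ + t) (size≡ p)
    size≡ (false ∷ p) = trans (size≡ p) (sym (+-identityˡ _))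

  fromGraph : ∀ {n} (G : Subgraph n) → K₂₂-free G → Configuration n
  fromGraph G free = record
    { On = Adjacent G
    ; on? = λ u v → v ∈? lookup G u
    ; linear = λ {u} {u′} {v} {v′} u≢u′ uv u′v uv′ u′v′ → decidable-stable (v ≟ v′) λ v≢v′ →
        free (u , u′ , v , v′ , u≢u′ , v≢v′ , uv , uv′ , u′v , u′v′)
    }

  module _ {n : ℕ} (C : Configuration n) where

    open Configuration C

    toGraph : Subgraph n
    toGraph = tabulate λ u → tabulate λ v → does (on? u v)

    lookup-toGraph : ∀ u v → lookup (lookup toGraph u) v ≡ does (on? u v)
    lookup-toGraph u v = trans (cong (λ r → lookup r v) (lookup∘tabulate _ u)) (lookup∘tabulate _ v)

    adjacent⇒on : ∀ {u v} → Adjacent toGraph u v → On u v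
    adjacent⇒on {u} {v} uv = from-does (on? u v) (trans (sym (lookup-toGraph u v)) ([]=⇒lookup uv))
      where
      from-does : {P : Set} (P? : Dec P) → does P? ≡ true → P
      from-does (yes p) _ = p

    toGraph-free : K₂₂-free toGraph
    toGraph-free (u , u′ , v , v′ , u≢u′ , v≢v′ , uv , uv′ , u′v , u′v′) =
      v≢v′ (linear u≢u′ (adjacent⇒on uv) (adjacent⇒on u′v) (adjacent⇒on uv′) (adjacent⇒on u′v′))

    edges-toGraph : + edges toGraph ≡ incidences
    edges-toGraph = trans (edges≡ toGraph) (sum-cong λ u → sum-cong λ v → 𝟙-∈ u v (v ∈? lookup toGraph u) (on? u v) (lookup-toGraph u v))
      where
      𝟙-∈ : ∀ u v (a : Dec (v ∈ lookup toGraph u)) (b : Dec (On u v)) → lookup (lookup toGraph u) v ≡ does b → 𝟙 a ≡ 𝟙 b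
      𝟙-∈ u v (yes a) (yes b) _ = refl
      𝟙-∈ u v (no a) (no b) _ = refl
      𝟙-∈ u v (yes a) (no b) e = ⊥-elim (b (adjacent⇒on a))
      𝟙-∈ u v (no a) (yes b) e = ⊥-elim (a (lookup⇒[]= v _ e))

  zarankiewicz≡ : ∀ {n m b} → IsZarankiewicz n m →
    (∀ (C : Configuration n) → Configuration.incidences C ≤ b) →
    ∃ (λ (C : Configuration n) → b ≤ Configuration.incidences C) → + m ≡ b
  zarankiewicz≡ {b = b} ((G , free , refl) , maximal) upper (C , lower) = ≤-antisym
    (subst (_≤ b) (sym (edges≡ G)) (upper (fromGraph G free)))
    (≤-trans lower (subst (_≤ + edges G) (edges-toGraph C) (+≤+ (maximal (toGraph C) (toGraph-free C)))))

  survivor : ∀ {n} (i : Fin (suc n)) {j} → i ≢ j → ∃ λ (j′ : Fin n) → punchIn i j′ ≡ j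
  survivor i i≢j = punchOut i≢j , punchIn-punchOut i≢j

  module _ {n : ℕ} (C : Configuration (suc n)) (u v : Fin (suc n)) where

    open Configuration C

    delete : Configuration n
    delete = record
      { On = λ p l → On (punchIn u p) (punchIn v l)
      ; on? = λ p l → on? (punchIn u p) (punchIn v l)
      ; linear = λ {p} {q} {l} {m} p≢q pl ql pm qm → punchIn-injective v l m
          (linear (λ e → p≢q (punchIn-injective u p q e)) pl ql pm qm)
      }

    private module Del = Configuration delete

    degree-delete : ∀ p → Del.degree p ≡ degree (punchIn u p) - M (punchIn u p) v
    degree-delete p = trans (e (M (punchIn u p) v) (Del.degree p))
      (cong (_- M (punchIn u p) v) (sym (sum-remove {i = v} (M (punchIn u p)))))
      where
      e : ∀ a b → b ≡ a + b - a
      e = solve-∀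

    size-delete : ∀ l → Del.size l ≡ size (punchIn v l) - M u (punchIn v l)
    size-delete l = trans (e (M u (punchIn v l)) (Del.size l))
      (cong (_- M u (punchIn v l)) (sym (sum-remove {i = u} (λ p → M p (punchIn v l)))))
      where
      e : ∀ a b → b ≡ a + b - a
      e = solve-∀

    incidences-delete : Del.incidences ≡ incidences - degree u - size v + M u v
    incidences-delete = trans (sum-cong degree-delete)
      (trans (sum-- (λ p → degree (punchIn u p)) (λ p → M (punchIn u p) v))
        (trans (e (degree u) (sum (λ p → degree (punchIn u p))) (M u v) (sum (λ p → M (punchIn u p) v)))
          (cong₂ (λ a b → a - degree u - b + M u v) (sym (sum-remove {i = u} degree))
            (sym (sum-remove {i = u} (λ p → M p v))))))
      where
      e : ∀ d D m s → D - s ≡ d + D - d - (m + s) + m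
      e = solve-∀

  -- The sides `v₁`, `v₂`, `v₃` are `u₁u₂`, `u₁u₃`, `u₂u₃`. Deleting the first one, two or three
  -- pairs `uᵢ`, `vᵢ` costs at most 2d, 4d or 6d incidences, less the 1, 3 or 6 listed here among
  -- the deleted vertices and sides, each of which would be counted twice.
  record Triangle {n : ℕ} (C : Configuration n) (d : ℤ) : Set where
    open Configuration C
    field
      u₁ u₂ u₃ v₁ v₂ v₃ : Fin n
      u₁≢u₂ : u₁ ≢ u₂
      u₁≢u₃ : u₁ ≢ u₃
      u₂≢u₃ : u₂ ≢ u₃
      v₁≢v₂ : v₁ ≢ v₂
      v₁≢v₃ : v₁ ≢ v₃
      v₂≢v₃ : v₂ ≢ v₃
      u₁v₁ : On u₁ v₁
      u₂v₁ : On u₂ v₁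
      u₁v₂ : On u₁ v₂
      u₃v₂ : On u₃ v₂
      u₂v₃ : On u₂ v₃
      u₃v₃ : On u₃ v₃
      degree≤₁ : degree u₁ ≤ d
      degree≤₂ : degree u₂ ≤ d
      degree≤₃ : degree u₃ ≤ d
      size≤₁ : size v₁ ≤ d
      size≤₂ : size v₂ ≤ d
      size≤₃ : size v₃ ≤ d

  module _ {m : ℕ} (C : Configuration (suc (suc (suc m)))) {d : ℤ} (T : Triangle C d) where

    open Configuration C
    open Triangle T

    private
      on⇒1 : ∀ {p l} → On p l → M p l ≡ 1ℤ
      on⇒1 {p} {l} = 𝟙-true (on? p l)

      C₁ : Configuration (suc (suc m))
      C₁ = delete C u₁ v₁

      module C₁ = Configuration C₁

    deleteOne : ∃ λ (C′ : Configuration (suc (suc m))) → incidences - (+ 2 * d - 1ℤ) ≤ Configuration.incidences C′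
    deleteOne = C₁ , certify (gap degree≤₁ ⊹ gap size≤₁)
      (trans (cong (_- (incidences - (+ 2 * d - 1ℤ))) (trans (incidences-delete C u₁ v₁)
        (cong (λ t → incidences - degree u₁ - size v₁ + t) (on⇒1 u₁v₁)))) (e incidences d (degree u₁) (size v₁)))
      where
      e : ∀ i d a b → i - a - b + 1ℤ - (i - (+ 2 * d - 1ℤ)) ≡ d - a + (d - b)
      e = solve-∀

    private
      u₂′ : Fin (suc (suc m))
      u₂′ = proj₁ (survivor u₁ u₁≢u₂)
      u₂-eq : punchIn u₁ u₂′ ≡ u₂
      u₂-eq = proj₂ (survivor u₁ u₁≢u₂)
      u₃′ : Fin (suc (suc m))
      u₃′ = proj₁ (survivor u₁ u₁≢u₃)
      u₃-eq : punchIn u₁ u₃′ ≡ u₃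
      u₃-eq = proj₂ (survivor u₁ u₁≢u₃)
      v₂′ : Fin (suc (suc m))
      v₂′ = proj₁ (survivor v₁ v₁≢v₂)
      v₂-eq : punchIn v₁ v₂′ ≡ v₂
      v₂-eq = proj₂ (survivor v₁ v₁≢v₂)
      v₃′ : Fin (suc (suc m))
      v₃′ = proj₁ (survivor v₁ v₁≢v₃)
      v₃-eq : punchIn v₁ v₃′ ≡ v₃
      v₃-eq = proj₂ (survivor v₁ v₁≢v₃)

      C₂ : Configuration (suc m)
      C₂ = delete C₁ u₂′ v₂′

      module C₂ = Configuration C₂

      degree₂≤ : C₁.degree u₂′ ≤ d - 1ℤ
      degree₂≤ = subst (_≤ d - 1ℤ) (sym (trans (degree-delete C u₁ v₁ u₂′)
        (cong₂ _-_ (cong degree u₂-eq) (trans (cong (λ u → M u v₁) u₂-eq) (on⇒1 u₂v₁)))))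
        (+-monoˡ-≤ (- 1ℤ) degree≤₂)

      size₂≤ : C₁.size v₂′ ≤ d - 1ℤ
      size₂≤ = subst (_≤ d - 1ℤ) (sym (trans (size-delete C u₁ v₁ v₂′)
        (cong₂ _-_ (cong size v₂-eq) (trans (cong (λ v → M u₁ v) v₂-eq) (on⇒1 u₁v₂)))))
        (+-monoˡ-≤ (- 1ℤ) size≤₂)

      incidences₂ : C₁.incidences - (+ 2 * d - + 2) ≤ C₂.incidences
      incidences₂ = certify (gap degree₂≤ ⊹ gap size₂≤ ⊹ 01⇒0≤ (C₁.M-01 u₂′ v₂′))
        (trans (cong (_- (C₁.incidences - (+ 2 * d - + 2))) (incidences-delete C₁ u₂′ v₂′))
          (e C₁.incidences d (C₁.degree u₂′) (C₁.size v₂′) (C₁.M u₂′ v₂′)))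
        where
        e : ∀ i d a b m → i - a - b + m - (i - (+ 2 * d - + 2)) ≡ d - 1ℤ - a + (d - 1ℤ - b) + m
        e = solve-∀

    deleteTwo : ∃ λ (C′ : Configuration (suc m)) → incidences - (+ 4 * d - + 3) ≤ Configuration.incidences C′
    deleteTwo = C₂ , ≤-trans (subst (_≤ C₁.incidences - (+ 2 * d - + 2)) (e incidences d)
        (+-monoˡ-≤ (- (+ 2 * d - + 2)) (proj₂ deleteOne))) incidences₂
      where
      e : ∀ i d → i - (+ 2 * d - 1ℤ) - (+ 2 * d - + 2) ≡ i - (+ 4 * d - + 3)
      e = solve-∀

    private
      ≢′ : ∀ {n} {i : Fin (suc n)} {a b : Fin n} {j k} → punchIn i a ≡ j → punchIn i b ≡ k → j ≢ k → a ≢ b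
      ≢′ refl refl j≢k refl = j≢k refl

      u₃″ : Fin (suc m)
      u₃″ = proj₁ (survivor u₂′ (≢′ u₂-eq u₃-eq u₂≢u₃))
      u₃-eq′ : punchIn u₂′ u₃″ ≡ u₃′
      u₃-eq′ = proj₂ (survivor u₂′ (≢′ u₂-eq u₃-eq u₂≢u₃))
      v₃″ : Fin (suc m)
      v₃″ = proj₁ (survivor v₂′ (≢′ v₂-eq v₃-eq v₂≢v₃))
      v₃-eq′ : punchIn v₂′ v₃″ ≡ v₃′
      v₃-eq′ = proj₂ (survivor v₂′ (≢′ v₂-eq v₃-eq v₂≢v₃))

      degree₃≤ : C₂.degree u₃″ ≤ d - 1ℤ
      degree₃≤ = certify (01⇒0≤ (M-01 u₃ v₁) ⊹ gap degree≤₃) (trans (cong (λ t → d - 1ℤ - t) eq) (e d (degree u₃) (M u₃ v₁)))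
        where
        eq : C₂.degree u₃″ ≡ degree u₃ - M u₃ v₁ - 1ℤ
        eq = trans (degree-delete C₁ u₂′ v₂′ u₃″) (cong₂ _-_
          (trans (cong C₁.degree u₃-eq′) (trans (degree-delete C u₁ v₁ u₃′) (cong (λ u → degree u - M u v₁) u₃-eq)))
          (trans (cong (λ u → C₁.M u v₂′) u₃-eq′) (trans (cong₂ M u₃-eq v₂-eq) (on⇒1 u₃v₂))))
        e : ∀ d a m → d - 1ℤ - (a - m - 1ℤ) ≡ m + (d - a)
        e = solve-∀

      size₃≤ : C₂.size v₃″ ≤ d - 1ℤ
      size₃≤ = certify (01⇒0≤ (M-01 u₁ v₃) ⊹ gap size≤₃) (trans (cong (λ t → d - 1ℤ - t) eq) (e d (size v₃) (M u₁ v₃)))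
        where
        eq : C₂.size v₃″ ≡ size v₃ - M u₁ v₃ - 1ℤ
        eq = trans (size-delete C₁ u₂′ v₂′ v₃″) (cong₂ _-_
          (trans (cong C₁.size v₃-eq′) (trans (size-delete C u₁ v₁ v₃′) (cong (λ v → size v - M u₁ v) v₃-eq)))
          (trans (cong (λ v → C₁.M u₂′ v) v₃-eq′) (trans (cong₂ M u₂-eq v₃-eq) (on⇒1 u₂v₃))))
        e : ∀ d a m → d - 1ℤ - (a - m - 1ℤ) ≡ m + (d - a)
        e = solve-∀

      M₃≡1 : C₂.M u₃″ v₃″ ≡ 1ℤ
      M₃≡1 = trans (cong₂ C₁.M u₃-eq′ v₃-eq′) (trans (cong₂ M u₃-eq v₃-eq) (on⇒1 u₃v₃))

    deleteThree : ∃ λ (C′ : Configuration m) → incidences - (+ 6 * d - + 6) ≤ Configuration.incidences C′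
    deleteThree = delete C₂ u₃″ v₃″ , certify (gap (proj₂ deleteTwo) ⊹ gap degree₃≤ ⊹ gap size₃≤)
      (trans (cong (_- (incidences - (+ 6 * d - + 6))) (trans (incidences-delete C₂ u₃″ v₃″)
        (cong (λ t → C₂.incidences - C₂.degree u₃″ - C₂.size v₃″ + t) M₃≡1)))
        (e incidences d C₂.incidences (C₂.degree u₃″) (C₂.size v₃″)))
      where
      e : ∀ i d j a b → j - a - b + 1ℤ - (i - (+ 6 * d - + 6)) ≡ j - (i - (+ 4 * d - + 3)) + (d - 1ℤ - a) + (d - 1ℤ - b)
      e = solve-∀

  -- Projective planes

  sum-splitAt : ∀ m {n} (f : Fin m ⊎ Fin n → ℤ) →
                sum (λ i → f (splitAt m i)) ≡ sum (λ i → f (inj₁ i)) + sum (λ j → f (inj₂ j))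
  sum-splitAt zero f = sym (+-identityˡ _)
  sum-splitAt (suc m) f = trans (cong (λ t → f (inj₁ zero) + t) (sum-splitAt m (f ∘ Sum.map₁ suc)))
    (sym (+-assoc (f (inj₁ zero)) _ _))

  sum-quotRem : ∀ m {n} (f : Fin n × Fin m → ℤ) →
                sum (λ i → f (quotRem {m} n i)) ≡ sum (λ i → sum (λ j → f (j , i)))
  sum-quotRem zero f = refl
  sum-quotRem (suc m) {n} f = trans (sum-splitAt n {m ℕ.* n} (λ s → f ([ (λ j → j , zero) , Prod.map₂ suc ∘ quotRem {m} n ]′ s)))
    (cong (λ t → sum (λ j → f (j , zero)) + t) (sum-quotRem m (f ∘ Prod.map₂ suc)))

  sum-remQuot : ∀ m {n} (f : Fin m × Fin n → ℤ) →
                sum (λ i → f (remQuot {m} n i)) ≡ sum (λ i → sum (λ j → f (i , j)))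
  sum-remQuot m f = sum-quotRem m (f ∘ Prod.swap)

  -- The points at infinity are the common point of the vertical lines and one point for each
  -- slope; dually, the lines are the line at infinity, the vertical lines and the graphs.
  Element : ℕ → Set
  Element k = ⊤ ⊎ (Fin k ⊎ (Fin k × Fin k))

  pattern infinite = inj₁ tt
  pattern ideal m = inj₂ (inj₁ m)
  pattern affine x y = inj₂ (inj₂ (x , y))

  module _ (k : ℕ) where

    order : ℕ
    order = suc (k ℕ.+ k ℕ.* k)

    decode : Fin order → Element k
    decode i = Sum.map₂ (λ j → Sum.map₂ (remQuot {k} k) (splitAt k j)) (point (splitAt 1 i))
      where
      point : ∀ {A : Set} → Fin 1 ⊎ A → ⊤ ⊎ A
      point = Sum.map₁ (λ _ → tt)

    encode : Element k → Fin order
    encode infinite = zero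
    encode (inj₂ e) = suc (join k (k ℕ.* k) (Sum.map₂ (uncurry combine) e))

    decode-encode : ∀ e → decode (encode e) ≡ e
    decode-encode infinite = refl
    decode-encode (ideal m) = cong (λ s → inj₂ (Sum.map₂ (remQuot {k} k) s)) (splitAt-join k (k ℕ.* k) (inj₁ m))
    decode-encode (affine x y) = trans
      (cong (λ s → inj₂ (Sum.map₂ (remQuot {k} k) s)) (splitAt-join k (k ℕ.* k) (inj₂ (combine x y))))
      (cong (λ s → inj₂ (inj₂ s)) (remQuot-combine x y))

    encode-decode : ∀ i → encode (decode i) ≡ i
    encode-decode zero = refl
    encode-decode (suc i) = cong suc (trans (cong (join k (k ℕ.* k)) (inner (splitAt k i))) (join-splitAt k (k ℕ.* k) i))
      where
      inner : ∀ s → Sum.map₂ (uncurry combine) (Sum.map₂ (remQuot {k} k) s) ≡ s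
      inner (inj₁ m) = refl
      inner (inj₂ j) = cong inj₂ (combine-remQuot {k} k j)

    decode-injective : ∀ {i j} → decode i ≡ decode j → i ≡ j
    decode-injective {i} {j} e = trans (sym (encode-decode i)) (trans (cong encode e) (encode-decode j))

    sum-decode : (f : Element k → ℤ) → sum (λ i → f (decode i)) ≡
                 f infinite + (sum (λ m → f (ideal m)) + sum (λ x → sum (λ y → f (affine x y))))
    sum-decode f = cong (λ t → f infinite + t) (trans
      (sum-splitAt k {k ℕ.* k} (λ s → f (inj₂ (Sum.map₂ (remQuot {k} k) s))))
      (cong (λ t → sum (λ m → f (ideal m)) + t) (sum-remQuot k (λ e → f (inj₂ (inj₂ e))))))

  𝟙-sym : ∀ {n} (i j : Fin n) → 𝟙 (i ≟ j) ≡ 𝟙 (j ≟ i)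
  𝟙-sym i j with i ≟ j | j ≟ i
  ... | yes _ | yes _ = refl
  ... | no _ | no _ = refl
  ... | yes i≡j | no j≢i = ⊥-elim (j≢i (sym i≡j))
  ... | no i≢j | yes j≡i = ⊥-elim (i≢j (sym j≡i))

  sum-𝟙≟′ : ∀ {n} (i : Fin n) → sum (λ j → 𝟙 (j ≟ i)) ≡ 1ℤ
  sum-𝟙≟′ i = trans (sum-cong λ j → 𝟙-sym j i) (sum-𝟙≟ i)

  module _ {k : ℕ} (co : Coordinates k) where

    open Coordinates co

    data _liesOn_ : Element k → Element k → Set where
      infinite-infinite : infinite liesOn infinite
      infinite-vertical : ∀ {x} → infinite liesOn ideal x
      ideal-infinite    : ∀ {m} → ideal m liesOn infinite
      ideal-graph       : ∀ {m b} → ideal m liesOn affine m b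
      affine-vertical   : ∀ {x y} → affine x y liesOn ideal x
      affine-graph      : ∀ {m x b y} → line m x b ≡ y → affine x y liesOn affine m b

    _liesOn?_ : ∀ p l → Dec (p liesOn l)
    infinite liesOn? infinite = yes infinite-infinite
    infinite liesOn? ideal x = yes infinite-vertical
    infinite liesOn? affine m b = no λ ()
    ideal m liesOn? infinite = yes ideal-infinite
    ideal m liesOn? ideal x = no λ ()
    ideal m liesOn? affine m′ b = map′ (λ { refl → ideal-graph }) (λ { ideal-graph → refl }) (m ≟ m′)
    affine x y liesOn? infinite = no λ ()
    affine x y liesOn? ideal x′ = map′ (λ { refl → affine-vertical }) (λ { affine-vertical → refl }) (x ≟ x′)
    affine x y liesOn? affine m b = map′ affine-graph (λ { (affine-graph e) → e }) (line m x b ≟ y)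

    on-linear : ∀ {p q l m} → p ≢ q → p liesOn l → q liesOn l → p liesOn m → q liesOn m → l ≡ m
    on-linear p≢q infinite-infinite infinite-infinite _ _ = ⊥-elim (p≢q refl)
    on-linear p≢q infinite-infinite ideal-infinite infinite-infinite ideal-infinite = refl
    on-linear p≢q infinite-vertical infinite-vertical _ _ = ⊥-elim (p≢q refl)
    on-linear p≢q infinite-vertical affine-vertical infinite-vertical affine-vertical = refl
    on-linear p≢q ideal-infinite infinite-infinite ideal-infinite infinite-infinite = refl
    on-linear p≢q ideal-infinite ideal-infinite ideal-infinite ideal-infinite = refl
    on-linear p≢q ideal-infinite ideal-infinite ideal-graph ideal-graph = ⊥-elim (p≢q refl)
    on-linear p≢q ideal-graph ideal-graph _ _ = ⊥-elim (p≢q refl)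
    on-linear p≢q ideal-graph (affine-graph {m} {x} e) ideal-graph (affine-graph e′) =
      cong (λ b → affine m b) (line-injective m x (trans e (sym e′)))
    on-linear p≢q affine-vertical infinite-vertical affine-vertical infinite-vertical = refl
    on-linear p≢q affine-vertical affine-vertical affine-vertical affine-vertical = refl
    on-linear p≢q affine-vertical affine-vertical (affine-graph e) (affine-graph e′) =
      ⊥-elim (p≢q (cong (λ y → affine _ y) (trans (sym e) e′)))
    on-linear p≢q (affine-graph {m} {x} e) ideal-graph (affine-graph e′) ideal-graph =
      cong (λ b → affine m b) (line-injective m x (trans e (sym e′)))
    on-linear p≢q (affine-graph e) (affine-graph e′) affine-vertical affine-vertical =
      ⊥-elim (p≢q (cong (λ y → affine _ y) (trans (sym e) e′)))
    on-linear p≢q (affine-graph {m} {x} {b} e) (affine-graph {m} {x′} e′) (affine-graph {n} {x} {c} f) (affine-graph {n} {x′} f′)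
      with x ≟ x′
    ... | yes refl = ⊥-elim (p≢q (cong (λ y → affine x y) (trans (sym e) e′)))
    ... | no x≢x′ with slope-unique x≢x′ (trans e (sym f)) (trans e′ (sym f′))
    ...   | refl = cong (λ b → affine m b) (line-injective m x (trans e (sym f)))

    plane : Configuration (order k)
    plane = record
      { On = λ i j → decode k i liesOn decode k j
      ; on? = λ i j → decode k i liesOn? decode k j
      ; linear = λ p≢q pl ql pm qm → decode-injective k
          (on-linear (λ e → p≢q (decode-injective k e)) pl ql pm qm)
      }

    open Configuration plane

    private
      K : ℤ
      K = + k

      sum-sum-0 : sum {k} (λ _ → sum {k} (λ _ → 0ℤ)) ≡ 0ℤ
      sum-sum-0 = trans (sum-cong {k} {λ _ → sum {k} (λ _ → 0ℤ)} {λ _ → 0ℤ} (λ _ → sum-0 k)) (sum-0 k)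

      sum-sum-1 : (f : Fin k → Fin k → ℤ) → (∀ i → sum (f i) ≡ 1ℤ) → sum (λ i → sum (f i)) ≡ K
      sum-sum-1 f e = trans (sum-cong e) (sum-1 k)

      sum-sum-const : (f : Fin k → ℤ) → sum f ≡ 1ℤ → sum (λ i → sum {k} (λ _ → f i)) ≡ K
      sum-sum-const f e = trans (∑-comm {k} {k} (λ i _ → f i)) (sum-sum-1 (λ _ → f) (λ _ → e))

    lineSize : ∀ l → sum (λ i → 𝟙 (decode k i liesOn? l)) ≡ K + 1ℤ
    lineSize infinite = trans (sum-decode k (λ p → 𝟙 (p liesOn? infinite)))
      (trans (cong (λ t → 1ℤ + t) (cong₂ _+_ (sum-1 k) sum-sum-0)) (e K))
      where
      e : ∀ K → 1ℤ + (K + 0ℤ) ≡ K + 1ℤ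
      e = solve-∀
    lineSize (ideal x) = trans (sum-decode k (λ p → 𝟙 (p liesOn? ideal x)))
      (trans (cong (λ t → 1ℤ + t) (cong₂ _+_ (sum-0 k) (sum-sum-const (λ i → 𝟙 (i ≟ x)) (sum-𝟙≟′ x)))) (e K))
      where
      e : ∀ K → 1ℤ + (0ℤ + K) ≡ K + 1ℤ
      e = solve-∀
    lineSize (affine m b) = trans (sum-decode k (λ p → 𝟙 (p liesOn? affine m b)))
      (trans (cong (λ t → 0ℤ + t) (cong₂ _+_ (sum-𝟙≟′ m) (sum-sum-1 (λ x y → 𝟙 (line m x b ≟ y)) (λ x → sum-𝟙≟ (line m x b))))) (e K))
      where
      e : ∀ K → 0ℤ + (1ℤ + K) ≡ K + 1ℤ
      e = solve-∀

    -- For an affine point, `line-injective` supplies at most one graph of each slope through it. An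
    -- inequality is what the deletions use; the exact total of incidences comes from the line
    -- sizes.
    pointDegree : ∀ p → sum (λ j → 𝟙 (p liesOn? decode k j)) ≤ K + 1ℤ
    pointDegree infinite = ≤-reflexive (trans (sum-decode k (λ l → 𝟙 (infinite liesOn? l)))
      (trans (cong (λ t → 1ℤ + t) (cong₂ _+_ (sum-1 k) sum-sum-0)) (e K)))
      where
      e : ∀ K → 1ℤ + (K + 0ℤ) ≡ K + 1ℤ
      e = solve-∀
    pointDegree (ideal m) = ≤-reflexive (trans (sum-decode k (λ l → 𝟙 (ideal m liesOn? l)))
      (trans (cong (λ t → 1ℤ + t) (cong₂ _+_ (sum-0 k) (sum-sum-const (λ i → 𝟙 (m ≟ i)) (sum-𝟙≟ m)))) (e K)))
      where
      e : ∀ K → 1ℤ + (0ℤ + K) ≡ K + 1ℤ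
      e = solve-∀
    pointDegree (affine x y) = subst (_≤ K + 1ℤ) (sym (sum-decode k (λ l → 𝟙 (affine x y liesOn? l))))
      (subst₂ _≤_ (cong (λ t → 0ℤ + (t + S)) (sym (sum-𝟙≟ x))) (e K) (+-monoʳ-≤ 0ℤ (+-monoʳ-≤ 1ℤ graphs)))
      where
      S : ℤ
      S = sum (λ m → sum (λ b → 𝟙 (line m x b ≟ y)))
      graphs : S ≤ K
      graphs = sum-≤+ λ m → sum-unique≤1 (λ b → 𝟙-01 (line m x b ≟ y))
        λ {b} {b′} h h′ → line-injective m x (trans (𝟙-reflects (line m x b ≟ y) h) (sym (𝟙-reflects (line m x b′ ≟ y) h′)))
      e : ∀ K → 0ℤ + (1ℤ + K) ≡ K + 1ℤ
      e = solve-∀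

    plane-incidences : incidences ≡ + order k * (K + 1ℤ)
    plane-incidences = trans (sym sum-size) (trans (sum-cong λ j → trans (lineSize (decode k j)) (sym (*-identityʳ (K + 1ℤ))))
      (trans (sym (*-distribˡ-sum (K + 1ℤ) (λ (_ : Fin (order k)) → 1ℤ))) (trans (cong (λ t → (K + 1ℤ) * t) (sum-1 (order k))) (*-comm (K + 1ℤ) (+ order k)))))

    -- Two sides are the line at infinity and a vertical line, which meet in `infinite`; the third
    -- is a graph. For k = 1 this triangle is the whole plane, so nothing is left for h = 3.
    plane-triangle : Fin k → Triangle plane (K + 1ℤ)
    plane-triangle o = record
      { u₁ = encode k infinite ; u₂ = encode k (ideal o) ; u₃ = encode k (affine o (line o o o))
      ; v₁ = encode k infinite ; v₂ = encode k (ideal o) ; v₃ = encode k (affine o o)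
      ; u₁≢u₂ = λ () ; u₁≢u₃ = λ () ; u₂≢u₃ = distinct {ideal o} {affine o (line o o o)} λ ()
      ; v₁≢v₂ = λ () ; v₁≢v₃ = λ () ; v₂≢v₃ = distinct {ideal o} {affine o o} λ ()
      ; u₁v₁ = infinite-infinite
      ; u₂v₁ = on-encode ideal-infinite
      ; u₁v₂ = on-encode infinite-vertical
      ; u₃v₂ = on-encode affine-vertical
      ; u₂v₃ = on-encode ideal-graph
      ; u₃v₃ = on-encode (affine-graph refl)
      ; degree≤₁ = pointDegree infinite
      ; degree≤₂ = pointDegree (decode k (encode k (ideal o)))
      ; degree≤₃ = pointDegree (decode k (encode k (affine o (line o o o))))
      ; size≤₁ = ≤-reflexive (lineSize infinite)
      ; size≤₂ = ≤-reflexive (lineSize (decode k (encode k (ideal o))))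
      ; size≤₃ = ≤-reflexive (lineSize (decode k (encode k (affine o o))))
      }
      where
      distinct : ∀ {e f} → e ≢ f → encode k e ≢ encode k f
      distinct {e} {f} e≢f h = e≢f (trans (sym (decode-encode k e)) (trans (cong (decode k) h) (decode-encode k f)))
      on-encode : ∀ {e f} → e liesOn f → decode k (encode k e) liesOn decode k (encode k f)
      on-encode {e} {f} = subst₂ _liesOn_ (sym (decode-encode k e)) (sym (decode-encode k f))

-- Assembling the four values

open import Defs
open import Data.Nat using (ℕ; _+_; _*_; _∸_; _^_)
open import Data.Integer using (ℤ; +_) renaming (_+_ to _+ℤ_; _-_ to _-ℤ_)
open import Data.Product using (_×_)
open import Data.Sum using (_⊎_)
open import Relation.Binary.PropositionalEquality using (_≡_)
open import Data.Empty using (⊥-elim)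
open import Data.Fin.Base using (Fin; zero)
open import Data.Integer using (0ℤ; 1ℤ; -1ℤ; +≤+) renaming (_*_ to _*ℤ_; _≤_ to _≤ℤ_)
open import Data.Integer.Properties as ℤₚ using (pos-*)
open import Data.Integer.Tactic.RingSolver using (solve-∀)
open import Data.Nat using (suc; _≤_; s≤s; z≤n)
open import Data.Nat.Properties using (+-suc; +-comm; *-identityʳ)
open import Data.Product using (∃; _,_; proj₁; proj₂)
open import Data.Sum using (inj₁; inj₂)
open import Relation.Binary.PropositionalEquality using (refl; sym; trans; cong; cong₂; subst)
open import Relation.Nullary using (¬_)
open import Relation.Nullary.Decidable using (decidable-stable)
open FiniteDomains using (Coordinates; prime^>0)
open PrimePowerFields using (primePowerCoordinates)
open Counting

module _ (k : ℕ) (1≤k : 1 ≤ k) where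

  private
    K : ℤ
    K = + k

    1≤K : 0ℤ ≤ℤ K -ℤ 1ℤ
    1≤K = gap (+≤+ 1≤k)

  -- Being integers, the incidences either stay within the bound or exceed it by at least 1, and the
  -- latter is the case `Many` with `D` in place of `D + 1`.
  value : ∀ {n} D → (∀ I → ¬ Many {n} K 1≤K D I) →
          ∃ (λ (C : Configuration n) → + n *ℤ (K +ℤ 1ℤ) -ℤ (D +ℤ 1ℤ) ≤ℤ Configuration.incidences C) →
          + z n ≡ + n *ℤ (K +ℤ 1ℤ) -ℤ (D +ℤ 1ℤ)
  value {n} D not-many lower = zarankiewicz≡ (proj₂ (zarankiewicz n)) upper lower
    where
    upper : ∀ (C : Configuration n) → Configuration.incidences C ≤ℤ + n *ℤ (K +ℤ 1ℤ) -ℤ (D +ℤ 1ℤ)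
    upper C = by-size (dichotomy incidences (+ n *ℤ (K +ℤ 1ℤ) -ℤ (D +ℤ 1ℤ)))
      where
      open Configuration C
      by-size : incidences ≤ℤ + n *ℤ (K +ℤ 1ℤ) -ℤ (D +ℤ 1ℤ) ⊎
                0ℤ ≤ℤ incidences -ℤ (+ n *ℤ (K +ℤ 1ℤ) -ℤ (D +ℤ 1ℤ) +ℤ 1ℤ) → incidences ≤ℤ + n *ℤ (K +ℤ 1ℤ) -ℤ (D +ℤ 1ℤ)
      by-size (inj₁ h) = h
      by-size (inj₂ h) = ⊥-elim (not-many incidence (certify h (e incidences (+ n *ℤ (K +ℤ 1ℤ)) D)))
        where
        e : ∀ i a D → i -ℤ (a -ℤ D) ≡ i -ℤ (a -ℤ (D +ℤ 1ℤ) +ℤ 1ℤ)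
        e = solve-∀

  Values : ℕ → Set
  Values m =
    (+ z (suc (suc (suc m))) ≡ + suc (suc (suc m)) *ℤ (K +ℤ 1ℤ) -ℤ (-1ℤ +ℤ 1ℤ)) ×
    (+ z (suc (suc m)) ≡ + suc (suc m) *ℤ (K +ℤ 1ℤ) -ℤ (K -ℤ 1ℤ +ℤ 1ℤ)) ×
    (+ z (suc m) ≡ + suc m *ℤ (K +ℤ 1ℤ) -ℤ (+ 2 *ℤ K -ℤ + 2 +ℤ 1ℤ)) ×
    (+ z m ≡ + m *ℤ (K +ℤ 1ℤ) -ℤ (+ 3 *ℤ K -ℤ + 4 +ℤ 1ℤ))

  module _ {m : ℕ} (order≡ : + suc (suc (suc m)) ≡ K *ℤ K +ℤ K +ℤ 1ℤ) where

    m+2≡ : + suc (suc m) ≡ K *ℤ K +ℤ K +ℤ 1ℤ -ℤ + 1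
    m+2≡ = trans (e (+ suc (suc m))) (cong (_-ℤ + 1) order≡)
      where
      e : ∀ x → x ≡ 1ℤ +ℤ x -ℤ + 1
      e = solve-∀

    m+1≡ : + suc m ≡ K *ℤ K +ℤ K +ℤ 1ℤ -ℤ + 2
    m+1≡ = trans (e (+ suc m)) (cong (_-ℤ + 2) order≡)
      where
      e : ∀ x → x ≡ + 2 +ℤ x -ℤ + 2
      e = solve-∀

    m≡ : + m ≡ K *ℤ K +ℤ K +ℤ 1ℤ -ℤ + 3
    m≡ = trans (e (+ m)) (cong (_-ℤ + 3) order≡)
      where
      e : ∀ x → x ≡ + 3 +ℤ x -ℤ + 3
      e = solve-∀

    values : (C : Configuration (suc (suc (suc m)))) → Triangle C (K +ℤ 1ℤ) →
             Configuration.incidences C ≡ + suc (suc (suc m)) *ℤ (K +ℤ 1ℤ) → Values m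
    values C T inc≡ =
      value -1ℤ (not-many-0 K 1≤K (trans order≡ (sym (ℤₚ.+-identityʳ _))))
        (C , ℤₚ.≤-reflexive (trans (ℤₚ.+-identityʳ _) (sym inc≡))) ,
      value (K -ℤ 1ℤ) (not-many-1 K 1≤K m+2≡) (proj₁ one , ℤₚ.≤-trans (ℤₚ.≤-reflexive (trans
        (cong (λ n → n *ℤ (K +ℤ 1ℤ) -ℤ (K -ℤ 1ℤ +ℤ 1ℤ)) m+2≡) (trans (e₁ K) (cong (_-ℤ (+ 2 *ℤ (K +ℤ 1ℤ) -ℤ 1ℤ)) inc-eq)))) (proj₂ one)) ,
      value (+ 2 *ℤ K -ℤ + 2) (not-many-2 K 1≤K m+1≡) (proj₁ two , ℤₚ.≤-trans (ℤₚ.≤-reflexive (trans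
        (cong (λ n → n *ℤ (K +ℤ 1ℤ) -ℤ (+ 2 *ℤ K -ℤ + 2 +ℤ 1ℤ)) m+1≡) (trans (e₂ K) (cong (_-ℤ (+ 4 *ℤ (K +ℤ 1ℤ) -ℤ + 3)) inc-eq)))) (proj₂ two)) ,
      value (+ 3 *ℤ K -ℤ + 4) (not-many-3 K 1≤K m≡) (proj₁ three , ℤₚ.≤-trans (ℤₚ.≤-reflexive (trans
        (cong (λ n → n *ℤ (K +ℤ 1ℤ) -ℤ (+ 3 *ℤ K -ℤ + 4 +ℤ 1ℤ)) m≡) (trans (e₃ K) (cong (_-ℤ (+ 6 *ℤ (K +ℤ 1ℤ) -ℤ + 6)) inc-eq)))) (proj₂ three))
      where
      one = deleteOne C T
      two = deleteTwo C T
      three = deleteThree C T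
      inc-eq : (K *ℤ K +ℤ K +ℤ 1ℤ) *ℤ (K +ℤ 1ℤ) ≡ Configuration.incidences C
      inc-eq = trans (cong (_*ℤ (K +ℤ 1ℤ)) (sym order≡)) (sym inc≡)
      e₁ : ∀ K → (K *ℤ K +ℤ K +ℤ 1ℤ -ℤ + 1) *ℤ (K +ℤ 1ℤ) -ℤ (K -ℤ 1ℤ +ℤ 1ℤ) ≡
                 (K *ℤ K +ℤ K +ℤ 1ℤ) *ℤ (K +ℤ 1ℤ) -ℤ (+ 2 *ℤ (K +ℤ 1ℤ) -ℤ 1ℤ)
      e₁ = solve-∀
      e₂ : ∀ K → (K *ℤ K +ℤ K +ℤ 1ℤ -ℤ + 2) *ℤ (K +ℤ 1ℤ) -ℤ (+ 2 *ℤ K -ℤ + 2 +ℤ 1ℤ) ≡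
                 (K *ℤ K +ℤ K +ℤ 1ℤ) *ℤ (K +ℤ 1ℤ) -ℤ (+ 4 *ℤ (K +ℤ 1ℤ) -ℤ + 3)
      e₂ = solve-∀
      e₃ : ∀ K → (K *ℤ K +ℤ K +ℤ 1ℤ -ℤ + 3) *ℤ (K +ℤ 1ℤ) -ℤ (+ 3 *ℤ K -ℤ + 4 +ℤ 1ℤ) ≡
                 (K *ℤ K +ℤ K +ℤ 1ℤ) *ℤ (K +ℤ 1ℤ) -ℤ (+ 6 *ℤ (K +ℤ 1ℤ) -ℤ + 6)
      e₃ = solve-∀

  k²≡ : + (k ^ 2) ≡ K *ℤ K
  k²≡ = trans (pos-* k (k * 1)) (cong (λ t → K *ℤ + t) (*-identityʳ k))

  k³≡ : + (k ^ 3) ≡ K *ℤ (K *ℤ K)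
  k³≡ = trans (pos-* k (k ^ 2)) (cong (K *ℤ_) k²≡)

  k³+2k²≡ : + (k ^ 3 + 2 * k ^ 2) ≡ K *ℤ (K *ℤ K) +ℤ + 2 *ℤ (K *ℤ K)
  k³+2k²≡ = cong₂ _+ℤ_ k³≡ (trans (pos-* 2 (k ^ 2)) (cong (+ 2 *ℤ_) k²≡))

  Claim : ℕ → Set
  Claim n =
    (+ z (n ∸ 0) ≡ + (k ^ 3 + 2 * k ^ 2 + 2 * k + 1)) ×
    (+ z (n ∸ 1) ≡ + (k ^ 3 + 2 * k ^ 2)) ×
    (+ z (n ∸ 2) ≡ + (k ^ 3 + 2 * k ^ 2) -ℤ + (2 * k)) ×
    (+ z (n ∸ 3) ≡ + (k ^ 3 + 2 * k ^ 2) -ℤ + (4 * k) +ℤ + 1)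

  fromCoordinates : Coordinates k → Claim (k ^ 2 + k + 1)
  fromCoordinates co = conclude (order k) (shape k 1≤k) order≡ (plane co) (plane-triangle co (element k 1≤k)) (plane-incidences co)
    where
    element : ∀ k → 1 ≤ k → Fin k
    element (suc k) _ = zero
    shape : ∀ k → 1 ≤ k → ∃ λ m → order k ≡ suc (suc (suc m))
    shape (suc j) _ = j + (j + j * suc j) , cong (λ t → suc (suc t)) (+-suc j (j + j * suc j))
    order≡ : order k ≡ k ^ 2 + k + 1
    order≡ = trans (cong suc (trans (+-comm k (k * k)) (cong (λ t → k * t + k) (sym (*-identityʳ k))))) (+-comm 1 (k ^ 2 + k))
    -- The order is generalised to `n` so that it can be replaced by a threefold successor, the form
    -- in which three vertices can be deleted.
    conclude : ∀ n → ∃ (λ m → n ≡ suc (suc (suc m))) → n ≡ k ^ 2 + k + 1 → (C : Configuration n) →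
               Triangle C (K +ℤ 1ℤ) → Configuration.incidences C ≡ + n *ℤ (K +ℤ 1ℤ) → Claim (k ^ 2 + k + 1)
    conclude _ (m , refl) n≡ C T inc≡ = let (v₀ , v₁ , v₂ , v₃) = values N≡ C T inc≡ in
      subst Claim n≡ (trans v₀ r₀ , trans v₁ r₁ , trans v₂ r₂ , trans v₃ r₃)
      where
      N≡ : + suc (suc (suc m)) ≡ K *ℤ K +ℤ K +ℤ 1ℤ
      N≡ = trans (cong +_ n≡) (cong (λ t → t +ℤ K +ℤ 1ℤ) k²≡)
      r₀ : + suc (suc (suc m)) *ℤ (K +ℤ 1ℤ) -ℤ (-1ℤ +ℤ 1ℤ) ≡ + (k ^ 3 + 2 * k ^ 2 + 2 * k + 1)
      r₀ = trans (cong (λ n → n *ℤ (K +ℤ 1ℤ) -ℤ (-1ℤ +ℤ 1ℤ)) N≡) (trans (e K)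
        (cong₂ (λ a b → a +ℤ b +ℤ 1ℤ) (sym k³+2k²≡) (sym (pos-* 2 k))))
        where
        e : ∀ K → (K *ℤ K +ℤ K +ℤ 1ℤ) *ℤ (K +ℤ 1ℤ) -ℤ (-1ℤ +ℤ 1ℤ) ≡ K *ℤ (K *ℤ K) +ℤ + 2 *ℤ (K *ℤ K) +ℤ + 2 *ℤ K +ℤ 1ℤ
        e = solve-∀
      r₁ : + suc (suc m) *ℤ (K +ℤ 1ℤ) -ℤ (K -ℤ 1ℤ +ℤ 1ℤ) ≡ + (k ^ 3 + 2 * k ^ 2)
      r₁ = trans (cong (λ n → n *ℤ (K +ℤ 1ℤ) -ℤ (K -ℤ 1ℤ +ℤ 1ℤ)) (m+2≡ N≡)) (trans (e K) (sym k³+2k²≡))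
        where
        e : ∀ K → (K *ℤ K +ℤ K +ℤ 1ℤ -ℤ + 1) *ℤ (K +ℤ 1ℤ) -ℤ (K -ℤ 1ℤ +ℤ 1ℤ) ≡ K *ℤ (K *ℤ K) +ℤ + 2 *ℤ (K *ℤ K)
        e = solve-∀
      r₂ : + suc m *ℤ (K +ℤ 1ℤ) -ℤ (+ 2 *ℤ K -ℤ + 2 +ℤ 1ℤ) ≡ + (k ^ 3 + 2 * k ^ 2) -ℤ + (2 * k)
      r₂ = trans (cong (λ n → n *ℤ (K +ℤ 1ℤ) -ℤ (+ 2 *ℤ K -ℤ + 2 +ℤ 1ℤ)) (m+1≡ N≡)) (trans (e K)
        (cong₂ _-ℤ_ (sym k³+2k²≡) (sym (pos-* 2 k))))
        where
        e : ∀ K → (K *ℤ K +ℤ K +ℤ 1ℤ -ℤ + 2) *ℤ (K +ℤ 1ℤ) -ℤ (+ 2 *ℤ K -ℤ + 2 +ℤ 1ℤ) ≡ K *ℤ (K *ℤ K) +ℤ + 2 *ℤ (K *ℤ K) -ℤ + 2 *ℤ K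
        e = solve-∀
      r₃ : + m *ℤ (K +ℤ 1ℤ) -ℤ (+ 3 *ℤ K -ℤ + 4 +ℤ 1ℤ) ≡ + (k ^ 3 + 2 * k ^ 2) -ℤ + (4 * k) +ℤ + 1
      r₃ = trans (cong (λ n → n *ℤ (K +ℤ 1ℤ) -ℤ (+ 3 *ℤ K -ℤ + 4 +ℤ 1ℤ)) (m≡ N≡)) (trans (e K)
        (cong₂ (λ a b → a -ℤ b +ℤ + 1) (sym k³+2k²≡) (sym (pos-* 4 k))))
        where
        e : ∀ K → (K *ℤ K +ℤ K +ℤ 1ℤ -ℤ + 3) *ℤ (K +ℤ 1ℤ) -ℤ (+ 3 *ℤ K -ℤ + 4 +ℤ 1ℤ) ≡ K *ℤ (K *ℤ K) +ℤ + 2 *ℤ (K *ℤ K) -ℤ + 4 *ℤ K +ℤ + 1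
        e = solve-∀

trivialCoordinates : Coordinates 1
trivialCoordinates = record
  { line = λ _ _ _ → zero
  ; line-injective = λ { _ _ {zero} {zero} _ → refl }
  ; slope-unique = λ { {zero} {zero} _ _ _ → refl }
  }

coordinates : ∀ {k} → PrimePower k ⊎ k ≡ 1 → ¬ ¬ Coordinates k
coordinates (inj₁ (p , a , pr , 1≤a , refl)) = primePowerCoordinates pr 1≤a
coordinates (inj₂ refl) none = none trivialCoordinates

positive : ∀ {k} → PrimePower k ⊎ k ≡ 1 → 1 ≤ k
positive (inj₁ (p , a , pr , 1≤a , refl)) = prime^>0 pr a
positive (inj₂ refl) = s≤s z≤n

theorem4 : (k : ℕ) → PrimePower k ⊎ k ≡ 1 →
    (+ z (k ^ 2 + k + 1 ∸ 0) ≡ + (k ^ 3 + 2 * k ^ 2 + 2 * k + 1)) ×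
    (+ z (k ^ 2 + k + 1 ∸ 1) ≡ + (k ^ 3 + 2 * k ^ 2)) ×
    (+ z (k ^ 2 + k + 1 ∸ 2) ≡ + (k ^ 3 + 2 * k ^ 2) -ℤ + (2 * k)) ×
    (+ z (k ^ 2 + k + 1 ∸ 3) ≡ + (k ^ 3 + 2 * k ^ 2) -ℤ + (4 * k) +ℤ + 1)
theorem4 k k-pp = stable proj₁ , stable (λ c → proj₁ (proj₂ c)) ,
    stable (λ c → proj₁ (proj₂ (proj₂ c))) , stable (λ c → proj₂ (proj₂ (proj₂ c)))
  where
  stable : ∀ {a b : ℤ} → (Claim k (positive k-pp) (k ^ 2 + k + 1) → a ≡ b) → a ≡ b
  stable {a} {b} select = decidable-stable (a ℤₚ.≟ b) λ a≢b →
    coordinates k-pp λ co → a≢b (select (fromCoordinates k (positive k-pp) co))
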